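{- There exists an absolute constant $c'>0$ such that for every integer $d\ge 2$, every finite simple $d$-regular graph contains a star factor in which every star has at least $c' d/\log d$ edges. This is optimal up to the value of the constant $c'$: there exists an absolute constant $C'>0$ such that for every integer $d\ge 2$ there is a finite simple $d$-regular graph $G$ with at least one vertex such that every star factor of $G$ contains a star with at most $C' d/\log d$ edges.
   Context: All graphs are finite and simple. A star is a tree with one vertex, the center, adjacent to all the other vertices, which are called leaves. A star factor of a graph $G$ is a spanning forest of $G$ (a subgraph of $G$ that is a forest and contains all vertices of $G$) in which every connected component is a star. The logarithm $\log$ is in the natural base. -}

module Defs where

open import Data.Bool using (Bool; false; T; T?)
open import Data.Fin.Base as Fin using (Fin; zero; suc; inject₁; fromℕ)
import Data.Fin.Properties as Fin
open import Data.Fin.Subset using (Subset; _∈_; ∣_∣)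
open import Data.Fin.Subset.Properties using (_∈?_)
open import Data.Integer.Base as ℤ using (+_; -[1+_]; +[1+_])
import Data.Integer.Properties as ℤ
import Data.Integer.Solver as ℤ
open import Data.List.Base using (allFin; cartesianProduct; filter; length)
open import Data.Nat.Base as ℕ using (ℕ; zero; suc; z≤n; s≤s; NonZero)
import Data.Nat.Properties as ℕ
open import Data.Nat.Coprimality using (1-coprimeTo)
open import Data.Product using (∃; ∃-syntax; _×_; _,_; proj₁; proj₂)
open import Data.Rational.Base as ℚ
  using (ℚ; mkℚ; 0ℚ; 1ℚ; _+_; _-_; _*_; -_; _/_; 1/_; _≤_; _<_; *≤*; *<*)
  renaming (∣_∣ to abs)
import Data.Rational.Properties as ℚ
import Data.Rational.Unnormalised.Base as ℚᵘ
import Data.Rational.Unnormalised.Properties as ℚᵘ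
open import Data.Rational.Solver using (module +-*-Solver)
open import Data.Sum using (inj₁; inj₂)
open import Data.Vec.Base using (tabulate)
open import Function.Bundles using (_⇔_)
open import Function.Definitions using (Injective)
open import Relation.Binary.Construct.Closure.ReflexiveTransitive using (Star)
open import Relation.Binary.PropositionalEquality
  using (_≡_; _≢_; refl; sym; trans; cong; cong₂; subst; subst₂)
open import Relation.Nullary using (¬_; yes; no; contradiction)
open import Relation.Nullary.Decidable using (_×-dec_)

Cauchy : (ℕ → ℚ) → Set
Cauchy x = ∀ ε → 0ℚ < ε →
  ∃[ N ] (∀ m n → N ℕ.≤ m → N ℕ.≤ n → abs (x m - x n) ≤ ε)

-- Equality of reals is x ≤ʳ y together with y ≤ʳ x; it is not needed here.
record ℝ : Set where
  constructor real
  field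
    seq    : ℕ → ℚ
    cauchy : Cauchy seq

open ℝ public

infix 4 _≤ʳ_ _<ʳ_

-- The order of the limits, not the pointwise order of the sequences.
_≤ʳ_ : ℝ → ℝ → Set
x ≤ʳ y = ∀ ε → 0ℚ < ε → ∃[ N ] (∀ n → N ℕ.≤ n → seq x n ≤ seq y n + ε)

_<ʳ_ : ℝ → ℝ → Set
x <ʳ y = ∃[ ε ] 0ℚ < ε × ∃[ N ] (∀ n → N ℕ.≤ n → seq x n + ε ≤ seq y n)

fromℚ : ℚ → ℝ
fromℚ q = real (λ _ → q) λ ε ε>0 → 0 , λ _ _ _ _ →
  subst (λ z → abs z ≤ ε) (sym (ℚ.+-inverseʳ q)) (ℚ.<⇒≤ ε>0)

fromNat : ℕ → ℝ
fromNat n = fromℚ (+ n / 1)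

0ʳ : ℝ
0ʳ = fromℚ 0ℚ

0<* : ∀ {p q} → 0ℚ < p → 0ℚ < q → 0ℚ < p * q
0<* {p} {q} p>0 q>0 =
  let instance _ = ℚ.positive p>0
               _ = ℚ.positive q>0
  in ℚ.positive⁻¹ (p * q) {{ℚ.pos*pos⇒pos p q}}

0<recip : ∀ {p} (p>0 : 0ℚ < p) → 0ℚ < (1/ p) {{ℚ.>-nonZero p>0}}
0<recip {p} p>0 = ℚ.positive⁻¹ _ {{ℚ.1/pos⇒pos p {{ℚ.positive p>0}}}}

*-mono-≤-0≤ : ∀ {p q r s} → 0ℚ ≤ r → 0ℚ ≤ q → p ≤ q → r ≤ s → p * r ≤ q * s
*-mono-≤-0≤ {p} {q} {r} {s} 0≤r 0≤q p≤q r≤s =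
  ℚ.≤-trans (ℚ.*-monoʳ-≤-nonNeg r {{ℚ.nonNegative 0≤r}} p≤q)
            (ℚ.*-monoˡ-≤-nonNeg q {{ℚ.nonNegative 0≤q}} r≤s)

≤-diff : ∀ {p q r} → p ≤ q + r → p - q ≤ r
≤-diff {p} {q} {r} p≤q+r =
  subst (p - q ≤_) (solve 2 (λ q r → (q :+ r) :- q := r) refl q r)
    (ℚ.+-monoˡ-≤ (- q) p≤q+r)
  where open +-*-Solver

abs-≤ : ∀ {p q r} → p ≤ q + r → q ≤ p + r → abs (p - q) ≤ r
abs-≤ {p} {q} {r} p≤ q≤ with ℚ.∣p∣≡p∨∣p∣≡-p (p - q)
... | inj₁ eq = subst (_≤ r) (sym eq) (≤-diff p≤)
... | inj₂ eq = subst (_≤ r)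
  (trans (solve 2 (λ p q → q :- p := :- (p :- q)) refl p q) (sym eq)) (≤-diff q≤)
  where open +-*-Solver

bounded : (x : ℝ) → ∃[ N ] ∃[ B ] 0ℚ < B × (∀ n → N ℕ.≤ n → abs (seq x n) ≤ B)
bounded x = let (N , h) = cauchy x 1ℚ 0<1 in
  N , 1ℚ + abs (seq x N) ,
  ℚ.<-≤-trans 0<1 (ℚ.≤-trans (ℚ.≤-reflexive (sym (ℚ.+-identityʳ 1ℚ)))
                              (ℚ.+-monoʳ-≤ 1ℚ (ℚ.0≤∣p∣ (seq x N)))) ,
  λ n N≤n → ℚ.≤-trans
    (subst (λ z → abs z ≤ abs (seq x n - seq x N) + abs (seq x N))
       (solve 2 (λ a b → (a :- b) :+ b := a) refl (seq x n) (seq x N))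
       (ℚ.∣p+q∣≤∣p∣+∣q∣ (seq x n - seq x N) (seq x N)))
    (ℚ.+-monoˡ-≤ (abs (seq x N)) (h n N N≤n ℕ.≤-refl))
  where
  open +-*-Solver
  0<1 : 0ℚ < 1ℚ
  0<1 = ℚ.positive⁻¹ 1ℚ

infixl 7 _*ʳ_

_*ʳ_ : ℝ → ℝ → ℝ
x *ʳ y = real (λ n → seq x n * seq y n) cau
  where
  open +-*-Solver
  cau : Cauchy (λ n → seq x n * seq y n)
  cau ε ε>0 = N , λ m n N≤m N≤n →
    let a = seq x m; b = seq x n; c = seq y m; d = seq y n
        lt₁ : N₁ ℕ.≤ m
        lt₁ = ℕ.≤-trans (ℕ.m≤m⊔n N₁ N₂) (ℕ.≤-trans (ℕ.m≤m⊔n (N₁ ℕ.⊔ N₂) (N₃ ℕ.⊔ N₄)) N≤m)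
        lt₂ : N₂ ℕ.≤ n
        lt₂ = ℕ.≤-trans (ℕ.m≤n⊔m N₁ N₂) (ℕ.≤-trans (ℕ.m≤m⊔n (N₁ ℕ.⊔ N₂) (N₃ ℕ.⊔ N₄)) N≤n)
        up₃ : N₃ ℕ.≤ N
        up₃ = ℕ.≤-trans (ℕ.m≤m⊔n N₃ N₄) (ℕ.m≤n⊔m (N₁ ℕ.⊔ N₂) (N₃ ℕ.⊔ N₄))
        up₄ : N₄ ℕ.≤ N
        up₄ = ℕ.≤-trans (ℕ.m≤n⊔m N₃ N₄) (ℕ.m≤n⊔m (N₁ ℕ.⊔ N₂) (N₃ ℕ.⊔ N₄))
        t₁ : abs (a * (c - d)) ≤ A * δ
        t₁ = subst (_≤ A * δ) (sym (ℚ.∣p*q∣≡∣p∣*∣q∣ a (c - d)))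
               (*-mono-≤-0≤ (ℚ.0≤∣p∣ (c - d)) (ℚ.<⇒≤ A>0) (hA m lt₁)
                  (hy m n (ℕ.≤-trans up₄ N≤m) (ℕ.≤-trans up₄ N≤n)))
        t₂ : abs (d * (a - b)) ≤ B * δ
        t₂ = subst (_≤ B * δ) (sym (ℚ.∣p*q∣≡∣p∣*∣q∣ d (a - b)))
               (*-mono-≤-0≤ (ℚ.0≤∣p∣ (a - b)) (ℚ.<⇒≤ B>0) (hB n lt₂)
                  (hx m n (ℕ.≤-trans up₃ N≤m) (ℕ.≤-trans up₃ N≤n)))
    in subst₂ _≤_
         (cong abs (solve 4 (λ a b c d → a :* (c :- d) :+ d :* (a :- b) := a :* c :- b :* d)
                      refl a b c d))
         total
         (ℚ.≤-trans (ℚ.∣p+q∣≤∣p∣+∣q∣ (a * (c - d)) (d * (a - b))) (ℚ.+-mono-≤ t₁ t₂))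
    where
    bx = bounded x
    by = bounded y
    N₁ = proj₁ bx
    A = proj₁ (proj₂ bx)
    A>0 = proj₁ (proj₂ (proj₂ bx))
    hA = proj₂ (proj₂ (proj₂ bx))
    N₂ = proj₁ by
    B = proj₁ (proj₂ by)
    B>0 = proj₁ (proj₂ (proj₂ by))
    hB = proj₂ (proj₂ (proj₂ by))
    A+B>0 : 0ℚ < A + B
    A+B>0 = ℚ.+-mono-< A>0 B>0
    instance
      A+B≢0 : ℚ.NonZero (A + B)
      A+B≢0 = ℚ.>-nonZero A+B>0
    δ = ε * (1/ (A + B))
    δ>0 : 0ℚ < δ
    δ>0 = 0<* ε>0 (0<recip A+B>0)
    cx = cauchy x δ δ>0
    cy = cauchy y δ δ>0
    N₃ = proj₁ cx
    hx = proj₂ cx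
    N₄ = proj₁ cy
    hy = proj₂ cy
    N = (N₁ ℕ.⊔ N₂) ℕ.⊔ (N₃ ℕ.⊔ N₄)
    total : A * δ + B * δ ≡ ε
    total = trans
      (solve 4 (λ a b e r → a :* (e :* r) :+ b :* (e :* r) := e :* ((a :+ b) :* r))
         refl A B ε (1/ (A + B)))
      (trans (cong (ε *_) (ℚ.*-inverseʳ (A + B))) (ℚ.*-identityʳ ε))

-- The value at 0 is a convention; a positive real has only finitely many
-- terms on which it is used.
recip : ℚ → ℚ
recip q with q ℚ.≟ 0ℚ
... | yes _   = 0ℚ
... | no  q≢0 = (1/ q) {{ℚ.≢-nonZero q≢0}}

recip-inverse : ∀ {q} → 0ℚ < q → q * recip q ≡ 1ℚ
recip-inverse {q} q>0 with q ℚ.≟ 0ℚ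
... | yes q≡0 = contradiction (sym q≡0) (ℚ.<⇒≢ q>0)
... | no  q≢0 = ℚ.*-inverseʳ q {{ℚ.≢-nonZero q≢0}}

recip-pos : ∀ {q} → 0ℚ < q → 0ℚ < recip q
recip-pos {q} q>0 with q ℚ.≟ 0ℚ
... | yes q≡0 = contradiction (sym q≡0) (ℚ.<⇒≢ q>0)
... | no  q≢0 = 0<recip q>0

recip-anti : ∀ {p q} → 0ℚ < p → p ≤ q → recip q ≤ recip p
recip-anti {p} {q} p>0 p≤q = subst₂ _≤_ lhs rhs
  (*-mono-≤-0≤ {p} {q} {recip p * recip q} {recip p * recip q} (ℚ.<⇒≤ pq>0) (ℚ.<⇒≤ q>0) p≤q ℚ.≤-refl)
  where
  open +-*-Solver
  q>0 = ℚ.<-≤-trans p>0 p≤q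
  pq>0 = 0<* (recip-pos p>0) (recip-pos q>0)
  lhs : p * (recip p * recip q) ≡ recip q
  lhs = trans (solve 3 (λ p a b → p :* (a :* b) := (p :* a) :* b) refl p (recip p) (recip q))
          (trans (cong (_* recip q) (recip-inverse p>0)) (ℚ.*-identityˡ _))
  rhs : q * (recip p * recip q) ≡ recip p
  rhs = trans (solve 3 (λ q a b → q :* (a :* b) := (q :* b) :* a) refl q (recip p) (recip q))
          (trans (cong (_* recip p) (recip-inverse q>0)) (ℚ.*-identityˡ _))

recipʳ : (y : ℝ) → 0ʳ <ʳ y → ℝ
recipʳ y (η , η>0 , N₀ , hη) = real (λ n → recip (seq y n)) cau
  where
  open +-*-Solver
  cau : Cauchy (λ n → recip (seq y n))
  cau ε ε>0 = N₀ ℕ.⊔ N₁ , λ m n N≤m N≤n →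
    let a = seq y m; b = seq y n
        η≤a = η≤ m (ℕ.≤-trans (ℕ.m≤m⊔n N₀ N₁) N≤m)
        η≤b = η≤ n (ℕ.≤-trans (ℕ.m≤m⊔n N₀ N₁) N≤n)
        a>0 = ℚ.<-≤-trans η>0 η≤a
        b>0 = ℚ.<-≤-trans η>0 η≤b
        ra≥0 = ℚ.<⇒≤ (recip-pos a>0)
        rb≥0 = ℚ.<⇒≤ (recip-pos b>0)
        rη≥0 = ℚ.<⇒≤ (recip-pos η>0)
        le₁ : recip a * recip b ≤ recip η * recip η
        le₁ = *-mono-≤-0≤ rb≥0 rη≥0 (recip-anti η>0 η≤a) (recip-anti η>0 η≤b)
        rarb>0 = 0<* (recip-pos a>0) (recip-pos b>0)
        le₂ : abs (b - a) * (recip a * recip b) ≤ δ * (recip η * recip η)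
        le₂ = *-mono-≤-0≤ (ℚ.<⇒≤ rarb>0) (ℚ.<⇒≤ δ>0)
                (hy n m (ℕ.≤-trans (ℕ.m≤n⊔m N₀ N₁) N≤n) (ℕ.≤-trans (ℕ.m≤n⊔m N₀ N₁) N≤m)) le₁
        eq : abs (b - a) * (recip a * recip b) ≡ abs (recip a - recip b)
        eq = trans (cong (abs (b - a) *_) (sym (ℚ.0≤p⇒∣p∣≡p (ℚ.<⇒≤ rarb>0))))
               (trans (sym (ℚ.∣p*q∣≡∣p∣*∣q∣ (b - a) (recip a * recip b)))
                 (cong abs (trans
                   (solve 4 (λ a b r s → (b :- a) :* (r :* s) := (b :* s) :* r :- (a :* r) :* s)
                      refl a b (recip a) (recip b))
                   (trans (cong₂ (λ p q → p * recip a - q * recip b)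
                             (recip-inverse b>0) (recip-inverse a>0))
                          (cong₂ _-_ (ℚ.*-identityˡ (recip a)) (ℚ.*-identityˡ (recip b)))))))
    in subst₂ _≤_ eq total le₂
    where
    η≤ : ∀ n → N₀ ℕ.≤ n → η ≤ seq y n
    η≤ n N₀≤n = subst (_≤ seq y n) (ℚ.+-identityˡ η) (hη n N₀≤n)
    δ = ε * (η * η)
    δ>0 : 0ℚ < δ
    δ>0 = 0<* ε>0 (0<* η>0 η>0)
    cy = cauchy y δ δ>0
    N₁ = proj₁ cy
    hy = proj₂ cy
    total : δ * (recip η * recip η) ≡ ε
    total = trans
      (solve 3 (λ e h r → e :* (h :* h) :* (r :* r) := e :* ((h :* r) :* (h :* r)))
         refl ε η (recip η))
      (trans (cong (λ z → ε * (z * z)) (recip-inverse η>0)) (ℚ.*-identityʳ ε))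

_÷ʳ_by_ : (x y : ℝ) → 0ʳ <ʳ y → ℝ
x ÷ʳ y by y>0 = x *ʳ recipʳ y y>0

harmonic : ℕ → ℚ
harmonic zero    = 0ℚ
harmonic (suc n) = harmonic n + + 1 / suc n

-- log d = ∫₁ᵈ dt/t.  With N = suc n, the lower Riemann sum of this integral
-- for the partition of [1,d] into intervals of length 1/N is
--   Σ (1/N) · 1/(j/N) = Σ 1/j,  N < j ≤ N d.
logSeq : ℕ → ℕ → ℚ
logSeq d n = harmonic (suc n ℕ.* d) - harmonic (suc n)

-- Convergence: logSeq d n increases with n, and logSeq d n + 1/(n+1) decreases.

unit≡ : ∀ n → + 1 / suc n ≡ mkℚ (+ 1) n (1-coprimeTo (suc n))
unit≡ n = ℚ.normalize-coprime (1-coprimeTo (suc n))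

unit-anti : ∀ {m n} → m ℕ.≤ n → + 1 / suc n ≤ + 1 / suc m
unit-anti {m} {n} m≤n = subst₂ _≤_ (sym (unit≡ n)) (sym (unit≡ m))
  (*≤* (subst₂ ℤ._≤_ (sym (ℤ.*-identityˡ (+ suc m))) (sym (ℤ.*-identityˡ (+ suc n)))
          (ℤ.+≤+ (s≤s m≤n))))

unit-pos : ∀ n → 0ℚ < + 1 / suc n
unit-pos n = ℚ.positive⁻¹ _ {{ℚ.normalize-pos 1 (suc n)}}

archimedean : ∀ ε → 0ℚ < ε → ∃[ N ] (+ 1 / suc N ≤ ε)
archimedean (mkℚ +[1+ a ] b c) _ = b , subst (_≤ mkℚ +[1+ a ] b c) (sym (unit≡ b))
  (*≤* (ℤ.*-monoʳ-≤-nonNeg (+ suc b) {+ 1} {+ suc a} (ℤ.+≤+ (s≤s (z≤n {a})))))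
archimedean (mkℚ (+ 0) b c) (*<* (ℤ.+<+ ()))
archimedean (mkℚ -[1+ a ] b c) (*<* ())

times : ℕ → ℚ → ℚ
times zero    q = 0ℚ
times (suc k) q = times k q + q

times-mono : ∀ k {p q} → p ≤ q → times k p ≤ times k q
times-mono zero    p≤q = ℚ.≤-refl
times-mono (suc k) p≤q = ℚ.+-mono-≤ (times-mono k p≤q) p≤q

times-unit : ∀ k m → times k (+ 1 / suc m) ≡ + k / suc m
times-unit zero    m = sym (ℚ.0/n≡0 (suc m))
times-unit (suc k) m = trans (cong (_+ (+ 1 / suc m)) (times-unit k m))
  (ℚ.toℚᵘ-injective
    (ℚᵘ.≃-trans (ℚ.toℚᵘ-homo-+ (+ k / suc m) (+ 1 / suc m))
    (ℚᵘ.≃-trans (ℚᵘ.+-cong (ℚ.toℚᵘ-fromℚᵘ p) (ℚ.toℚᵘ-fromℚᵘ q))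
    (ℚᵘ.≃-trans (ℚᵘ.*≡* (solve 2
        (λ k m → (k :* m :+ con (+ 1) :* m) :* m := (con (+ 1) :+ k) :* (m :* m))
        refl (+ k) (+ suc m)))
      (ℚᵘ.≃-sym (ℚ.toℚᵘ-fromℚᵘ r))))))
  where
  open ℤ.+-*-Solver
  p = ℚᵘ.mkℚᵘ (+ k) m
  q = ℚᵘ.mkℚᵘ (+ 1) m
  r = ℚᵘ.mkℚᵘ (+ suc k) m

-- d · 1/(N d) = 1/N
times-cancel : ∀ e n → times (suc e) (+ 1 / (suc n ℕ.* suc e)) ≡ + 1 / suc n
times-cancel e n = trans (times-unit (suc e) (e ℕ.+ n ℕ.* suc e))
  (ℚ.fromℚᵘ-cong {ℚᵘ.mkℚᵘ (+ suc e) (e ℕ.+ n ℕ.* suc e)} {ℚᵘ.mkℚᵘ (+ 1) n}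
    (ℚᵘ.*≡* (trans (ℤ.*-comm (+ suc e) (+ suc n))
      (trans (sym (ℤ.pos-* (suc n) (suc e))) (sym (ℤ.*-identityˡ _))))))

harmonic-block-≥ : ∀ k a {m} → k ℕ.+ a ℕ.≤ suc m →
  times k (+ 1 / suc m) + harmonic a ≤ harmonic (k ℕ.+ a)
harmonic-block-≥ zero    a h = ℚ.≤-reflexive (ℚ.+-identityˡ (harmonic a))
harmonic-block-≥ (suc k) a {m} (s≤s h) = subst (_≤ harmonic (suc k ℕ.+ a))
  (solve 3 (λ t q x → (t :+ x) :+ q := (t :+ q) :+ x) refl
     (times k (+ 1 / suc m)) (+ 1 / suc m) (harmonic a))
  (ℚ.+-mono-≤ (harmonic-block-≥ k a (ℕ.m≤n⇒m≤1+n h)) (unit-anti h))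
  where open +-*-Solver

harmonic-block-≤ : ∀ k a {m} → m ℕ.≤ a →
  harmonic (k ℕ.+ a) ≤ times k (+ 1 / suc m) + harmonic a
harmonic-block-≤ zero    a h = ℚ.≤-reflexive (sym (ℚ.+-identityˡ (harmonic a)))
harmonic-block-≤ (suc k) a {m} h = subst (harmonic (suc k ℕ.+ a) ≤_)
  (solve 3 (λ t q x → (t :+ x) :+ q := (t :+ q) :+ x) refl
     (times k (+ 1 / suc m)) (+ 1 / suc m) (harmonic a))
  (ℚ.+-mono-≤ (harmonic-block-≤ k a h) (unit-anti (ℕ.≤-trans h (ℕ.m≤n+m a k))))
  where open +-*-Solver

logSeq-step-≥ : ∀ e n → logSeq (suc e) n ≤ logSeq (suc e) (suc n)
logSeq-step-≥ e n = subst₂ _≤_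
  (solve 3 (λ u h x → (u :+ h) :- (x :+ u) := h :- x) refl
     u (harmonic (suc n ℕ.* suc e)) (harmonic (suc n)))
  refl
  (ℚ.+-monoˡ-≤ (- harmonic (suc (suc n)))
    (subst (λ z → z + harmonic (suc n ℕ.* suc e) ≤ harmonic (suc (suc n) ℕ.* suc e))
      (times-cancel e (suc n))
      (harmonic-block-≥ (suc e) (suc n ℕ.* suc e) ℕ.≤-refl)))
  where
  open +-*-Solver
  u = + 1 / suc (suc n)

logSeq-step-≤ : ∀ e n →
  logSeq (suc e) (suc n) + + 1 / suc (suc n) ≤ logSeq (suc e) n + + 1 / suc n
logSeq-step-≤ e n = subst₂ _≤_
  (solve 3 (λ y u x → y :+ (:- x) := (y :- (x :+ u)) :+ u) refl
     (harmonic (suc (suc n) ℕ.* suc e)) u (harmonic (suc n)))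
  (solve 3 (λ v h x → (v :+ h) :+ (:- x) := (h :- x) :+ v) refl
     v (harmonic (suc n ℕ.* suc e)) (harmonic (suc n)))
  (ℚ.+-monoˡ-≤ (- harmonic (suc n))
    (subst (λ z → harmonic (suc (suc n) ℕ.* suc e) ≤ z + harmonic (suc n ℕ.* suc e))
      (times-cancel e n)
      (harmonic-block-≤ (suc e) (suc n ℕ.* suc e) (ℕ.n≤1+n _))))
  where
  open +-*-Solver
  u = + 1 / suc (suc n)
  v = + 1 / suc n

logSeq-mono : ∀ e {m n} → m ℕ.≤′ n → logSeq (suc e) m ≤ logSeq (suc e) n
logSeq-mono e (ℕ.≤′-reflexive refl) = ℚ.≤-refl
logSeq-mono e (ℕ.≤′-step {n} h) = ℚ.≤-trans (logSeq-mono e h) (logSeq-step-≥ e n)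

logSeq-anti : ∀ e {m n} → m ℕ.≤′ n →
  logSeq (suc e) n + + 1 / suc n ≤ logSeq (suc e) m + + 1 / suc m
logSeq-anti e (ℕ.≤′-reflexive refl) = ℚ.≤-refl
logSeq-anti e (ℕ.≤′-step {n} h) = ℚ.≤-trans (logSeq-step-≤ e n) (logSeq-anti e h)

logSeq-cauchy : ∀ d .{{_ : NonZero d}} → Cauchy (logSeq d)
logSeq-cauchy (suc e) ε ε>0 = let (N , hN) = archimedean ε ε>0 in
  N , λ m n N≤m N≤n → abs-≤ (close hN N≤m N≤n) (close hN N≤n N≤m)
  where
  close : ∀ {N m n} → + 1 / suc N ≤ ε → N ℕ.≤ m → N ℕ.≤ n →
    logSeq (suc e) m ≤ logSeq (suc e) n + ε
  close {N} {m} {n} hN N≤m N≤n =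
    ℚ.≤-trans (ℚ.≤-reflexive (sym (ℚ.+-identityʳ _)))
    (ℚ.≤-trans (ℚ.+-monoʳ-≤ (logSeq (suc e) m) (ℚ.<⇒≤ (unit-pos m)))
    (ℚ.≤-trans (logSeq-anti e (ℕ.≤⇒≤′ N≤m))
      (ℚ.+-mono-≤ (logSeq-mono e (ℕ.≤⇒≤′ N≤n)) hN)))

log : (d : ℕ) .{{_ : NonZero d}} → ℝ
log d = real (logSeq d) (logSeq-cauchy d)

harmonic-mono : ∀ {m n} → m ℕ.≤′ n → harmonic m ≤ harmonic n
harmonic-mono (ℕ.≤′-reflexive refl) = ℚ.≤-refl
harmonic-mono (ℕ.≤′-step {n} h) = ℚ.≤-trans (harmonic-mono h)
  (ℚ.≤-trans (ℚ.≤-reflexive (sym (ℚ.+-identityʳ _)))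
             (ℚ.+-monoʳ-≤ (harmonic n) (ℚ.<⇒≤ (unit-pos n))))

log-pos : ∀ {d} (d≥2 : 2 ℕ.≤ d) → 0ʳ <ʳ log d {{ℕ.>-nonZero (ℕ.≤-trans (s≤s z≤n) d≥2)}}
log-pos {suc e} d≥2 = + 1 / 2 , unit-pos 1 , 0 , λ n _ →
  ℚ.≤-trans
    (ℚ.+-monoˡ-≤ (- harmonic 1)
      (harmonic-mono {2} {1 ℕ.* suc e} (ℕ.≤⇒≤′ (ℕ.≤-trans d≥2 (ℕ.m≤m+n (suc e) 0)))))
    (logSeq-mono e (ℕ.≤⇒≤′ (z≤n {n})))

_/log_by_ : ℕ → (d : ℕ) → 2 ℕ.≤ d → ℝ
k /log d by d≥2 = fromNat k ÷ʳ log d {{ℕ.>-nonZero (ℕ.≤-trans (s≤s z≤n) d≥2)}} by log-pos d≥2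

record Graph (V : Set) : Set where
  field
    adj    : V → V → Bool
    symm   : ∀ u v → adj u v ≡ adj v u
    irrefl : ∀ v → adj v v ≡ false

  Adj : V → V → Set
  Adj u v = T (adj u v)

  -- Star is the reflexive transitive closure, unrelated to star graphs.
  Reachable : V → V → Set
  Reachable = Star Adj

open Graph public

degree : ∀ {n} → Graph (Fin n) → Fin n → ℕ
degree G v = ∣ tabulate (adj G v) ∣

Regular : ∀ {n} → ℕ → Graph (Fin n) → Set
Regular d G = ∀ v → degree G v ≡ d

-- H and G have the same vertices, so H ⊑ G makes H a spanning subgraph.
_⊑_ : ∀ {V} → Graph V → Graph V → Set
H ⊑ G = ∀ u v → Adj H u v → Adj G u v

induced : ∀ {n} → Graph (Fin n) → (S : Subset n) → Graph (∃ (_∈ S))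
induced G S = record
  { adj    = λ u v → adj G (proj₁ u) (proj₁ v)
  ; symm   = λ u v → symm G (proj₁ u) (proj₁ v)
  ; irrefl = λ v → irrefl G (proj₁ v)
  }

-- A cycle with k + 3 vertices, listed in cyclic order.
IsCycle : ∀ {V} → Graph V → (k : ℕ) → (Fin (3 ℕ.+ k) → V) → Set
IsCycle G k f = Injective _≡_ _≡_ f
  × (∀ i → Adj G (f (inject₁ i)) (f (suc i)))
  × Adj G (f (fromℕ _)) (f zero)

IsForest : ∀ {V} → Graph V → Set
IsForest {V} G = ∀ k (f : Fin (3 ℕ.+ k) → V) → ¬ IsCycle G k f

Connected : ∀ {V} → Graph V → Set
Connected {V} G = V × (∀ u v → Reachable G u v)

IsTree : ∀ {V} → Graph V → Set
IsTree G = Connected G × IsForest G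

-- A single vertex is a star with no edges.
IsStar : ∀ {V} → Graph V → Set
IsStar G = IsTree G × ∃[ c ] (∀ v → v ≢ c → Adj G c v)

IsComponent : ∀ {n} → Graph (Fin n) → Subset n → Set
IsComponent G S = ∃[ v ] (∀ u → u ∈ S ⇔ Reachable G v u)

IsStarFactor : ∀ {n} → Graph (Fin n) → Graph (Fin n) → Set
IsStarFactor G H = H ⊑ G × IsForest H × (∀ S → IsComponent H S → IsStar (induced H S))

-- The number of edges of induced G S, each counted once, as a pair u < v.
edgesWithin : ∀ {n} → Graph (Fin n) → Subset n → ℕ
edgesWithin {n} G S = length (filter
  (λ (u , v) → (u Fin.<? v) ×-dec (u ∈? S) ×-dec (v ∈? S) ×-dec T? (adj G u v))
  (cartesianProduct (allFin n) (allFin n)))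

{-# OPTIONS --safe #-}
module Submission where

-- Existence.  By the local lemma some random set C of centres, of density about (log d)/d, leaves
-- every vertex with between 1 and O(log d) neighbours in C.  A centre then has at least d/2
-- neighbours outside C, each of which may be claimed by O(log d) centres only, so by Hall's
-- condition (here: augmenting along walks until no centre is short) the vertices outside C can be
-- assigned to adjacent centres with Ω(d/log d) of them at every centre.  If d = O(log d), single
-- edges suffice, and a maximal independent set serves as C.
--
-- Optimality.  The centres of a star factor dominate, so it is enough that dominating sets have
-- Ω(log d) of at most 2d vertices: some star is then as small as O(d/log d).  Join nonzero
-- vectors of F₂^2h on which a symplectic form is 1.  Any k vectors have at least 2^(2h−k) common
-- orthogonal vectors, so fewer than h vertices never dominate; blowing up yields every degree.

open import Defs
import Data.Bool.Base as Bool
open import Data.Bool.Base using (Bool; true; false; not; _∧_; _∨_; _xor_; if_then_else_; T)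
import Data.Bool.Properties as Bool
open import Data.Empty using (⊥; ⊥-elim)
open import Data.Fin.Base using (Fin; zero; suc; toℕ; _↑ˡ_; _↑ʳ_; combine; remQuot)
import Data.Fin.Base as Fin
open import Data.Fin.Patterns using (0F; 1F; 2F; 3F)
import Data.Fin.Properties as Fin
open import Data.Fin.Subset using (Subset; _∈_; ∣_∣)
import Data.Fin.Subset.Properties as Subset
import Data.List.Base as List
open import Data.List.Base using (List; []; _∷_; length)
import Data.List.Properties as List
import Data.List.Membership.Propositional as List
import Data.List.Membership.Propositional.Properties as List
import Data.List.Relation.Unary.Any as List using (here; there)
open import Data.Nat.Base using (ℕ; zero; suc; _+_; _*_; _∸_; _^_; _≤_; _<_; z≤n; s≤s; NonZero; >-nonZero; >-nonZero⁻¹)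
open import Data.Nat.DivMod using (_/_; _%_; m≡m%n+[m/n]*n; m*n/n≡m; /-monoˡ-≤; m%n<n; m/n*n≤m; m≥n⇒m/n>0; m<n⇒m%n≡m; [m+n]%n≡m%n)
open import Data.Nat.Properties
open import Data.Nat.Tactic.RingSolver using (solve-∀)
open import Data.Product using (∃; ∃-syntax; Σ-syntax; _×_; _,_; proj₁; proj₂)
import Data.Sum.Base as Sum
open import Data.Sum.Base using (_⊎_; inj₁; inj₂)
open import Data.Vec.Base using (Vec; []; _∷_; here; there; lookup; tabulate)
import Data.Vec.Properties as Vec
open import Function.Base using (_∘_; case_of_)
open import Function.Bundles using (_⇔_; mk⇔; Equivalence)
open import Relation.Binary.Construct.Closure.ReflexiveTransitive using (Star; ε; _◅_; _◅◅_)
open import Relation.Binary.Definitions using (tri<; tri≈; tri>)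
open import Relation.Binary.PropositionalEquality
open import Relation.Nullary using (¬_; Dec; yes; no; does; contradiction)
open import Relation.Nullary.Decidable using (_×-dec_; ¬?; from-yes)
open import Algebra.Properties.Semiring.Sum +-*-semiring using (sum; sum-cong-≗; ∑-distrib-+; ∑-comm; *-distribˡ-sum; *-distribʳ-sum)
open import Algebra.Properties.CommutativeMonoid.Sum *-1-commutativeMonoid using () renaming (sum to prod; sum-cong-≗ to prod-cong)
import Data.Integer.Base as ℤ
import Data.Integer.Properties as ℤ
open import Data.Rational.Base using (ℚ; 0ℚ; 1ℚ)
import Data.Rational.Base as ℚ
import Data.Rational.Properties as ℚ
import Data.Rational.Unnormalised.Base as ℚᵘ
import Data.Rational.Unnormalised.Properties as ℚᵘ
open import Data.Rational.Solver using () renaming (module +-*-Solver to ℚ-Solver)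

-- A union bound over all vertices is hopeless, since n is unbounded in terms of d. The bad event at
-- a vertex, however, depends only on the colours of its d neighbours, and at most d² events share
-- one of them; this is what the local lemma exploits. Probabilities are counts of colourings with
-- denominators cleared, and log d is replaced by the ℓ with 2^ℓ ≤ d < 2^(ℓ+1). The combinatorics
-- thus stays in the natural numbers, and real numbers enter only through ℓ/2 ≤ log d ≤ 3ℓ. For
-- optimality a symplectic form serves three purposes at once. Being symmetric over F₂ and zero on
-- the diagonal, it is the adjacency relation of a simple graph; being nondegenerate, it makes that
-- graph regular on the nonzero vectors; and being linear, it bounds the domination number by
-- counting solutions of equations, so that no second probabilistic argument is needed.

private variable
  m n q : ℕ

-- Indicators, finite sums and growing subsets.

⟦_⟧ : Bool → ℕ
⟦ false ⟧ = 0
⟦ true ⟧  = 1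

⟦⟧≤1 : ∀ b → ⟦ b ⟧ ≤ 1
⟦⟧≤1 false = z≤n
⟦⟧≤1 true  = s≤s z≤n

⟦⟧≤ : ∀ b {x} → (b ≡ true → 1 ≤ x) → ⟦ b ⟧ ≤ x
⟦⟧≤ false h = z≤n
⟦⟧≤ true  h = h refl

*⟦⟧≤ : ∀ x b {y} → (b ≡ true → x ≤ y) → x * ⟦ b ⟧ ≤ y
*⟦⟧≤ x false h = ≤-trans (≤-reflexive (*-zeroʳ x)) z≤n
*⟦⟧≤ x true  h = ≤-trans (≤-reflexive (*-identityʳ x)) (h refl)

⟦⟧-mono : ∀ {a b} → (a ≡ true → b ≡ true) → ⟦ a ⟧ ≤ ⟦ b ⟧
⟦⟧-mono {false} h = z≤n
⟦⟧-mono {true}  h rewrite h refl = s≤s z≤n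

⟦⟧-∧ : ∀ a b → ⟦ a ∧ b ⟧ ≡ ⟦ a ⟧ * ⟦ b ⟧
⟦⟧-∧ false b = refl
⟦⟧-∧ true  b = sym (+-identityʳ ⟦ b ⟧)

⟦⟧*-mono : ∀ b {x y} → (b ≡ true → x ≤ y) → ⟦ b ⟧ * x ≤ ⟦ b ⟧ * y
⟦⟧*-mono false h = z≤n
⟦⟧*-mono true  h = *-monoʳ-≤ 1 (h refl)

T⇒true : ∀ {b} → T b → b ≡ true
T⇒true {true} _ = refl

true⇒T : ∀ {b} → b ≡ true → T b
true⇒T refl = _

∧-true : ∀ {a b} → a ≡ true → b ≡ true → a ∧ b ≡ true
∧-true refl refl = refl

true-∧ : ∀ {a b} → a ∧ b ≡ true → a ≡ true × b ≡ true
true-∧ {true} {true} _ = refl , refl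

true-∨ : ∀ {a b} → a ∨ b ≡ true → a ≡ true ⊎ b ≡ true
true-∨ {true}          _ = inj₁ refl
true-∨ {false} {true} _ = inj₂ refl

does-true : ∀ {a} {A : Set a} (A? : Dec A) → A → does A? ≡ true
does-true (yes _) _ = refl
does-true (no ¬x) x = contradiction x ¬x

true-does : ∀ {a} {A : Set a} (A? : Dec A) → does A? ≡ true → A
true-does (yes x) _ = x

not-true : ∀ {b} → not b ≡ true → b ≡ false
not-true {false} _ = refl

true-or-false : ∀ b → b ≡ true ⊎ b ≡ false
true-or-false true  = inj₁ refl
true-or-false false = inj₂ refl

true≢false : ∀ {b} → b ≡ true → b ≡ false → ⊥
true≢false refl ()

sum-mono : {f g : Fin n → ℕ} → (∀ i → f i ≤ g i) → sum f ≤ sum g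
sum-mono {zero}  h = z≤n
sum-mono {suc n} h = +-mono-≤ (h zero) (sum-mono (h ∘ suc))

sum-mono-< : {f g : Fin n → ℕ} → (∀ i → f i ≤ g i) → ∀ j → f j < g j → sum f < sum g
sum-mono-< {suc n} h zero    lt = +-mono-<-≤ lt (sum-mono (h ∘ suc))
sum-mono-< {suc n} h (suc j) lt = +-mono-≤-< (h zero) (sum-mono-< (h ∘ suc) j lt)

term≤sum : (f : Fin n → ℕ) → ∀ i → f i ≤ sum f
term≤sum f zero    = m≤m+n _ _
term≤sum f (suc i) = ≤-trans (term≤sum (f ∘ suc) i) (m≤n+m _ _)

sum-const : ∀ n {c} → sum {n} (λ _ → c) ≡ n * c
sum-const zero    = refl
sum-const (suc n) {c} = cong (c +_) (sum-const n)

sum-const′ : ∀ {c} {f : Fin n → ℕ} → (∀ i → f i ≡ c) → sum f ≡ n * c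
sum-const′ {n} h = trans (sum-cong-≗ h) (sum-const n)

sum-zero : {f : Fin n → ℕ} → (∀ i → f i ≡ 0) → sum f ≡ 0
sum-zero {n} h = trans (sum-const′ h) (*-zeroʳ n)

sum>0⇒∃ : (f : Fin n → ℕ) → 0 < sum f → ∃[ i ] 0 < f i
sum>0⇒∃ {suc n} f h with f zero in eq
... | suc k = zero , subst (0 <_) (sym eq) (s≤s z≤n)
... | zero  = let (i , p) = sum>0⇒∃ (f ∘ suc) h in suc i , p

sum-δ : ∀ (j : Fin n) (f : Fin n → ℕ) → sum (λ i → ⟦ does (j Fin.≟ i) ⟧ * f i) ≡ f j
sum-δ {suc n} zero f = trans
  (cong₂ _+_ (+-identityʳ (f zero)) (sum-zero {f = λ i → 0 * f (suc i)} (λ i → refl)))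
  (+-identityʳ _)
sum-δ {suc n} (suc j) f = trans (sum-cong-≗ λ i → cong (λ b → ⟦ b ⟧ * f (suc i)) (same i)) (sum-δ j (f ∘ suc))
  where
  same : ∀ i → does (suc j Fin.≟ suc i) ≡ does (j Fin.≟ i)
  same i with j Fin.≟ i
  ... | yes refl = refl
  ... | no _     = refl

sum-δ₁ : ∀ (j : Fin n) → sum (λ i → ⟦ does (j Fin.≟ i) ⟧) ≡ 1
sum-δ₁ {n} j = trans (sum-cong-≗ {n} λ i → sym (*-identityʳ ⟦ does (j Fin.≟ i) ⟧)) (sum-δ j (λ _ → 1))

∃true? : (P : Fin n → Bool) → Dec (∃[ i ] P i ≡ true)
∃true? P = Fin.any? (λ i → P i Bool.≟ true)

sum-↑ : ∀ m (f : Fin (m + n) → ℕ) → sum f ≡ sum (f ∘ (_↑ˡ n)) + sum (f ∘ (m ↑ʳ_))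
sum-↑ zero    f = refl
sum-↑ (suc m) f = trans (cong (f zero +_) (sum-↑ m (f ∘ suc))) (sym (+-assoc (f zero) _ _))

sum-combine : ∀ m (f : Fin (m * n) → ℕ) → sum f ≡ sum {m} (λ i → sum {n} (λ j → f (combine i j)))
sum-combine zero        f = refl
sum-combine {n} (suc m) f = trans (sum-↑ n f) (cong (sum (f ∘ (_↑ˡ (m * n))) +_) (sum-combine m (f ∘ (n ↑ʳ_))))

sum-remQuot : ∀ m (F : Fin m → Fin n → ℕ) →
  sum {m * n} (λ k → F (proj₁ (remQuot {m} n k)) (proj₂ (remQuot {m} n k))) ≡ sum (λ i → sum (F i))
sum-remQuot {n} m F = trans (sum-combine m _) (sum-cong-≗ λ i → sum-cong-≗ λ j →
  cong (λ (p : Fin m × Fin n) → F (proj₁ p) (proj₂ p)) (Fin.remQuot-combine {m} {n} i j))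

degree-sum : (G : Graph (Fin n)) → ∀ v → degree G v ≡ sum (λ w → ⟦ adj G v w ⟧)
degree-sum G v = go (adj G v)
  where
  go : ∀ {n} (f : Fin n → Bool) → ∣ tabulate f ∣ ≡ sum (λ w → ⟦ f w ⟧)
  go {zero}  f = refl
  go {suc n} f with f zero
  ... | true  = cong suc (go (f ∘ suc))
  ... | false = go (f ∘ suc)

insert : Fin n → (Fin n → Bool) → Fin n → Bool
insert x R y = does (x Fin.≟ y) ∨ R y

insert-self : ∀ (x : Fin n) R → insert x R x ≡ true
insert-self x R rewrite does-true (x Fin.≟ x) refl = refl

insert-⊇ : ∀ (x : Fin n) R {y} → R y ≡ true → insert x R y ≡ true
insert-⊇ x R {y} p rewrite p = Bool.∨-zeroʳ (does (x Fin.≟ y))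

insert-inv : ∀ (x : Fin n) R {y} → insert x R y ≡ true → x ≡ y ⊎ R y ≡ true
insert-inv x R {y} p with x Fin.≟ y
... | yes e = inj₁ e
... | no _  = inj₂ p

card : (Fin n → Bool) → ℕ
card R = sum (λ i → ⟦ R i ⟧)

card≤n : (R : Fin n → Bool) → card R ≤ n
card≤n {n} R = subst (card R ≤_) (trans (sum-const n) (*-identityʳ n)) (sum-mono (⟦⟧≤1 ∘ R))

card-< : ∀ {R S : Fin n → Bool} → (∀ y → R y ≡ true → S y ≡ true) → ∀ x → R x ≡ false → S x ≡ true → card R < card S
card-< {R = R} {S} sub x rx sx = sum-mono-< (λ i → ⟦⟧-mono (sub i)) x (subst₂ (λ a b → ⟦ a ⟧ < ⟦ b ⟧) (sym rx) (sym sx) (s≤s z≤n))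

-- A growing subset of `Fin n` gains at most n elements, which the fuel `n ≤ k + card R` records.
-- Reachable sets, the local lemma and maximal independent sets all obtain termination from here.
saturate : {Inv Done : (Fin n → Bool) → Set} →
  (∀ R → Inv R → Done R ⊎ ∃[ x ] R x ≡ false × Inv (insert x R)) →
  ∀ R → Inv R → ∃[ R′ ] Inv R′ × Done R′
saturate {n} {Inv} {Done} step R₀ inv₀ = go n R₀ inv₀ (m≤m+n n (card R₀))
  where
  go : ∀ k R → Inv R → n ≤ k + card R → ∃[ R′ ] Inv R′ × Done R′
  go k R inv h with step R inv
  ... | inj₁ d = R , inv , d
  ... | inj₂ (x , rx , inv′) with k | h
  ...   | zero  | h = contradiction (≤-trans (s≤s h) (≤-trans (card-< {R = R} (λ y → insert-⊇ x R {y}) x rx (insert-self x R)) (card≤n (insert x R)))) 1+n≰n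
  ...   | suc k | h = go k (insert x R) inv′
          (≤-trans h (≤-trans (≤-reflexive (sym (+-suc k _))) (+-monoʳ-≤ k (card-< {R = R} (λ y → insert-⊇ x R {y}) x rx (insert-self x R)))))

-- `P` is the evidence kept for each member, such as a walk from `c`, so that the closed set found
-- comes with the means by which its elements were reached.
reachableSet : {E : Fin n → Fin n → Set} → (∀ x y → Dec (E x y)) → (P : Fin n → Set) →
  (∀ {x y} → P x → E x y → P y) → ∀ c → P c →
  ∃[ R ] R c ≡ true × (∀ x → R x ≡ true → P x) × (∀ x y → R x ≡ true → E x y → R y ≡ true)
reachableSet {n} {E} E? P closed c pc =
  let (R , (rc , rp) , cl) = saturate {Inv = λ R → R c ≡ true × (∀ x → R x ≡ true → P x)}
                               {Done = λ R → ∀ x y → R x ≡ true → E x y → R y ≡ true} step (insert c (λ _ → false))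
                               (insert-self c (λ _ → false) , λ x rx → case insert-inv c (λ _ → false) rx of λ { (inj₁ refl) → pc ; (inj₂ ()) })
  in R , rc , rp , cl
  where
  step : ∀ R → R c ≡ true × (∀ x → R x ≡ true → P x) →
    (∀ x y → R x ≡ true → E x y → R y ≡ true) ⊎ ∃[ y ] R y ≡ false × (insert y R c ≡ true × (∀ x → insert y R x ≡ true → P x))
  step R (rc , rp) with Fin.any? (λ y → (R y Bool.≟ false) ×-dec Fin.any? (λ x → (R x Bool.≟ true) ×-dec E? x y))
  ... | yes (y , ry , x , rx , e) = inj₂ (y , ry , insert-⊇ y R rc , λ z rz → case insert-inv y R rz of λ
          { (inj₁ refl) → closed (rp x rx) e ; (inj₂ r) → rp z r })
  ... | no none = inj₁ λ x y rx e → Bool.¬-not λ ry → none (y , ry , x , rx , e)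

-- Assigning leaves to centres

module Assignment {n} (G : Graph (Fin n)) (C : Fin n → Bool) where

  Valid : (Fin n → Fin n) → Set
  Valid f = ∀ v → C v ≡ false → C (f v) ≡ true × adj G v (f v) ≡ true

  load : (Fin n → Fin n) → Fin n → ℕ
  load f c = sum (λ v → ⟦ not (C v) ∧ does (f v Fin.≟ c) ⟧)

  -- The potential that drops with every augmentation. Truncated subtraction is intended: an
  -- overloaded centre must not compensate for a short one.
  deficit : ℕ → (Fin n → Fin n) → ℕ
  deficit s f = sum (λ c → ⟦ C c ⟧ * (s ∸ load f c))

  reassign : (Fin n → Fin n) → Fin n → Fin n → Fin n → Fin n
  reassign f v y w = if does (v Fin.≟ w) then y else f w

  -- An edge from `y` to `z` of the exchange graph is a leaf held by `z` that `y` could take over. A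
  -- walk from a short centre to an overloaded one is therefore a chain of possible transfers back
  -- to `c`.
  data Walk (f : Fin n → Fin n) (c : Fin n) : ℕ → Fin n → Set where
    stop : Walk f c 0 c
    step : ∀ {k y z} v → Walk f c k y → C v ≡ false → adj G v y ≡ true → f v ≡ z → Walk f c (suc k) z

  walk⊆C : ∀ {f c k y} → Valid f → C c ≡ true → Walk f c k y → C y ≡ true
  walk⊆C valid cc stop                   = cc
  walk⊆C valid cc (step v w cv vy refl) = proj₁ (valid v cv)

  module Reassign (f : Fin n → Fin n) (v y z : Fin n) (cv : C v ≡ false) (fv : f v ≡ z) (y≢z : y ≢ z) where

    f′ : Fin n → Fin n
    f′ = reassign f v y

    same : ∀ {w} → v ≢ w → f′ w ≡ f w
    same {w} v≢w with v Fin.≟ w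
    ... | yes e = contradiction e v≢w
    ... | no _  = refl

    valid′ : Valid f → C y ≡ true → adj G v y ≡ true → Valid f′
    valid′ valid cy vy u cu with v Fin.≟ u
    ... | yes refl = cy , vy
    ... | no _     = valid u cu

    load-≥ : ∀ {x} → x ≢ z → load f x ≤ load f′ x
    load-≥ {x} x≢z = sum-mono λ w → ⟦⟧-mono λ e → let (cw , fw) = true-∧ e in
      ∧-true cw (does-true (f′ w Fin.≟ x) (trans (same λ { refl → x≢z (trans (sym (true-does (f w Fin.≟ x) fw)) fv) })
                                                  (true-does (f w Fin.≟ x) fw)))

    load-≤ : ∀ {x} → x ≢ y → load f′ x ≤ load f x
    load-≤ {x} x≢y = sum-mono λ w → ⟦⟧-mono λ e → let (cw , fw) = true-∧ e in ∧-true cw (case′ w (true-does (f′ w Fin.≟ x) fw))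
      where
      case′ : ∀ w → f′ w ≡ x → does (f w Fin.≟ x) ≡ true
      case′ w fw with v Fin.≟ w
      ... | yes _ = contradiction (sym fw) x≢y
      ... | no _  = does-true (f w Fin.≟ x) fw

    load-y : load f y < load f′ y
    load-y = sum-mono-< (λ w → ⟦⟧-mono λ e → let (cw , fw) = true-∧ e in
        ∧-true cw (does-true (f′ w Fin.≟ y) (trans (same λ { refl → y≢z (trans (sym (true-does (f w Fin.≟ y) fw)) fv) })
                                                    (true-does (f w Fin.≟ y) fw))))
      v strict
      where
      strict : ⟦ not (C v) ∧ does (f v Fin.≟ y) ⟧ < ⟦ not (C v) ∧ does (f′ v Fin.≟ y) ⟧
      strict rewrite cv with f v Fin.≟ y
      ... | yes e = contradiction (trans (sym e) fv) y≢z
      ... | no _ with v Fin.≟ v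
      ...   | no v≢v = contradiction refl v≢v
      ...   | yes _ with y Fin.≟ y
      ...     | yes _ = s≤s z≤n
      ...     | no y≢y = contradiction refl y≢y

    load-z : load f z ≤ suc (load f′ z)
    load-z = ≤-trans (sum-mono {g = λ w → ⟦ does (v Fin.≟ w) ⟧ + ⟦ not (C w) ∧ does (f′ w Fin.≟ z) ⟧} pointwise)
      (≤-reflexive (trans (∑-distrib-+ (λ w → ⟦ does (v Fin.≟ w) ⟧) (λ w → ⟦ not (C w) ∧ does (f′ w Fin.≟ z) ⟧)) (cong (_+ load f′ z) (sum-δ₁ v))))
      where
      pointwise : ∀ w → ⟦ not (C w) ∧ does (f w Fin.≟ z) ⟧ ≤ ⟦ does (v Fin.≟ w) ⟧ + ⟦ not (C w) ∧ does (f′ w Fin.≟ z) ⟧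
      pointwise w with v Fin.≟ w
      ... | yes _ = ≤-trans (⟦⟧≤1 _) (m≤m+n 1 _)
      ... | no _  = ≤-refl

    module _ (s : ℕ) (big : s < load f z) where

      s≤load′ : s ≤ load f′ z
      s≤load′ = ≤-pred (≤-trans big load-z)

      -- Only `z` loses a leaf, and since its load exceeded `s` it does not become short.
      deficit-pointwise : ∀ x → ⟦ C x ⟧ * (s ∸ load f′ x) ≤ ⟦ C x ⟧ * (s ∸ load f x)
      deficit-pointwise x = *-monoʳ-≤ ⟦ C x ⟧ le
        where
        le : s ∸ load f′ x ≤ s ∸ load f x
        le with x Fin.≟ z
        ... | yes refl = subst (_≤ s ∸ load f x) (sym (m≤n⇒m∸n≡0 s≤load′)) z≤n
        ... | no x≢z   = ∸-monoʳ-≤ s (load-≥ x≢z)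

      deficit-≤ : deficit s f′ ≤ deficit s f
      deficit-≤ = sum-mono deficit-pointwise

      deficit-< : C y ≡ true → load f y < s → deficit s f′ < deficit s f
      deficit-< cy ly = sum-mono-< deficit-pointwise y
        (subst (λ b → ⟦ b ⟧ * (s ∸ load f′ y) < ⟦ b ⟧ * (s ∸ load f y)) (sym cy)
          (+-monoˡ-< 0 (≤-<-trans (∸-monoʳ-≤ s load-y) (∸-monoʳ-< (n<1+n (load f y)) ly))))

  -- Moving v changes only the edges into z of the exchange graph, so a walk
  -- survives the move unless it passes through an overloaded centre earlier.
  truncate : ∀ {f c k y} s v y₀ z → f v ≡ z → s < load f z → Walk f c k y →
    (∃[ k′ ] ∃[ y′ ] k′ ≤ k × Walk f c k′ y′ × s < load f y′) ⊎ Walk (reassign f v y₀) c k y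
  truncate s v y₀ z fv big stop = inj₂ stop
  truncate {f} {y = y} s v y₀ z fv big w₀@(step u w cu ux fu) with truncate s v y₀ z fv big w
  ... | inj₁ (k′ , y′ , le , w′ , b) = inj₁ (k′ , y′ , m≤n⇒m≤1+n le , w′ , b)
  ... | inj₂ w′ with v Fin.≟ u
  ...   | no v≢u = inj₂ (step u w′ cu ux (trans unchanged fu))
    where
    unchanged : reassign f v y₀ u ≡ f u
    unchanged with v Fin.≟ u
    ... | yes e = contradiction e v≢u
    ... | no _  = refl
  ...   | yes refl = inj₁ (_ , y , ≤-refl , w₀ , subst (λ t → s < load f t) (trans (sym fv) fu) big)

  -- The last leaf of the walk is moved from `z` back to `y`. If `y` was short, the deficit drops.
  -- Otherwise `y` is now overloaded itself and ends a shorter walk. Where the move would spoil the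
  -- rest of the walk, `truncate` finds a shorter walk to an overloaded centre before anything is
  -- moved.
  augment : ∀ fuel {f c k z} s → k ≤ fuel → Valid f → C c ≡ true → load f c < s → Walk f c k z → s < load f z →
    ∃[ f′ ] Valid f′ × deficit s f′ < deficit s f
  augment fuel s k≤ valid cc small stop big = contradiction (<-trans small big) (<-irrefl refl)
  augment (suc fuel) {f} {c} {z = z} s (s≤s k≤) valid cc small (step {k} {y} v w cv vy fv) big
    with truncate s v y z fv big w
  ... | inj₁ (k′ , y′ , le , w′ , b) = augment fuel s (≤-trans le k≤) valid cc small w′ b
  ... | inj₂ w′ with y Fin.≟ z
  ...   | yes refl = augment fuel s k≤ valid cc small w big
  ...   | no y≢z with load f y <? s
  ...     | yes ly = f′ , valid′ valid cy vy , deficit-< s big cy ly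
    where
    open Reassign f v y z cv fv y≢z
    cy : C y ≡ true
    cy = walk⊆C valid cc w
  ...     | no ly =
    -- `c` is still short: it differs from `y`, which is not short, and no other centre gains a
    -- leaf.
    let (f″ , valid″ , lt) = augment fuel {f′} s k≤ (valid′ valid (walk⊆C valid cc w) vy) cc
          (≤-<-trans (load-≤ (λ { refl → ly small })) small) w′ (≤-<-trans (≮⇒≥ ly) load-y)
    in f″ , valid″ , <-≤-trans lt (deficit-≤ s big)
    where
    open Reassign f v y z cv fv y≢z

  module _ (M s : ℕ) .{{_ : NonZero M}}
    (few : ∀ v → C v ≡ false → sum (λ c → ⟦ C c ∧ adj G v c ⟧) ≤ M)
    (many : ∀ c → C c ≡ true → M * s ≤ sum (λ v → ⟦ not (C v) ∧ adj G c v ⟧)) where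

    -- Hall's condition as a double count of the edges between `R` and the leaves. There are at
    -- least `M * s` per centre in `R`. Every leaf with a neighbour in `R` is assigned into `R` and
    -- sees at most `M` centres, so there are at most `M` times the total load of `R`, which is too
    -- few if no load exceeds `s` and that of `c` is smaller.
    closed-overload : ∀ f → (R : Fin n → Bool) → (∀ x → R x ≡ true → C x ≡ true) →
      (∀ x v → R x ≡ true → C v ≡ false → adj G v x ≡ true → R (f v) ≡ true) →
      ∀ c → R c ≡ true → load f c < s → ¬ (∀ x → R x ≡ true → load f x ≤ s)
    closed-overload f R R⊆C closed c rc lc allsmall = <-irrefl refl (begin-strict
      M * sum (λ x → ⟦ R x ⟧ * s)                                    ≡⟨ *-distribˡ-sum {n} M (λ x → ⟦ R x ⟧ * s) ⟩
      sum (λ x → M * (⟦ R x ⟧ * s))                                  ≤⟨ sum-mono row ⟩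
      sum (λ x → sum (λ v → ⟦ R x ⟧ * ⟦ not (C v) ∧ adj G v x ⟧))    ≡⟨ ∑-comm {n} {n} (λ x v → ⟦ R x ⟧ * ⟦ not (C v) ∧ adj G v x ⟧) ⟩
      sum (λ v → sum (λ x → ⟦ R x ⟧ * ⟦ not (C v) ∧ adj G v x ⟧))    ≤⟨ sum-mono column ⟩
      sum (λ v → M * ⟦ not (C v) ∧ R (f v) ⟧)                        ≡⟨ *-distribˡ-sum {n} M (λ v → ⟦ not (C v) ∧ R (f v) ⟧) ⟨
      M * sum (λ v → ⟦ not (C v) ∧ R (f v) ⟧)                        ≡⟨ cong (M *_) (sum-cong-≗ {n} image) ⟩
      M * sum (λ v → sum (λ x → ⟦ R x ⟧ * ⟦ not (C v) ∧ does (f v Fin.≟ x) ⟧))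
        ≡⟨ cong (M *_) (∑-comm {n} {n} (λ v x → ⟦ R x ⟧ * ⟦ not (C v) ∧ does (f v Fin.≟ x) ⟧)) ⟩
      M * sum (λ x → sum (λ v → ⟦ R x ⟧ * ⟦ not (C v) ∧ does (f v Fin.≟ x) ⟧))
        ≡⟨ cong (M *_) (sum-cong-≗ {n} λ x → *-distribˡ-sum {n} ⟦ R x ⟧ (λ v → ⟦ not (C v) ∧ does (f v Fin.≟ x) ⟧)) ⟨
      M * sum (λ x → ⟦ R x ⟧ * load f x)                             <⟨ *-monoʳ-< M fewer ⟩
      M * sum (λ x → ⟦ R x ⟧ * s)                                    ∎)
      where
      open ≤-Reasoning
      row : ∀ x → M * (⟦ R x ⟧ * s) ≤ sum (λ v → ⟦ R x ⟧ * ⟦ not (C v) ∧ adj G v x ⟧)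
      row x = begin
        M * (⟦ R x ⟧ * s)    ≡⟨ (λ a b c → solve a b c) M ⟦ R x ⟧ s ⟩
        ⟦ R x ⟧ * (M * s)    ≤⟨ ⟦⟧*-mono (R x) (λ rx → many x (R⊆C x rx)) ⟩
        ⟦ R x ⟧ * sum (λ v → ⟦ not (C v) ∧ adj G x v ⟧)
          ≡⟨ cong (⟦ R x ⟧ *_) (sum-cong-≗ {n} λ v → cong (λ b → ⟦ not (C v) ∧ b ⟧) (symm G x v)) ⟩
        ⟦ R x ⟧ * sum (λ v → ⟦ not (C v) ∧ adj G v x ⟧) ≡⟨ *-distribˡ-sum {n} ⟦ R x ⟧ (λ v → ⟦ not (C v) ∧ adj G v x ⟧) ⟩
        sum (λ v → ⟦ R x ⟧ * ⟦ not (C v) ∧ adj G v x ⟧) ∎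
        where
        solve : ∀ a b c → a * (b * c) ≡ b * (a * c)
        solve = solve-∀
      column : ∀ v → sum (λ x → ⟦ R x ⟧ * ⟦ not (C v) ∧ adj G v x ⟧) ≤ M * ⟦ not (C v) ∧ R (f v) ⟧
      column v with C v in cv
      ... | true = subst (_≤ M * 0) (sym (sum-zero {n} (λ x → *-zeroʳ ⟦ R x ⟧))) z≤n
      ... | false with R (f v) in rfv
      ...   | true = ≤-trans (sum-mono {n} λ x → ≤-trans (≤-reflexive (sym (⟦⟧-∧ (R x) (adj G v x))))
                        (⟦⟧-mono λ e → let (rx , vx) = true-∧ {R x} e in ∧-true (R⊆C x rx) vx))
                      (≤-trans (few v cv) (≤-reflexive (sym (*-identityʳ M))))
      ...   | false = subst (_≤ M * 0) (sym (sum-zero {n} none)) z≤n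
        where
        none : ∀ x → ⟦ R x ⟧ * ⟦ adj G v x ⟧ ≡ 0
        none x with R x in rx | adj G v x in vx
        ... | false | _     = refl
        ... | true  | false = refl
        ... | true  | true  = ⊥-elim (true≢false (closed x v rx cv vx) rfv)
      image : ∀ v → ⟦ not (C v) ∧ R (f v) ⟧ ≡ sum (λ x → ⟦ R x ⟧ * ⟦ not (C v) ∧ does (f v Fin.≟ x) ⟧)
      image v with not (C v)
      ... | false = sym (sum-zero {n} (λ x → *-zeroʳ ⟦ R x ⟧))
      ... | true  = trans (sym (sum-δ (f v) (λ x → ⟦ R x ⟧))) (sum-cong-≗ {n} λ x → *-comm _ ⟦ R x ⟧)
      fewer : sum (λ x → ⟦ R x ⟧ * load f x) < sum (λ x → ⟦ R x ⟧ * s)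
      fewer = sum-mono-< (λ x → ⟦⟧*-mono (R x) (allsmall x)) c
        (subst (λ b → ⟦ b ⟧ * load f c < ⟦ b ⟧ * s) (sym rc) (+-monoˡ-< 0 lc))

    -- The centres reachable from a short centre in the exchange graph form a closed set, so one of
    -- them is overloaded and a walk leads to it. Each augmentation lowers the deficit, which `k`
    -- bounds.
    balance : ∀ k f → Valid f → deficit s f ≤ k → ∃[ f′ ] Valid f′ × (∀ c → C c ≡ true → s ≤ load f′ c)
    balance k f valid bound with Fin.any? (λ c → (C c Bool.≟ true) ×-dec (load f c <? s))
    ... | no none = f , valid , λ c cc → ≮⇒≥ (λ lc → none (c , cc , lc))
    ... | yes (c , cc , lc) with reachableSet {n} {E = λ x y → ∃[ v ] (C v ≡ false × adj G v x ≡ true × f v ≡ y)}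
              (λ x y → Fin.any? (λ v → (C v Bool.≟ false) ×-dec ((adj G v x Bool.≟ true) ×-dec (f v Fin.≟ y))))
              (λ x → ∃[ k ] Walk f c k x)
              (λ { (k , w) (v , cv , vx , fv) → suc k , step v w cv vx fv }) c (0 , stop)
    ...   | (R , rc , walks , closed)
           with Fin.any? (λ x → (R x Bool.≟ true) ×-dec (s <? load f x))
    ...     | no none = ⊥-elim (closed-overload f R (λ x rx → walk⊆C valid cc (proj₂ (walks x rx)))
                          (λ x v rx cv vx → closed x (f v) rx (v , cv , vx , refl)) c rc lc
                          (λ x rx → ≮⇒≥ (λ lx → none (x , rx , lx))))
    ...     | yes (x , rx , lx) with augment (proj₁ (walks x rx)) s ≤-refl valid cc lc (proj₂ (walks x rx)) lx
    ...       | (f′ , valid′ , lt) with k | bound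
    ...         | zero  | bound = contradiction (<-≤-trans lt bound) λ ()
    ...         | suc k | bound = balance k f′ valid′ (≤-pred (<-≤-trans lt bound))

    assignment : (∀ v → C v ≡ false → ∃[ c ] C c ≡ true × adj G v c ≡ true) →
      ∃[ f ] Valid f × (∀ c → C c ≡ true → s ≤ load f c)
    assignment dominated = balance (deficit s f₀) f₀ valid₀ ≤-refl
      where
      -- The value at a centre is a default; `Valid` and `load` look at leaves only.
      choose : ∀ v b → C v ≡ b → Fin n
      choose v true  _ = v
      choose v false e = proj₁ (dominated v e)
      f₀ : Fin n → Fin n
      f₀ v = choose v (C v) refl
      valid₀ : Valid f₀
      valid₀ v cv = go (C v) refl cv
        where
        go : ∀ b (e : C v ≡ b) → b ≡ false → C (choose v b e) ≡ true × adj G v (choose v b e) ≡ true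
        go false e refl = proj₂ (dominated v e)

-- Star factors from assignments

length-filter-tabulate : ∀ {a p} {A : Set a} {P : A → Set p} (P? : ∀ x → Dec (P x)) (f : Fin n → A) →
  length (List.filter P? (List.tabulate f)) ≡ sum (λ i → ⟦ does (P? (f i)) ⟧)
length-filter-tabulate {zero}  P? f = refl
length-filter-tabulate {suc n} P? f with does (P? (f zero))
... | true  = cong suc (length-filter-tabulate P? (f ∘ suc))
... | false = length-filter-tabulate P? (f ∘ suc)

edge? : Graph (Fin n) → Subset n → Fin n → Fin n → Bool
edge? G S u v = does (u Fin.<? v) ∧ (does (u Subset.∈? S) ∧ (does (v Subset.∈? S) ∧ adj G u v))

edgesWithin-sum : (G : Graph (Fin n)) → ∀ S → edgesWithin G S ≡ sum (λ u → sum (λ v → ⟦ edge? G S u v ⟧))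
edgesWithin-sum {n} G S = go (λ i → i)
  where
  P? = λ (e : Fin n × Fin n) →
    (proj₁ e Fin.<? proj₂ e) ×-dec (proj₁ e Subset.∈? S) ×-dec (proj₂ e Subset.∈? S) ×-dec Bool.T? (adj G (proj₁ e) (proj₂ e))
  go : ∀ {m} (f : Fin m → Fin n) →
    length (List.filter P? (List.cartesianProduct (List.tabulate f) (List.allFin n))) ≡ sum (λ i → sum (λ v → ⟦ edge? G S (f i) v ⟧))
  go {zero}  f = refl
  go {suc m} f = begin
    length (List.filter P? (List.map (f zero ,_) (List.allFin n) List.++ rest))
      ≡⟨ cong length (List.filter-++ P? (List.map (f zero ,_) (List.allFin n)) rest) ⟩
    length (List.filter P? (List.map (f zero ,_) (List.allFin n)) List.++ List.filter P? rest)
      ≡⟨ List.length-++ (List.filter P? (List.map (f zero ,_) (List.allFin n))) ⟩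
    length (List.filter P? (List.map (f zero ,_) (List.allFin n))) + length (List.filter P? rest)
      ≡⟨ cong₂ _+_ (trans (cong (length ∘ List.filter P?) (List.map-tabulate (λ i → i) (f zero ,_)))
                          (length-filter-tabulate P? (f zero ,_))) (go (f ∘ suc)) ⟩
    sum (λ v → ⟦ edge? G S (f zero) v ⟧) + sum (λ i → sum (λ v → ⟦ edge? G S (f (suc i)) v ⟧)) ∎
    where
    open ≡-Reasoning
    rest = List.cartesianProduct (List.tabulate (f ∘ suc)) (List.allFin n)

-- Vertices of `induced` carry membership proofs. Their uniqueness lets injectivity and inequality
-- of vertices pass between a graph and its induced subgraphs.
∈-irrelevant : {S : Subset n} {u : Fin n} (p q : u ∈ S) → p ≡ q
∈-irrelevant here      here      = refl
∈-irrelevant (there p) (there q) = cong there (∈-irrelevant p q)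

∃∈-≡ : {S : Subset n} {u v : ∃ (_∈ S)} → proj₁ u ≡ proj₁ v → u ≡ v
∃∈-≡ {u = u , p} {v = .u , q} refl = cong (u ,_) (∈-irrelevant p q)

induced-forest : (H : Graph (Fin n)) → IsForest H → ∀ S → IsForest (induced H S)
induced-forest H forest S k f (inj , path , close) = forest k (proj₁ ∘ f) ((λ e → inj (∃∈-≡ e)) , path , close)

module StarFactor {n} (G : Graph (Fin n)) (C : Fin n → Bool) (f : Fin n → Fin n)
  (valid : Assignment.Valid G C f) where

  open Assignment G C using (load)

  arc : Fin n → Fin n → Bool
  arc u v = not (C u) ∧ does (f u Fin.≟ v)

  arc⇒ : ∀ {u v} → arc u v ≡ true → C u ≡ false × f u ≡ v
  arc⇒ {u} {v} e = let (a , b) = true-∧ e in not-true a , true-does (f u Fin.≟ v) b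

  ⇒arc : ∀ {u v} → C u ≡ false → f u ≡ v → arc u v ≡ true
  ⇒arc {u} {v} cu fu rewrite cu = does-true (f u Fin.≟ v) fu

  factor : Graph (Fin n)
  factor = record
    { adj    = λ u v → arc u v ∨ arc v u
    ; symm   = λ u v → Bool.∨-comm (arc u v) (arc v u)
    ; irrefl = λ v → Bool.¬-not λ e → loop (Sum.reduce (true-∨ e))
    }
    where
    loop : ∀ {v} → arc v v ≡ true → ⊥
    loop {v} a = let (cv , fv) = arc⇒ a in true≢false (trans (cong C (sym fv)) (proj₁ (valid v cv))) cv

  leaf-edge : ∀ u v → C u ≡ false → Adj factor u v → f u ≡ v
  leaf-edge u v cu e with true-∨ (T⇒true e)
  ... | inj₁ a = proj₂ (arc⇒ a)
  ... | inj₂ a = let (cv , fv) = arc⇒ a in ⊥-elim (true≢false (trans (cong C (sym fv)) (proj₁ (valid v cv))) cu)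

  centre-edge : ∀ u v → C u ≡ true → Adj factor u v → C v ≡ false × f v ≡ u
  centre-edge u v cu e with true-∨ (T⇒true e)
  ... | inj₁ a = ⊥-elim (true≢false cu (proj₁ (arc⇒ a)))
  ... | inj₂ a = arc⇒ a

  edge-in : ∀ {v} → C v ≡ false → Adj factor (f v) v
  edge-in {v} cv = true⇒T (trans (cong (arc (f v) v ∨_) (⇒arc cv refl)) (Bool.∨-zeroʳ (arc (f v) v)))

  edge-sym : ∀ u v → Adj factor u v → Adj factor v u
  edge-sym u v = subst T (symm factor u v)

  -- An invariant of components: both ends of an edge have the same root, and each vertex is joined
  -- to its root. So a component consists of one centre and the leaves assigned to it.
  root : Fin n → Fin n
  root v = if C v then v else f v

  root-centre : ∀ {v} → C v ≡ true → root v ≡ v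
  root-centre cv rewrite cv = refl

  root-leaf : ∀ {v} → C v ≡ false → root v ≡ f v
  root-leaf cv rewrite cv = refl

  root∈C : ∀ v → C (root v) ≡ true
  root∈C v with C v in cv
  ... | true  = cv
  ... | false = proj₁ (valid v cv)

  root-edge : ∀ u v → Adj factor u v → root u ≡ root v
  root-edge u v e with true-or-false (C u)
  ... | inj₁ cu = let (cv , fv) = centre-edge u v cu e in trans (root-centre cu) (trans (sym fv) (sym (root-leaf cv)))
  ... | inj₂ cu = let fu = leaf-edge u v cu e in
    trans (root-leaf cu) (trans fu (sym (root-centre (trans (cong C (sym fu)) (proj₁ (valid u cu))))))

  root-reachable : ∀ {u v} → Reachable factor u v → root u ≡ root v
  root-reachable ε       = refl
  root-reachable {u} (_◅_ {j = w} e p) = trans (root-edge u w e) (root-reachable p)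

  to-root : ∀ v → Reachable factor v (root v)
  to-root v with C v in cv
  ... | true  = ε
  ... | false = edge-sym (f v) v (edge-in cv) ◅ ε

  factor⊑ : factor ⊑ G
  factor⊑ u v e with true-∨ (T⇒true e)
  ... | inj₁ a = let (cu , fu) = arc⇒ a in true⇒T (subst (λ x → adj G u x ≡ true) fu (proj₂ (valid u cu)))
  ... | inj₂ a = let (cv , fv) = arc⇒ a in
    true⇒T (trans (symm G u v) (subst (λ x → adj G v x ≡ true) fv (proj₂ (valid v cv))))

  -- A leaf has a single neighbour. If the second vertex of a cycle is a leaf, its two neighbours on
  -- the cycle coincide; otherwise the first vertex is a leaf, and its neighbours, the second and
  -- the last vertex, coincide.
  factor-forest : IsForest factor
  factor-forest k F (inj , path , close) with C (F (suc zero)) in c₁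
  ... | false = case inj (trans (sym (leaf-edge (F (suc zero)) (F zero) c₁ (edge-sym (F zero) (F (suc zero)) (path zero))))
                      (leaf-edge (F (suc zero)) (F (suc (suc zero))) c₁ (path (suc zero)))) of λ ()
  ... | true  = let (c₀ , f₀) = centre-edge (F (suc zero)) (F zero) c₁ (edge-sym (F zero) (F (suc zero)) (path zero)) in
    case inj (trans (sym f₀) (leaf-edge (F zero) (F (Fin.fromℕ _)) c₀ (edge-sym (F (Fin.fromℕ _)) (F zero) close))) of λ ()

  module Component (S : Subset n) (v : Fin n) (S-component : ∀ u → u ∈ S ⇔ Reachable factor v u) where

    c : Fin n
    c = root v

    c∈S : c ∈ S
    c∈S = Equivalence.from (S-component c) (to-root v)

    root-S : ∀ {u} → u ∈ S → root u ≡ c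
    root-S u∈S = sym (root-reachable (Equivalence.to (S-component _) u∈S))

    leaf : ∀ {u} → u ∈ S → u ≢ c → C u ≡ false × f u ≡ c
    leaf {u} u∈S u≢c with C u in cu
    ... | true  = contradiction (trans (sym (root-centre cu)) (root-S u∈S)) u≢c
    ... | false = refl , trans (sym (root-leaf cu)) (root-S u∈S)

    centre-adj : ∀ {u} → u ∈ S → u ≢ c → Adj factor c u
    centre-adj u∈S u≢c = let (cu , fu) = leaf u∈S u≢c in subst (λ x → Adj factor x _) fu (edge-in cu)

    is-star : IsStar (induced factor S)
    is-star = (((c , c∈S) , connected) , induced-forest factor factor-forest S) ,
      (c , c∈S) , λ (u , u∈S) u≢c → centre-adj u∈S (λ e → u≢c (∃∈-≡ e))
      where
      up : ∀ u → Reachable (induced factor S) u (c , c∈S)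
      up (u , u∈S) with u Fin.≟ c
      ... | yes refl = subst (Reachable (induced factor S) (u , u∈S)) (∃∈-≡ refl) ε
      ... | no u≢c   = edge-sym c u (centre-adj u∈S u≢c) ◅ ε
      down : ∀ u → Reachable (induced factor S) (c , c∈S) u
      down (u , u∈S) with u Fin.≟ c
      ... | yes refl = subst (Reachable (induced factor S) (c , c∈S)) (∃∈-≡ refl) ε
      ... | no u≢c   = centre-adj u∈S u≢c ◅ ε
      connected : ∀ u w → Reachable (induced factor S) u w
      connected u w = up u ◅◅ down w

    -- `edgesWithin` counts an edge at its smaller end, and the centre may lie on either side of a
    -- leaf. Each of the two sides is bounded crudely by the number of all edges, whence the factor
    -- 2.
    load≤edges : load f c ≤ 2 * edgesWithin factor S
    load≤edges = begin
      sum (λ w → ⟦ arc w c ⟧)                                       ≤⟨ sum-mono pointwise ⟩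
      sum (λ w → ⟦ edge? factor S c w ⟧ + ⟦ edge? factor S w c ⟧)   ≡⟨ ∑-distrib-+ (λ w → ⟦ edge? factor S c w ⟧) (λ w → ⟦ edge? factor S w c ⟧) ⟩
      sum (λ w → ⟦ edge? factor S c w ⟧) + sum (λ w → ⟦ edge? factor S w c ⟧)
        ≤⟨ +-mono-≤ (term≤sum (λ u → sum (λ w → ⟦ edge? factor S u w ⟧)) c)
                    (sum-mono λ w → term≤sum (λ x → ⟦ edge? factor S w x ⟧) c) ⟩
      E + E                                                         ≡⟨ cong (E +_) (+-identityʳ E) ⟨
      2 * E                                                         ≡⟨ cong (2 *_) (edgesWithin-sum factor S) ⟨
      2 * edgesWithin factor S                                      ∎
      where
      open ≤-Reasoning
      E = sum (λ u → sum (λ w → ⟦ edge? factor S u w ⟧))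
      present : ∀ {u w} → u Fin.< w → u ∈ S → w ∈ S → Adj factor u w → edge? factor S u w ≡ true
      present {u} {w} lt u∈S w∈S e = ∧-true (does-true (u Fin.<? w) lt)
        (∧-true (does-true (u Subset.∈? S) u∈S) (∧-true (does-true (w Subset.∈? S) w∈S) (T⇒true e)))
      pointwise : ∀ w → ⟦ arc w c ⟧ ≤ ⟦ edge? factor S c w ⟧ + ⟦ edge? factor S w c ⟧
      pointwise w with true-or-false (arc w c)
      ... | inj₂ a = subst (λ b → ⟦ b ⟧ ≤ ⟦ edge? factor S c w ⟧ + ⟦ edge? factor S w c ⟧) (sym a) z≤n
      ... | inj₁ a with arc⇒ a
      ...   | (cw , fw) = ≤-trans (⟦⟧≤1 (arc w c)) (orient (Fin.<-cmp w c))
        where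
        e : Adj factor c w
        e = subst (λ x → Adj factor x w) fw (edge-in cw)
        w∈S : w ∈ S
        w∈S = Equivalence.from (S-component w) (to-root v ◅◅ e ◅ ε)
        orient : _ → 1 ≤ ⟦ edge? factor S c w ⟧ + ⟦ edge? factor S w c ⟧
        orient (tri< lt _ _) = ≤-trans (≤-reflexive (cong ⟦_⟧ (sym (present lt w∈S c∈S (edge-sym c w e))))) (m≤n+m _ _)
        orient (tri≈ _ w≡c _) = ⊥-elim (true≢false (trans (cong C w≡c) (root∈C v)) cw)
        orient (tri> _ _ gt) = ≤-trans (≤-reflexive (cong ⟦_⟧ (sym (present gt c∈S w∈S e)))) (m≤m+n _ _)

  starFactor : IsStarFactor G factor
  starFactor = factor⊑ , factor-forest , λ S (v , h) → Component.is-star S v h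

large-star-factor : (G : Graph (Fin n)) (C : Fin n → Bool) (M s : ℕ) .{{_ : NonZero M}} →
  (∀ v → C v ≡ false → ∃[ c ] C c ≡ true × adj G v c ≡ true) →
  (∀ v → C v ≡ false → sum (λ c → ⟦ C c ∧ adj G v c ⟧) ≤ M) →
  (∀ c → C c ≡ true → M * s ≤ sum (λ v → ⟦ not (C v) ∧ adj G c v ⟧)) →
  ∃[ H ] IsStarFactor G H × (∀ S → IsComponent H S → s ≤ 2 * edgesWithin H S)
large-star-factor G C M s dominated few many =
  let (f , valid , loads) = Assignment.assignment G C M s few many dominated
      open StarFactor G C f valid
  in factor , starFactor , λ S (v , h) → ≤-trans (loads (root v) (root∈C v)) (Component.load≤edges S v h)

-- The Lovász local lemma

decode : ∀ n → Fin (q ^ n) → Vec (Fin q) n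
decode     zero    k = []
decode {q} (suc n) k = proj₁ (remQuot {q} (q ^ n) k) ∷ decode n (proj₂ (remQuot {q} (q ^ n) k))

-- For an indicator this is its probability under a uniform random colouring, multiplied by `q ^ n`.
sumVec : (Vec (Fin q) n → ℕ) → ℕ
sumVec {q} {n} F = sum {q ^ n} (λ k → F (decode n k))

sumVec-suc : (F : Vec (Fin q) (suc n) → ℕ) → sumVec F ≡ sum (λ c → sumVec (λ f → F (c ∷ f)))
sumVec-suc {q} {n} F = sum-remQuot q (λ c k → F (c ∷ decode n k))

sumVec-mono : {F H : Vec (Fin q) n → ℕ} → (∀ f → F f ≤ H f) → sumVec F ≤ sumVec H
sumVec-mono {n = n} h = sum-mono (λ k → h (decode n k))

sumVec-cong : {F H : Vec (Fin q) n → ℕ} → (∀ f → F f ≡ H f) → sumVec F ≡ sumVec H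
sumVec-cong {q} {n} h = sum-cong-≗ {q ^ n} (λ k → h (decode n k))

sumVec-+ : (F H : Vec (Fin q) n → ℕ) → sumVec (λ f → F f + H f) ≡ sumVec F + sumVec H
sumVec-+ {q} {n} F H = ∑-distrib-+ {q ^ n} (F ∘ decode n) (H ∘ decode n)

sumVec-*ˡ : ∀ x (F : Vec (Fin q) n → ℕ) → sumVec (λ f → x * F f) ≡ x * sumVec F
sumVec-*ˡ {q} {n} x F = sym (*-distribˡ-sum {q ^ n} x (F ∘ decode n))

sumVec-sum : (F : Fin m → Vec (Fin q) n → ℕ) → sumVec (λ f → sum (λ i → F i f)) ≡ sum (λ i → sumVec (F i))
sumVec-sum {m} {q} {n} F = ∑-comm {q ^ n} {m} (λ k i → F i (decode n k))

sumVec>0⇒∃ : (F : Vec (Fin q) n → ℕ) → 0 < sumVec F → ∃[ f ] 0 < F f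
sumVec>0⇒∃ {n = n} F h = let (k , p) = sum>0⇒∃ (F ∘ decode n) h in decode n k , p

module _ {q : ℕ} where

  private
    Colouring : ℕ → Set
    Colouring n = Vec (Fin (suc q)) n

  independent-suc : (P Q : Colouring (suc n) → ℕ) (P′ : Colouring n → ℕ) → (∀ c f → P (c ∷ f) ≡ P′ f) →
    (∀ c → sumVec (λ f → P′ f * Q (c ∷ f)) * suc q ^ n ≡ sumVec P′ * sumVec (λ f → Q (c ∷ f))) →
    sumVec (λ f → P f * Q f) * suc q ^ suc n ≡ sumVec P * sumVec Q
  independent-suc {n} P Q P′ PP′ ih = begin
    sumVec (λ f → P f * Q f) * (suc q * K)
      ≡⟨ cong (_* (suc q * K)) (sumVec-suc (λ f → P f * Q f)) ⟩
    sum (λ c → sumVec (λ f → P (c ∷ f) * Q (c ∷ f))) * (suc q * K)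
      ≡⟨ cong (_* (suc q * K)) (sum-cong-≗ {suc q} λ c → sumVec-cong λ f → cong (_* Q (c ∷ f)) (PP′ c f)) ⟩
    sum (λ c → sumVec (λ f → P′ f * Q (c ∷ f))) * (suc q * K)
      ≡⟨ rearrange (sum (λ c → sumVec (λ f → P′ f * Q (c ∷ f)))) (suc q) K ⟩
    suc q * (sum (λ c → sumVec (λ f → P′ f * Q (c ∷ f))) * K)
      ≡⟨ cong (suc q *_) (*-distribʳ-sum {suc q} K (λ c → sumVec (λ f → P′ f * Q (c ∷ f)))) ⟩
    suc q * sum (λ c → sumVec (λ f → P′ f * Q (c ∷ f)) * K)
      ≡⟨ cong (suc q *_) (sum-cong-≗ {suc q} ih) ⟩
    suc q * sum (λ c → sumVec P′ * sumVec (λ f → Q (c ∷ f)))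
      ≡⟨ cong (suc q *_) (*-distribˡ-sum {suc q} (sumVec P′) (λ c → sumVec (λ f → Q (c ∷ f)))) ⟨
    suc q * (sumVec P′ * sum (λ c → sumVec (λ f → Q (c ∷ f))))
      ≡⟨ *-assoc (suc q) (sumVec P′) _ ⟨
    suc q * sumVec P′ * sum (λ c → sumVec (λ f → Q (c ∷ f)))
      ≡⟨ cong₂ _*_ (trans (sumVec-suc P) (sum-const′ {suc q} λ c → sumVec-cong (PP′ c))) (sumVec-suc Q) ⟨
    sumVec P * sumVec Q ∎
    where
    open ≡-Reasoning
    K = suc q ^ n
    rearrange : ∀ a b c → a * (b * c) ≡ b * (a * c)
    rearrange = solve-∀

  -- E(PQ) = E(P) E(Q), cleared of denominators, for functions of disjoint sets of coordinates. By
  -- induction on the coordinates: the first one is seen by at most one of the two factors, and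
  -- `independent-suc` applies to the other, with the roles exchanged if necessary.
  independent : ∀ n (U : Fin n → Bool) (P Q : Colouring n → ℕ) →
    (∀ f g → (∀ w → U w ≡ true → lookup f w ≡ lookup g w) → P f ≡ P g) →
    (∀ f g → (∀ w → U w ≡ false → lookup f w ≡ lookup g w) → Q f ≡ Q g) →
    sumVec (λ f → P f * Q f) * suc q ^ n ≡ sumVec P * sumVec Q
  independent zero U P Q hP hQ = base (P []) (Q [])
    where
    base : ∀ a b → (a * b + 0) * 1 ≡ (a + 0) * (b + 0)
    base = solve-∀
  independent (suc n) U P Q hP hQ with U zero in u₀
  -- `P` does not see the first colour, so any fixed colour may stand there.
  ... | false = independent-suc P Q (λ f → P (zero ∷ f))
    (λ c f → hP (c ∷ f) (zero ∷ f) λ { zero e → ⊥-elim (true≢false e u₀) ; (suc w) e → refl })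
    (λ c → independent n (U ∘ suc) (λ f → P (zero ∷ f)) (λ f → Q (c ∷ f))
      (λ f g h → hP (zero ∷ f) (zero ∷ g) λ { zero e → refl ; (suc w) e → h w e })
      (λ f g h → hQ (c ∷ f) (c ∷ g) λ { zero e → refl ; (suc w) e → h w e }))
  ... | true = trans (cong (_* suc q ^ suc n) (sumVec-cong λ f → *-comm (P f) (Q f)))
    (trans (independent-suc Q P (λ f → Q (zero ∷ f))
      (λ c f → hQ (c ∷ f) (zero ∷ f) λ { zero e → ⊥-elim (true≢false u₀ e) ; (suc w) e → refl })
      (λ c → trans (cong (_* suc q ^ n) (sumVec-cong λ f → *-comm (Q (zero ∷ f)) (P (c ∷ f))))
        (trans (independent n (U ∘ suc) (λ f → P (c ∷ f)) (λ f → Q (zero ∷ f))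
          (λ f g h → hP (c ∷ f) (c ∷ g) λ { zero e → refl ; (suc w) e → h w e })
          (λ f g h → hQ (zero ∷ f) (zero ∷ g) λ { zero e → refl ; (suc w) e → h w e }))
          (*-comm (sumVec λ f → P (c ∷ f)) (sumVec λ f → Q (zero ∷ f))))))
      (*-comm (sumVec Q) (sumVec P)))

  sumVec-const : ∀ n {x} → sumVec {suc q} {n} (λ _ → x) ≡ suc q ^ n * x
  sumVec-const n = sum-const (suc q ^ n)

  -- The symmetric local lemma with the condition 4Dp ≤ 1, where `D` bounds the number of events
  -- dependent on a given one. A factor 2 is spent on dropping the dependent events from the
  -- condition, and the other one leaves a conditional probability of at most 1/2D.
  module LocalLemma {m n} (Bad : Fin m → Colouring n → Bool) (dep : Fin m → Fin n → Bool)
    (local : ∀ u f g → (∀ w → dep u w ≡ true → lookup f w ≡ lookup g w) → Bad u f ≡ Bad u g)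
    (Γ : Fin m → Fin m → Bool) (disjoint : ∀ u w → Γ u w ≡ false → ∀ z → dep w z ≡ true → dep u z ≡ false)
    (D : ℕ) .{{_ : NonZero D}} (few : ∀ u → card (Γ u) ≤ D)
    (rare : ∀ u → 4 * D * sumVec (λ f → ⟦ Bad u f ⟧) ≤ suc q ^ n) where

    K : ℕ
    K = suc q ^ n

    avoids? : ∀ (T : Fin m → Bool) f → Dec (∀ u → T u ∧ Bad u f ≡ false)
    avoids? T f = Fin.all? (λ u → T u ∧ Bad u f Bool.≟ false)

    avoids : (Fin m → Bool) → Colouring n → Bool
    avoids T f = does (avoids? T f)

    avoids⇒ : ∀ T f → avoids T f ≡ true → ∀ u → T u ≡ true → Bad u f ≡ false
    avoids⇒ T f e u tu = subst (λ b → b ∧ Bad u f ≡ false) tu (true-does (avoids? T f) e u)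

    ⇒avoids : ∀ T f → (∀ u → T u ≡ true → Bad u f ≡ false) → avoids T f ≡ true
    ⇒avoids T f h = does-true (avoids? T f) go
      where
      go : ∀ u → T u ∧ Bad u f ≡ false
      go u with T u in tu
      ... | true  = h u tu
      ... | false = refl

    good : (Fin m → Bool) → ℕ
    good T = sumVec (λ f → ⟦ avoids T f ⟧)

    hit : Fin m → (Fin m → Bool) → ℕ
    hit u T = sumVec (λ f → ⟦ Bad u f ⟧ * ⟦ avoids T f ⟧)

    far : Fin m → (Fin m → Bool) → Fin m → Bool
    far u T w = T w ∧ not (Γ u w)

    -- Events far from `u` are determined by coordinates outside `dep u`, so here the independence
    -- is exact.
    hit-far : ∀ u T → hit u (far u T) * K ≡ sumVec (λ f → ⟦ Bad u f ⟧) * good (far u T)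
    hit-far u T = independent n (dep u) (λ f → ⟦ Bad u f ⟧) (λ f → ⟦ avoids (far u T) f ⟧)
      (λ f g h → cong ⟦_⟧ (local u f g h))
      (λ f g h → ≤-antisym (⟦⟧-mono (transfer f g h)) (⟦⟧-mono (transfer g f (λ w e → sym (h w e)))))
      where
      transfer : ∀ f g → (∀ w → dep u w ≡ false → lookup f w ≡ lookup g w) → avoids (far u T) f ≡ true → avoids (far u T) g ≡ true
      transfer f g h e = ⇒avoids (far u T) g λ w fw →
        trans (local w g f λ z dz → sym (h z (disjoint u w (not-true (proj₂ (true-∧ {T w} fw))) z dz))) (avoids⇒ (far u T) f e w fw)

    avoids-mono : ∀ T T′ f → (∀ u → T′ u ≡ true → T u ≡ true) → avoids T f ≡ true → avoids T′ f ≡ true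
    avoids-mono T T′ f sub e = ⇒avoids T′ f λ u tu → avoids⇒ T f e u (sub u tu)

    hit-mono : ∀ u T → hit u T ≤ hit u (far u T)
    hit-mono u T = sumVec-mono λ f → *-monoʳ-≤ ⟦ Bad u f ⟧ (⟦⟧-mono (avoids-mono T (far u T) f λ w e → proj₁ (true-∧ e)))

    -- A colouring that avoids the far events of `T` either avoids all of `T` or falls into some
    -- near event.
    union-bound : ∀ u T → good (far u T) ≤ good T + sum (λ w → ⟦ T w ∧ Γ u w ⟧ * hit w (far u T))
    union-bound u T = begin
      good (far u T)  ≤⟨ sumVec-mono pointwise ⟩
      sumVec (λ f → ⟦ avoids T f ⟧ + sum (λ w → ⟦ T w ∧ Γ u w ⟧ * (⟦ Bad w f ⟧ * ⟦ avoids (far u T) f ⟧)))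
        ≡⟨ sumVec-+ (λ f → ⟦ avoids T f ⟧) (λ f → sum (λ w → ⟦ T w ∧ Γ u w ⟧ * (⟦ Bad w f ⟧ * ⟦ avoids (far u T) f ⟧))) ⟩
      good T + sumVec (λ f → sum (λ w → ⟦ T w ∧ Γ u w ⟧ * (⟦ Bad w f ⟧ * ⟦ avoids (far u T) f ⟧)))
        ≡⟨ cong (good T +_) (sumVec-sum (λ w f → ⟦ T w ∧ Γ u w ⟧ * (⟦ Bad w f ⟧ * ⟦ avoids (far u T) f ⟧))) ⟩
      good T + sum (λ w → sumVec (λ f → ⟦ T w ∧ Γ u w ⟧ * (⟦ Bad w f ⟧ * ⟦ avoids (far u T) f ⟧)))
        ≡⟨ cong (good T +_) (sum-cong-≗ {m} λ w → sumVec-*ˡ ⟦ T w ∧ Γ u w ⟧ (λ f → ⟦ Bad w f ⟧ * ⟦ avoids (far u T) f ⟧)) ⟩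
      good T + sum (λ w → ⟦ T w ∧ Γ u w ⟧ * hit w (far u T)) ∎
      where
      open ≤-Reasoning
      pointwise : ∀ f → ⟦ avoids (far u T) f ⟧ ≤
        ⟦ avoids T f ⟧ + sum (λ w → ⟦ T w ∧ Γ u w ⟧ * (⟦ Bad w f ⟧ * ⟦ avoids (far u T) f ⟧))
      pointwise f with avoids (far u T) f in af | ∃true? (λ w → (T w ∧ Γ u w) ∧ Bad w f)
      ... | false | _ = z≤n
      ... | true | yes (w , e) = let (tw , bw) = true-∧ {T w ∧ Γ u w} e in
        ≤-trans (≤-trans (≤-reflexive (cong₂ (λ a b → ⟦ a ⟧ * (⟦ b ⟧ * 1)) (sym tw) (sym bw)))
                  (term≤sum (λ w → ⟦ T w ∧ Γ u w ⟧ * (⟦ Bad w f ⟧ * 1)) w)) (m≤n+m _ ⟦ avoids T f ⟧)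
      ... | true | no none = ≤-trans (≤-reflexive (cong ⟦_⟧ (sym (⇒avoids T f λ w tw → Bool.¬-not λ bw → case true-or-false (Γ u w) of λ
        { (inj₁ near) → none (w , ∧-true (∧-true tw near) bw)
        ; (inj₂ away) → true≢false bw (avoids⇒ (far u T) f af w (∧-true tw (cong not away))) })))) (m≤m+n ⟦ avoids T f ⟧ _)

    -- Conditioned on avoiding T, Bad u has probability at most 1/2D.  The events of T near u
    -- are dropped, which by induction at most doubles the probability of avoidance.
    hit-rare : ∀ k T → card T ≤ k → ∀ u → hit u T * (2 * D) ≤ good T
    hit-rare k T le u = *-cancelˡ-≤ (2 * K) {{>-nonZero (*-monoʳ-< 2 K>0)}} (begin
      2 * K * (hit u T * (2 * D))              ≡⟨ lhs K (hit u T) D ⟩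
      4 * D * (hit u T * K)                    ≤⟨ *-monoʳ-≤ (4 * D) (*-monoˡ-≤ K (hit-mono u T)) ⟩
      4 * D * (hit u (far u T) * K)            ≡⟨ cong (4 * D *_) (hit-far u T) ⟩
      4 * D * (B * good (far u T))             ≡⟨ *-assoc (4 * D) B _ ⟨
      4 * D * B * good (far u T)               ≤⟨ *-mono-≤ (rare u) far≤ ⟩
      K * (2 * good T)                         ≡⟨ rhs K (good T) ⟩
      2 * K * good T                           ∎)
      where
      open ≤-Reasoning
      B = sumVec (λ f → ⟦ Bad u f ⟧)
      K>0 : 0 < K
      K>0 = m^n>0 (suc q) n
      lhs : ∀ k h d → 2 * k * (h * (2 * d)) ≡ 4 * d * (h * k)
      lhs = solve-∀
      rhs : ∀ k g → k * (2 * g) ≡ 2 * k * g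
      rhs = solve-∀
      Near = sum (λ w → ⟦ T w ∧ Γ u w ⟧ * hit w (far u T))
      smaller : ∀ w → T w ∧ Γ u w ≡ true → card (far u T) < card T
      smaller w e = let (tw , g) = true-∧ {T w} e in
        card-< (λ x → proj₁ ∘ true-∧) w (trans (cong (_∧ not (Γ u w)) tw) (cong not g)) tw
      recurse : ∀ k → card T ≤ k → ∀ w → T w ∧ Γ u w ≡ true → hit w (far u T) * (2 * D) ≤ good (far u T)
      recurse zero    le w e = contradiction (≤-trans (smaller w e) le) λ ()
      recurse (suc k) le w e = hit-rare k (far u T) (≤-pred (≤-trans (smaller w e) le)) w
      near≤ : Near * (2 * D) ≤ D * good (far u T)
      near≤ = begin
        Near * (2 * D)    ≡⟨ *-distribʳ-sum {m} (2 * D) (λ w → ⟦ T w ∧ Γ u w ⟧ * hit w (far u T)) ⟩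
        sum (λ w → ⟦ T w ∧ Γ u w ⟧ * hit w (far u T) * (2 * D))
          ≤⟨ sum-mono {m} (λ w → ≤-trans (≤-reflexive (*-assoc ⟦ T w ∧ Γ u w ⟧ _ _)) (⟦⟧*-mono (T w ∧ Γ u w) (recurse k le w))) ⟩
        sum (λ w → ⟦ T w ∧ Γ u w ⟧ * good (far u T))
          ≡⟨ *-distribʳ-sum {m} (good (far u T)) (λ w → ⟦ T w ∧ Γ u w ⟧) ⟨
        sum (λ w → ⟦ T w ∧ Γ u w ⟧) * good (far u T)
          ≤⟨ *-monoˡ-≤ (good (far u T)) (≤-trans (sum-mono {m} λ w → ⟦⟧-mono (proj₂ ∘ true-∧ {T w})) (few u)) ⟩
        D * good (far u T) ∎
      far≤ : good (far u T) ≤ 2 * good T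
      far≤ = *-cancelˡ-≤ D (+-cancelʳ-≤ (D * good (far u T)) _ _ (begin
        D * good (far u T) + D * good (far u T)    ≡⟨ dbl D (good (far u T)) ⟩
        good (far u T) * (2 * D)                   ≤⟨ *-monoˡ-≤ (2 * D) (union-bound u T) ⟩
        (good T + Near) * (2 * D)                  ≡⟨ *-distribʳ-+ (2 * D) (good T) Near ⟩
        good T * (2 * D) + Near * (2 * D)          ≤⟨ +-monoʳ-≤ (good T * (2 * D)) near≤ ⟩
        good T * (2 * D) + D * good (far u T)      ≡⟨ cong (_+ D * good (far u T)) (sw (good T) D) ⟩
        D * (2 * good T) + D * good (far u T)      ∎))
        where
        dbl : ∀ d g → d * g + d * g ≡ g * (2 * d)
        dbl = solve-∀
        sw : ∀ g d → g * (2 * d) ≡ d * (2 * g)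
        sw = solve-∀

    -- Otherwise every colouring that avoids `T` would lie in `Bad u`, whose conditional probability
    -- is at most 1/2.
    good-insert : ∀ T u → 0 < good T → 0 < good (insert u T)
    good-insert T u pos = ≰⇒> λ none → <-irrefl refl (begin-strict
      good T                        <⟨ m<m+n (good T) pos ⟩
      good T + good T               ≤⟨ +-mono-≤ (≤-trans (all-hit none) (m≤n*m (hit u T) D)) (≤-trans (all-hit none) (m≤n*m (hit u T) D)) ⟩
      D * hit u T + D * hit u T     ≡⟨ dbl D (hit u T) ⟩
      hit u T * (2 * D)             ≤⟨ hit-rare (card T) T ≤-refl u ⟩
      good T                        ∎)
      where
      open ≤-Reasoning
      dbl : ∀ d g → d * g + d * g ≡ g * (2 * d)
      dbl = solve-∀
      split : good T ≤ good (insert u T) + hit u T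
      split = ≤-trans (sumVec-mono pointwise) (≤-reflexive (sumVec-+ (λ f → ⟦ avoids (insert u T) f ⟧) (λ f → ⟦ Bad u f ⟧ * ⟦ avoids T f ⟧)))
        where
        pointwise : ∀ f → ⟦ avoids T f ⟧ ≤ ⟦ avoids (insert u T) f ⟧ + ⟦ Bad u f ⟧ * ⟦ avoids T f ⟧
        pointwise f with avoids T f in af | Bad u f in bu
        ... | false | _     = z≤n
        ... | true  | true  = m≤n+m 1 ⟦ avoids (insert u T) f ⟧
        ... | true  | false = ≤-trans (≤-reflexive (cong ⟦_⟧ (sym (⇒avoids (insert u T) f λ w iw → case insert-inv u T iw of λ
          { (inj₁ refl) → bu ; (inj₂ tw) → avoids⇒ T f af w tw })))) (m≤m+n ⟦ avoids (insert u T) f ⟧ _)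
      all-hit : good (insert u T) ≤ 0 → good T ≤ hit u T
      all-hit none = ≤-trans split (+-monoˡ-≤ (hit u T) none)

    avoidable : ∃[ f ] (∀ u → Bad u f ≡ false)
    avoidable =
      let (T , pos , full) = saturate {Inv = λ T → 0 < good T} {Done = λ T → ∀ u → T u ≡ true} next (λ _ → false) start
          (f , p)          = sumVec>0⇒∃ (λ f → ⟦ avoids T f ⟧) pos
      in f , λ u → avoids⇒ T f (positive p) u (full u)
      where
      next : ∀ T → 0 < good T → (∀ u → T u ≡ true) ⊎ ∃[ u ] T u ≡ false × 0 < good (insert u T)
      next T pos with Fin.any? (λ u → T u Bool.≟ false)
      ... | yes (u , tu) = inj₂ (u , tu , good-insert T u pos)
      ... | no none      = inj₁ λ u → Bool.¬-not λ tu → none (u , tu)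
      start : 0 < good (λ _ → false)
      start = subst (0 <_) (sym (trans (sumVec-cong λ f → cong ⟦_⟧ (⇒avoids (λ _ → false) f λ u ())) (trans (sumVec-const n) (*-identityʳ K))))
        (m^n>0 (suc q) n)
      positive : ∀ {b} → 0 < ⟦ b ⟧ → b ≡ true
      positive {true} _ = refl

-- Random centres

-- Bernoulli's inequality (1 + 1/a)^m ≥ 1 + m/a, cleared of denominators.
bernoulli : ∀ a m → a ^ m * (a + m) ≤ a * suc a ^ m
bernoulli a zero    = ≤-reflexive (base a)
  where
  base : ∀ a → 1 * (a + 0) ≡ a * 1
  base = solve-∀
bernoulli a (suc m) = begin
  a * a ^ m * (a + suc m)                       ≡⟨ expand a m (a ^ m) ⟩
  a * (a ^ m * (a + m)) + a ^ m * a             ≤⟨ +-monoʳ-≤ (a * (a ^ m * (a + m))) (*-monoʳ-≤ (a ^ m) (m≤m+n a m)) ⟩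
  a * (a ^ m * (a + m)) + a ^ m * (a + m)       ≡⟨ +-comm (a * (a ^ m * (a + m))) (a ^ m * (a + m)) ⟩
  suc a * (a ^ m * (a + m))                     ≤⟨ *-monoʳ-≤ (suc a) (bernoulli a m) ⟩
  suc a * (a * suc a ^ m)                       ≡⟨ swap a (suc a) (suc a ^ m) ⟩
  a * (suc a * suc a ^ m)                       ∎
  where
  open ≤-Reasoning
  expand : ∀ a m p → a * p * (a + suc m) ≡ a * (p * (a + m)) + p * a
  expand a m p = trans (cong (a * p *_) (+-suc a m)) (expand′ a m p)
    where
    expand′ : ∀ a m p → a * p * (1 + (a + m)) ≡ a * (p * (a + m)) + p * a
    expand′ = solve-∀
  swap : ∀ a b p → b * (a * p) ≡ a * (b * p)
  swap = solve-∀

-- (1 − 1/(q+1))^m ≥ 1 − m/(q+1), cleared of denominators; j stands for q + 1 − m.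
bernoulli⁻ : ∀ q m j → j + m ≡ suc q → suc q ^ m * j ≤ q ^ m * suc q
bernoulli⁻ q zero    j e = ≤-reflexive (cong (1 *_) (trans (sym (+-identityʳ j)) e))
bernoulli⁻ q (suc m) j e = begin
  suc q * suc q ^ m * j      ≡⟨ arrange₁ (suc q) (suc q ^ m) j ⟩
  suc q ^ m * (suc q * j)    ≤⟨ *-monoʳ-≤ (suc q ^ m) le ⟩
  suc q ^ m * (q * suc j)    ≡⟨ arrange₂ (suc q ^ m) q (suc j) ⟩
  q * (suc q ^ m * suc j)    ≤⟨ *-monoʳ-≤ q (bernoulli⁻ q m (suc j) (trans (sym (+-suc j m)) e)) ⟩
  q * (q ^ m * suc q)        ≡⟨ *-assoc q (q ^ m) (suc q) ⟨
  q * q ^ m * suc q          ∎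
  where
  open ≤-Reasoning
  arrange₁ : ∀ a b c → a * b * c ≡ b * (a * c)
  arrange₁ = solve-∀
  arrange₂ : ∀ a b c → a * (b * c) ≡ b * (a * c)
  arrange₂ = solve-∀
  j≤q : j ≤ q
  j≤q = ≤-pred (≤-trans (≤-reflexive (sym (+-comm j 1))) (≤-trans (+-monoʳ-≤ j (s≤s z≤n)) (≤-reflexive e)))
  le : suc q * j ≤ q * suc j
  le = ≤-trans (+-monoˡ-≤ (q * j) j≤q) (≤-reflexive (sym (*-suc q j)))

^-distribʳ-* : ∀ o m n → (m * n) ^ o ≡ m ^ o * n ^ o
^-distribʳ-* zero    m n = refl
^-distribʳ-* (suc o) m n = trans (cong (m * n *_) (^-distribʳ-* o m n)) (arrange m n (m ^ o) (n ^ o))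
  where
  arrange : ∀ a b c d → a * b * (c * d) ≡ a * c * (b * d)
  arrange = solve-∀

power-cancel : ∀ {x y a k} .{{_ : NonZero a}} → a ^ k * x ≤ a ^ k * y → x ≤ y
power-cancel {a = a} {k} = *-cancelˡ-≤ (a ^ k) {{m^n≢0 a k}}

-- (1 + 1/a)^(a+1) ≥ 2.
power-≥ : ∀ a .{{_ : NonZero a}} t d → suc a * t ≤ d → 2 ^ t * a ^ d ≤ suc a ^ d
power-≥ a t d h = subst (λ d → 2 ^ t * a ^ d ≤ suc a ^ d) (m+[n∸m]≡n h) (begin
  2 ^ t * a ^ (suc a * t + k)               ≡⟨ cong (2 ^ t *_) (^-distribˡ-+-* a (suc a * t) k) ⟩
  2 ^ t * (a ^ (suc a * t) * a ^ k)         ≡⟨ *-assoc (2 ^ t) _ _ ⟨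
  2 ^ t * a ^ (suc a * t) * a ^ k           ≡⟨ cong (λ z → 2 ^ t * z * a ^ k) (sym (^-*-assoc a (suc a) t)) ⟩
  2 ^ t * (a ^ suc a) ^ t * a ^ k           ≡⟨ cong (_* a ^ k) (sym (^-distribʳ-* t 2 (a ^ suc a))) ⟩
  (2 * a ^ suc a) ^ t * a ^ k               ≤⟨ *-mono-≤ (^-monoˡ-≤ t base) (^-monoˡ-≤ k (n≤1+n a)) ⟩
  (suc a ^ suc a) ^ t * suc a ^ k           ≡⟨ cong (_* suc a ^ k) (^-*-assoc (suc a) (suc a) t) ⟩
  suc a ^ (suc a * t) * suc a ^ k           ≡⟨ ^-distribˡ-+-* (suc a) (suc a * t) k ⟨
  suc a ^ (suc a * t + k)                   ∎)
  where
  open ≤-Reasoning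
  k = d ∸ suc a * t
  dbl : ∀ a p → a * (2 * p) ≡ p * (a + a)
  dbl = solve-∀
  base : 2 * a ^ suc a ≤ suc a ^ suc a
  base = *-cancelˡ-≤ a (begin
    a * (2 * a ^ suc a)        ≡⟨ dbl a (a ^ suc a) ⟩
    a ^ suc a * (a + a)        ≤⟨ *-monoʳ-≤ (a ^ suc a) (+-monoʳ-≤ a (n≤1+n a)) ⟩
    a ^ suc a * (a + suc a)    ≤⟨ bernoulli a (suc a) ⟩
    a * suc a ^ suc a          ∎)

-- (1 + 1/2r)^r ≤ 2.
power-≤ : ∀ r q .{{_ : NonZero q}} t d → 2 * r ≡ q → d ≤ r * t → suc q ^ d ≤ 2 ^ t * q ^ d
power-≤ r q t d refl h = power-cancel {a = q} {r * t} (begin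
  q ^ (r * t) * suc q ^ d                  ≡⟨ cong (λ e → q ^ e * suc q ^ d) (sym eq) ⟩
  q ^ (d + k) * suc q ^ d                  ≡⟨ cong (_* suc q ^ d) (^-distribˡ-+-* q d k) ⟩
  q ^ d * q ^ k * suc q ^ d                ≡⟨ arrange (q ^ d) (q ^ k) (suc q ^ d) ⟩
  q ^ d * (suc q ^ d * q ^ k)              ≤⟨ *-monoʳ-≤ (q ^ d) (*-monoʳ-≤ (suc q ^ d) (^-monoˡ-≤ k (n≤1+n q))) ⟩
  q ^ d * (suc q ^ d * suc q ^ k)          ≡⟨ cong (q ^ d *_) (trans (sym (^-distribˡ-+-* (suc q) d k)) (cong (suc q ^_) eq)) ⟩
  q ^ d * suc q ^ (r * t)                  ≡⟨ cong (q ^ d *_) (sym (^-*-assoc (suc q) r t)) ⟩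
  q ^ d * (suc q ^ r) ^ t                  ≤⟨ *-monoʳ-≤ (q ^ d) (^-monoˡ-≤ t base) ⟩
  q ^ d * (2 * q ^ r) ^ t                  ≡⟨ cong (q ^ d *_) (^-distribʳ-* t 2 (q ^ r)) ⟩
  q ^ d * (2 ^ t * (q ^ r) ^ t)            ≡⟨ cong (λ z → q ^ d * (2 ^ t * z)) (^-*-assoc q r t) ⟩
  q ^ d * (2 ^ t * q ^ (r * t))            ≡⟨ arrange′ (q ^ d) (2 ^ t) (q ^ (r * t)) ⟩
  q ^ (r * t) * (2 ^ t * q ^ d)            ∎)
  where
  open ≤-Reasoning
  k = r * t ∸ d
  eq : d + k ≡ r * t
  eq = m+[n∸m]≡n h
  arrange : ∀ a b c → a * b * c ≡ a * (c * b)
  arrange = solve-∀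
  arrange′ : ∀ a b c → a * (b * c) ≡ c * (b * a)
  arrange′ = solve-∀
  half : ∀ r → 1 + r + r ≡ 1 + 2 * r
  half = solve-∀
  dbl : ∀ r p → p * (2 + 2 * r) ≡ (1 + r) * (2 * p)
  dbl = solve-∀
  base : suc q ^ r ≤ 2 * q ^ r
  base = *-cancelˡ-≤ (suc r) (begin
    suc r * suc q ^ r        ≡⟨ *-comm (suc r) (suc q ^ r) ⟩
    suc q ^ r * suc r        ≤⟨ bernoulli⁻ q r (suc r) (half r) ⟩
    q ^ r * suc q            ≤⟨ *-monoʳ-≤ (q ^ r) (n≤1+n (suc q)) ⟩
    q ^ r * suc (suc q)      ≡⟨ dbl r (q ^ r) ⟩
    suc r * (2 * q ^ r)      ∎)

prod-≥1 : (f : Fin n → ℕ) → (∀ i → 1 ≤ f i) → 1 ≤ prod f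
prod-≥1 {zero}  f h = ≤-refl
prod-≥1 {suc n} f h = *-mono-≤ (h zero) (prod-≥1 (f ∘ suc) (h ∘ suc))

prod-2^ : (f : Fin n → ℕ) → prod (λ i → 2 ^ f i) ≡ 2 ^ sum f
prod-2^ {zero}  f = refl
prod-2^ {suc n} f = trans (cong (2 ^ f zero *_) (prod-2^ (f ∘ suc))) (sym (^-distribˡ-+-* 2 (f zero) (sum (f ∘ suc))))

-- The product is a^|U| b^(n-|U|); the extra power of `b` on the left avoids the subtraction.
prod-if : ∀ (U : Fin n → Bool) a b → prod (λ i → if U i then a else b) * b ^ card U ≡ a ^ card U * b ^ n
prod-if {zero}  U a b = refl
prod-if {suc n} U a b with U zero
... | true  = trans (arrange a (prod P) b (b ^ card (U ∘ suc))) (trans (cong (λ z → a * b * z) (prod-if (U ∘ suc) a b)) (sym (arrange a (a ^ card (U ∘ suc)) b (b ^ n))))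
  where
  P = λ i → if U (suc i) then a else b
  arrange : ∀ a p b c → a * p * (b * c) ≡ a * b * (p * c)
  arrange = solve-∀
... | false = trans (*-assoc b (prod P) (b ^ card (U ∘ suc))) (trans (cong (b *_) (prod-if (U ∘ suc) a b)) (arrange b (a ^ card (U ∘ suc)) (b ^ n)))
  where
  P = λ i → if U (suc i) then a else b
  arrange : ∀ b p c → b * (p * c) ≡ p * (b * c)
  arrange = solve-∀

-- The colours of different vertices are independent, so the expectation of a product over the
-- vertices factors; as a count this is distributivity.
sumVec-prod : (h : Fin n → Fin q → ℕ) → sumVec (λ f → prod (λ w → h w (lookup f w))) ≡ prod (λ w → sum (h w))
sumVec-prod {zero}      h = refl
sumVec-prod {suc n} {q} h = begin
  sumVec (λ f → prod (λ w → h w (lookup f w)))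
    ≡⟨ sumVec-suc (λ f → prod (λ w → h w (lookup f w))) ⟩
  sum (λ c → sumVec (λ f → h zero c * prod (λ w → h (suc w) (lookup f w))))
    ≡⟨ sum-cong-≗ {q} (λ c → sumVec-*ˡ (h zero c) (λ f → prod (λ w → h (suc w) (lookup f w)))) ⟩
  sum (λ c → h zero c * sumVec (λ f → prod (λ w → h (suc w) (lookup f w))))
    ≡⟨ *-distribʳ-sum {q} (sumVec (λ f → prod (λ w → h (suc w) (lookup f w)))) (h zero) ⟨
  sum (h zero) * sumVec (λ f → prod (λ w → h (suc w) (lookup f w)))
    ≡⟨ cong (sum (h zero) *_) (sumVec-prod (h ∘ suc)) ⟩
  sum (h zero) * prod (λ w → sum (h (suc w))) ∎
  where open ≡-Reasoning

isZero : Fin (suc q) → Bool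
isZero zero    = true
isZero (suc _) = false

-- Vertices of colour 0 are centres, so each vertex is one with probability 1/(q+1).
-- The two bad events at u, no centre and more than 25L centres among its d
-- neighbours, are bounded by (1 − 1/(q+1))^d and by E 2^X / 2^(25L).
module RandomCentres {n} (G : Graph (Fin n)) (d : ℕ) (regular : Regular d G)
  (r q L : ℕ) (2r≡ : 2 * r ≡ suc q) .{{_ : NonZero q}} (1≤L : 1 ≤ L)
  (lower : suc q * (5 * L) ≤ d) (upper : d ≤ r * (20 * L)) (d≤2^L : d ≤ 2 ^ L) where

  neighbours : ∀ u → card (adj G u) ≡ d
  neighbours u = trans (sym (degree-sum G u)) (regular u)

  X : Fin n → Vec (Fin (suc q)) n → ℕ
  X u f = sum (λ w → ⟦ adj G u w ∧ isZero (lookup f w) ⟧)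

  none many Bad : Fin n → Vec (Fin (suc q)) n → Bool
  none u f = does (X u f ≟ 0)
  many u f = does (25 * L <? X u f)
  Bad u f = none u f ∨ many u f

  K : ℕ
  K = suc q ^ n

  none-rare : ∀ u → 2 ^ (5 * L) * sumVec (λ f → ⟦ none u f ⟧) ≤ K
  none-rare u = power-cancel {a = suc q} {d} (begin
    suc q ^ d * (2 ^ (5 * L) * N)          ≡⟨ arrange (suc q ^ d) (2 ^ (5 * L)) N ⟩
    2 ^ (5 * L) * (N * suc q ^ d)          ≤⟨ *-monoʳ-≤ (2 ^ (5 * L)) (*-monoˡ-≤ (suc q ^ d) count) ⟩
    2 ^ (5 * L) * (P * suc q ^ d)          ≡⟨ cong (2 ^ (5 * L) *_) closed ⟩
    2 ^ (5 * L) * (q ^ d * K)              ≡⟨ *-assoc (2 ^ (5 * L)) (q ^ d) K ⟨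
    2 ^ (5 * L) * q ^ d * K                ≤⟨ *-monoˡ-≤ K (power-≥ q (5 * L) d lower) ⟩
    suc q ^ d * K                          ∎)
    where
    open ≤-Reasoning
    N = sumVec (λ f → ⟦ none u f ⟧)
    P = prod (λ w → if adj G u w then q else suc q)
    arrange : ∀ a b c → a * (b * c) ≡ b * (c * a)
    arrange = solve-∀
    closed : P * suc q ^ d ≡ q ^ d * K
    closed = subst (λ e → P * suc q ^ e ≡ q ^ e * K) (neighbours u) (prod-if (adj G u) q (suc q))
    h : Fin n → Fin (suc q) → ℕ
    h w c = ⟦ not (adj G u w ∧ isZero c) ⟧
    total : ∀ w → sum (h w) ≡ (if adj G u w then q else suc q)
    total w with adj G u w
    ... | true  = trans (sum-const q) (*-identityʳ q)
    ... | false = cong suc (trans (sum-const q) (*-identityʳ q))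
    pointwise : ∀ f → ⟦ none u f ⟧ ≤ prod (λ w → h w (lookup f w))
    pointwise f = ⟦⟧≤ (none u f) λ e → prod-≥1 (λ w → h w (lookup f w)) λ w →
      one w (≤-trans (term≤sum (λ w → ⟦ adj G u w ∧ isZero (lookup f w) ⟧) w) (≤-reflexive (true-does (X u f ≟ 0) e)))
      where
      one : ∀ w → ⟦ adj G u w ∧ isZero (lookup f w) ⟧ ≤ 0 → 1 ≤ h w (lookup f w)
      one w le with adj G u w ∧ isZero (lookup f w)
      ... | false = ≤-refl
    count : N ≤ P
    count = ≤-trans (sumVec-mono pointwise) (≤-reflexive (trans (sumVec-prod h) (prod-cong {n} total)))

  many-rare : ∀ u → 2 ^ (5 * L) * sumVec (λ f → ⟦ many u f ⟧) ≤ K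
  many-rare u = power-cancel {a = suc q} {d} (power-cancel {a = 2} {20 * L} (begin
    2 ^ (20 * L) * (suc q ^ d * (2 ^ (5 * L) * N))   ≡⟨ arrange (2 ^ (20 * L)) (suc q ^ d) (2 ^ (5 * L)) N ⟩
    2 ^ (20 * L) * 2 ^ (5 * L) * N * suc q ^ d       ≡⟨ cong (λ z → z * N * suc q ^ d) (trans (sym (^-distribˡ-+-* 2 (20 * L) (5 * L))) (cong (2 ^_) (sym (*-distribʳ-+ L 20 5)))) ⟩
    2 ^ (25 * L) * N * suc q ^ d                     ≤⟨ *-monoˡ-≤ (suc q ^ d) count ⟩
    P * suc q ^ d                                    ≡⟨ closed ⟩
    -- By `upper`, E 2^X is at most 2^(20L). Markov's inequality at the threshold 25L then leaves
    -- 2^(-5L), the same rarity as in `none-rare`.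
    suc (suc q) ^ d * K                              ≤⟨ *-monoˡ-≤ K (power-≤ r (suc q) (20 * L) d 2r≡ upper) ⟩
    2 ^ (20 * L) * suc q ^ d * K                     ≡⟨ *-assoc (2 ^ (20 * L)) (suc q ^ d) K ⟩
    2 ^ (20 * L) * (suc q ^ d * K)                   ∎))
    where
    open ≤-Reasoning
    N = sumVec (λ f → ⟦ many u f ⟧)
    P = prod (λ w → if adj G u w then suc (suc q) else suc q)
    arrange : ∀ a b c e → a * (b * (c * e)) ≡ a * c * e * b
    arrange = solve-∀
    closed : P * suc q ^ d ≡ suc (suc q) ^ d * K
    closed = subst (λ e → P * suc q ^ e ≡ suc (suc q) ^ e * K) (neighbours u) (prod-if (adj G u) (suc (suc q)) (suc q))
    h : Fin n → Fin (suc q) → ℕ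
    h w c = 2 ^ ⟦ adj G u w ∧ isZero c ⟧
    total : ∀ w → sum (h w) ≡ (if adj G u w then suc (suc q) else suc q)
    total w with adj G u w
    ... | true  = cong (2 +_) (trans (sum-const q) (*-identityʳ q))
    ... | false = cong suc (trans (sum-const q) (*-identityʳ q))
    pointwise : ∀ f → 2 ^ (25 * L) * ⟦ many u f ⟧ ≤ prod (λ w → h w (lookup f w))
    pointwise f = subst (2 ^ (25 * L) * ⟦ many u f ⟧ ≤_) (sym (prod-2^ (λ w → ⟦ adj G u w ∧ isZero (lookup f w) ⟧)))
      (*⟦⟧≤ (2 ^ (25 * L)) (many u f) λ e → ^-monoʳ-≤ 2 (<⇒≤ (true-does (25 * L <? X u f) e)))
    count : 2 ^ (25 * L) * N ≤ P
    count = ≤-trans (≤-reflexive (sym (sumVec-*ˡ (2 ^ (25 * L)) (λ f → ⟦ many u f ⟧))))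
      (≤-trans (sumVec-mono pointwise) (≤-reflexive (trans (sumVec-prod h) (prod-cong {n} total))))

  -- The exponent 5L is what the local lemma asks for with D = d²: the two kinds of bad event have
  -- to beat 8d², where 3L pays for the 8 and 2L for d² ≤ 2^(2L).
  bad-rare : ∀ u → 4 * (d * d) * sumVec (λ f → ⟦ Bad u f ⟧) ≤ K
  bad-rare u = *-cancelˡ-≤ 2 (begin
    2 * (4 * (d * d) * sumVec (λ f → ⟦ Bad u f ⟧))   ≤⟨ *-monoʳ-≤ 2 (*-monoʳ-≤ (4 * (d * d)) union) ⟩
    2 * (4 * (d * d) * (N₁ + N₂))                    ≡⟨ arrange (d * d) N₁ N₂ ⟩
    8 * (d * d) * N₁ + 8 * (d * d) * N₂              ≤⟨ +-mono-≤ (*-monoˡ-≤ N₁ 8d²≤) (*-monoˡ-≤ N₂ 8d²≤) ⟩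
    2 ^ (5 * L) * N₁ + 2 ^ (5 * L) * N₂              ≤⟨ +-mono-≤ (none-rare u) (many-rare u) ⟩
    K + K                                            ≡⟨ cong (K +_) (+-identityʳ K) ⟨
    2 * K                                            ∎)
    where
    open ≤-Reasoning
    N₁ = sumVec (λ f → ⟦ none u f ⟧)
    N₂ = sumVec (λ f → ⟦ many u f ⟧)
    arrange : ∀ e a b → 2 * (4 * e * (a + b)) ≡ 8 * e * a + 8 * e * b
    arrange = solve-∀
    union : sumVec (λ f → ⟦ Bad u f ⟧) ≤ N₁ + N₂
    union = ≤-trans (sumVec-mono (λ f → ∨≤+ (none u f) (many u f))) (≤-reflexive (sumVec-+ (λ f → ⟦ none u f ⟧) (λ f → ⟦ many u f ⟧)))
      where
      ∨≤+ : ∀ a b → ⟦ a ∨ b ⟧ ≤ ⟦ a ⟧ + ⟦ b ⟧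
      ∨≤+ true  b = s≤s z≤n
      ∨≤+ false b = ≤-refl
    8d²≤ : 8 * (d * d) ≤ 2 ^ (5 * L)
    8d²≤ = begin
      8 * (d * d)                              ≤⟨ *-mono-≤ (^-monoʳ-≤ 2 (*-monoʳ-≤ 3 1≤L)) (*-mono-≤ d≤2^L d≤2^L) ⟩
      2 ^ (3 * L) * (2 ^ L * 2 ^ L)            ≡⟨ cong (2 ^ (3 * L) *_) (sym (^-distribˡ-+-* 2 L L)) ⟩
      2 ^ (3 * L) * 2 ^ (L + L)                ≡⟨ ^-distribˡ-+-* 2 (3 * L) (L + L) ⟨
      2 ^ (3 * L + (L + L))                    ≡⟨ cong (2 ^_) (five L) ⟩
      2 ^ (5 * L)                              ∎
      where
      five : ∀ l → 3 * l + (l + l) ≡ 5 * l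
      five = solve-∀

  -- The dependency relation of the bad events: `Bad u` reads the colours of the neighbours of `u`,
  -- so dependence requires a common neighbour. Walks of length two from `u` bound the number of
  -- such vertices by d².
  share : Fin n → Fin n → Bool
  share u w = does (∃true? (λ z → adj G u z ∧ adj G w z))

  few-share : ∀ u → card (share u) ≤ d * d
  few-share u = begin
    card (share u)                                             ≤⟨ sum-mono pointwise ⟩
    sum (λ w → sum (λ z → ⟦ adj G u z ⟧ * ⟦ adj G z w ⟧))      ≡⟨ ∑-comm {n} {n} (λ w z → ⟦ adj G u z ⟧ * ⟦ adj G z w ⟧) ⟩
    sum (λ z → sum (λ w → ⟦ adj G u z ⟧ * ⟦ adj G z w ⟧))      ≡⟨ sum-cong-≗ {n} (λ z → trans (sym (*-distribˡ-sum {n} ⟦ adj G u z ⟧ (λ w → ⟦ adj G z w ⟧))) (cong (⟦ adj G u z ⟧ *_) (neighbours z))) ⟩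
    sum (λ z → ⟦ adj G u z ⟧ * d)                              ≡⟨ *-distribʳ-sum {n} d (λ z → ⟦ adj G u z ⟧) ⟨
    card (adj G u) * d                                         ≡⟨ cong (_* d) (neighbours u) ⟩
    d * d                                                      ∎
    where
    open ≤-Reasoning
    pointwise : ∀ w → ⟦ share u w ⟧ ≤ sum (λ z → ⟦ adj G u z ⟧ * ⟦ adj G z w ⟧)
    pointwise w with ∃true? (λ z → adj G u z ∧ adj G w z)
    ... | no _ = z≤n
    ... | yes (z , e) = let (uz , wz) = true-∧ {adj G u z} e in
      ≤-trans (≤-reflexive (cong₂ (λ a b → ⟦ a ⟧ * ⟦ b ⟧) (sym uz) (sym (trans (symm G z w) wz))))
        (term≤sum (λ z → ⟦ adj G u z ⟧ * ⟦ adj G z w ⟧) z)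

  centres : ∃[ C ] (∀ u → 1 ≤ sum (λ w → ⟦ C w ∧ adj G u w ⟧) × sum (λ w → ⟦ C w ∧ adj G u w ⟧) ≤ 25 * L)
  centres = let (f , fine) = LocalLemma.avoidable Bad (adj G) local share disjoint (d * d) {{d²≢0}} few-share bad-rare in
    (λ w → isZero (lookup f w)) , λ u → subst (λ s → 1 ≤ s × s ≤ 25 * L)
      (sum-cong-≗ {n} λ w → cong ⟦_⟧ (Bool.∧-comm (adj G u w) (isZero (lookup f w)))) (bounds u f (fine u))
    where
    d²≢0 : NonZero (d * d)
    d²≢0 = >-nonZero (*-mono-≤ d>0 d>0)
      where
      d>0 : 1 ≤ d
      d>0 = ≤-trans (*-mono-≤ {1} {suc q} (s≤s z≤n) (*-mono-≤ {1} {5} (s≤s z≤n) 1≤L)) lower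
    X-local : ∀ u f g → (∀ w → adj G u w ≡ true → lookup f w ≡ lookup g w) → X u f ≡ X u g
    X-local u f g h = sum-cong-≗ {n} agree
      where
      agree : ∀ w → ⟦ adj G u w ∧ isZero (lookup f w) ⟧ ≡ ⟦ adj G u w ∧ isZero (lookup g w) ⟧
      agree w with adj G u w in uw
      ... | true  = cong (⟦_⟧ ∘ isZero) (h w uw)
      ... | false = refl
    local : ∀ u f g → (∀ w → adj G u w ≡ true → lookup f w ≡ lookup g w) → Bad u f ≡ Bad u g
    local u f g h = cong (λ x → does (x ≟ 0) ∨ does (25 * L <? x)) (X-local u f g h)
    disjoint : ∀ u w → share u w ≡ false → ∀ z → adj G w z ≡ true → adj G u z ≡ false
    disjoint u w e z wz = Bool.¬-not λ uz → true≢false (does-true (∃true? (λ z → adj G u z ∧ adj G w z)) (z , ∧-true uz wz)) e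
    bounds : ∀ u f → Bad u f ≡ false → 1 ≤ X u f × X u f ≤ 25 * L
    bounds u f e =
      n≢0⇒n>0 (λ x≡0 → true≢false (cong (_∨ many u f) (does-true (X u f ≟ 0) x≡0)) e) ,
      ≮⇒≥ (λ lt → true≢false (trans (cong (none u f ∨_) (does-true (25 * L <? X u f) lt)) (Bool.∨-zeroʳ (none u f))) e)

-- Existence of large star factors.

-- A vertex outside an independent set without a neighbour in it can be added, so a set that no
-- longer grows dominates.
maximal-independent : (G : Graph (Fin n)) →
  ∃[ C ] (∀ u v → C u ≡ true → C v ≡ true → adj G u v ≡ false) × (∀ v → C v ≡ false → ∃[ c ] C c ≡ true × adj G v c ≡ true)
maximal-independent {n} G = saturate {Inv = Independent} {Done = Dominating} extend (λ _ → false) (λ u v ())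
  where
  Independent Dominating : (Fin n → Bool) → Set
  Independent C = ∀ u v → C u ≡ true → C v ≡ true → adj G u v ≡ false
  Dominating C = ∀ v → C v ≡ false → ∃[ c ] C c ≡ true × adj G v c ≡ true
  extend : ∀ C → Independent C → Dominating C ⊎ ∃[ x ] C x ≡ false × Independent (insert x C)
  extend C ind with Fin.any? (λ v → (C v Bool.≟ false) ×-dec ¬? (∃true? (λ c → C c ∧ adj G v c)))
  ... | yes (x , cx , none) = inj₂ (x , cx , ind′)
    where
    away : ∀ v → C v ≡ true → adj G x v ≡ false
    away v cv = Bool.¬-not λ xv → none (v , ∧-true cv xv)
    ind′ : Independent (insert x C)
    ind′ u v iu iv with insert-inv x C iu | insert-inv x C iv
    ... | inj₁ refl | inj₁ refl = irrefl G x
    ... | inj₁ refl | inj₂ cv   = away v cv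
    ... | inj₂ cu   | inj₁ refl = trans (symm G u x) (away u cu)
    ... | inj₂ cu   | inj₂ cv   = ind u v cu cv
  ... | no all = inj₁ dominating
    where
    dominating : Dominating C
    dominating v cv with ∃true? (λ c → C c ∧ adj G v c)
    ... | yes (c , e) = c , true-∧ {C c} e
    ... | no none     = contradiction (v , cv , none) all

log₂-bracket : ∀ d → 1 ≤ d → ∃[ ℓ ] 2 ^ ℓ ≤ d × d < 2 ^ suc ℓ
log₂-bracket (suc zero)    _ = 0 , s≤s z≤n , s≤s (s≤s z≤n)
log₂-bracket (suc (suc d)) _ with log₂-bracket (suc d) (s≤s z≤n)
... | (ℓ , lo , hi) with suc (suc d) <? 2 ^ suc ℓ
...   | yes lt = ℓ , m≤n⇒m≤1+n lo , lt
...   | no ge  = suc ℓ , ≮⇒≥ ge , ≤-<-trans hi (≤-trans (m<m+n (2 ^ suc ℓ) (m^n>0 2 (suc ℓ))) (≤-reflexive (cong (2 ^ suc ℓ +_) (sym (+-identityʳ _)))))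

module _ (G : Graph (Fin n)) (d : ℕ) (regular : Regular d G) (ℓ : ℕ) (1≤ℓ : 1 ≤ ℓ) (d<2^1+ℓ : d < 2 ^ suc ℓ) where

  private
    neighbours : ∀ u → card (adj G u) ≡ d
    neighbours u = trans (sym (degree-sum G u)) (regular u)

    Large : Set
    Large = ∃[ H ] IsStarFactor G H × (∀ S → IsComponent H S → d ≤ 400 * (ℓ * edgesWithin H S))

    2L≤4ℓ : 2 * suc ℓ ≤ 4 * ℓ
    2L≤4ℓ = ≤-trans (*-monoʳ-≤ 2 (+-monoˡ-≤ ℓ 1≤ℓ)) (≤-reflexive (dbl ℓ))
      where
      dbl : ∀ l → 2 * (l + l) ≡ 4 * l
      dbl = solve-∀

    -- Stars with one edge are enough here. All d neighbours of a centre lie outside the independent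
    -- set `C`, and a leaf sees at most d centres, so Hall's condition holds with `M = d` and
    -- `s = 1`.
    small-degree : d ≤ 50 * suc ℓ → 1 ≤ d → Large
    small-degree d≤ 1≤d =
      let (C , ind , dom) = maximal-independent G
          (H , star , big) = large-star-factor G C d 1 {{>-nonZero 1≤d}} dom
            (λ v cv → ≤-trans (sum-mono λ c → ⟦⟧-mono (proj₂ ∘ true-∧ {C c})) (≤-reflexive (neighbours v)))
            (λ c cc → ≤-trans (≤-reflexive (trans (*-identityʳ d) (sym (neighbours c))))
              (sum-mono λ v → ⟦⟧-mono λ cv → ∧-true (outside ind c v cc cv) cv))
      in H , star , λ S comp → begin
        d                              ≤⟨ d≤ ⟩
        50 * suc ℓ                     ≡⟨ *-assoc 25 2 (suc ℓ) ⟩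
        25 * (2 * suc ℓ)               ≤⟨ *-monoʳ-≤ 25 2L≤4ℓ ⟩
        25 * (4 * ℓ)                   ≡⟨ *-assoc 25 4 ℓ ⟨
        100 * ℓ                        ≤⟨ m≤m*n (100 * ℓ) (2 * edgesWithin H S) {{>-nonZero (big S comp)}} ⟩
        100 * ℓ * (2 * edgesWithin H S) ≤⟨ m≤n*m _ 2 ⟩
        2 * (100 * ℓ * (2 * edgesWithin H S)) ≡⟨ arrange ℓ (edgesWithin H S) ⟩
        400 * (ℓ * edgesWithin H S)    ∎
      where
      open ≤-Reasoning
      arrange : ∀ l e → 2 * (100 * l * (2 * e)) ≡ 400 * (l * e)
      arrange = solve-∀
      outside : ∀ {C : Fin n → Bool} → (∀ u v → C u ≡ true → C v ≡ true → adj G u v ≡ false) →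
        ∀ c v → C c ≡ true → adj G c v ≡ true → not (C v) ≡ true
      outside {C} ind c v cc cv with C v in e
      ... | false = refl
      ... | true  = ⊥-elim (true≢false cv (ind c v cc e))

    large-degree : 50 * suc ℓ ≤ d → Large
    large-degree d≥ =
      let (C , bounds) = RandomCentres.centres G d regular r p L 2r≡ {{p≢0}} (s≤s z≤n) lower upper (<⇒≤ d<2^1+ℓ)
          (H , star , big) = large-star-factor G C M s
            (λ v cv → dominated C v (proj₁ (bounds v))) (λ v cv → proj₂ (bounds v)) (λ c cc → many C c (proj₂ (bounds c)))
      in H , star , λ S comp → begin
        d                                ≤⟨ d≤4Ms ⟩
        -- 400 = 4 · 25 · 2 · 2, from d ≤ 4Ms, M = 25L, L ≤ 2ℓ and s ≤ 2e for a star with e edges.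
        50 * (2 * L) * s                 ≤⟨ *-mono-≤ (*-monoʳ-≤ 50 2L≤4ℓ) (big S comp) ⟩
        50 * (4 * ℓ) * (2 * edgesWithin H S) ≡⟨ arrange ℓ (edgesWithin H S) ⟩
        400 * (ℓ * edgesWithin H S)      ∎
      where
      open ≤-Reasoning
      arrange : ∀ l e → 50 * (4 * l) * (2 * e) ≡ 400 * (l * e)
      arrange = solve-∀
      L = suc ℓ
      M = 25 * L
      r = d / (10 * L)
      -- Since 1 ≤ s, this gives Ms + M ≤ 2Ms ≤ d, so the at most M centres next to a centre still
      -- leave it Ms leaves.
      s = d / (2 * M)
      1≤r : 1 ≤ r
      1≤r = m≥n⇒m/n>0 (≤-trans (*-monoˡ-≤ L (m≤m+n 10 40)) d≥)
      1≤s : 1 ≤ s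
      1≤s = m≥n⇒m/n>0 {d} {2 * M} (≤-trans (≤-reflexive (sym (*-assoc 2 25 L))) d≥)
      -- With suc p = 2 r colours the expected number of centres next to a vertex, d/2r, is between 5L and 10L.
      p = 2 * r ∸ 1
      2r≡ : 2 * r ≡ suc p
      2r≡ = sym (m+[n∸m]≡n (≤-trans 1≤r (m≤n*m r 2)))
      p≢0 : NonZero p
      p≢0 = >-nonZero (≤-pred (subst (2 ≤_) 2r≡ (*-monoʳ-≤ 2 1≤r)))
      lower : suc p * (5 * L) ≤ d
      lower = ≤-trans (≤-reflexive (trans (cong (_* (5 * L)) (sym 2r≡)) (ten r L))) (m/n*n≤m d (10 * L))
        where
        ten : ∀ r l → 2 * r * (5 * l) ≡ r * (10 * l)
        ten = solve-∀
      -- Rounding down a quotient that is at least 1 loses less than a factor 2.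
      below : ∀ a .{{_ : NonZero a}} → 1 ≤ d / a → d ≤ d / a * (2 * a)
      below a le = begin
        d                        ≡⟨ m≡m%n+[m/n]*n d a ⟩
        d % a + d / a * a        ≤⟨ +-monoˡ-≤ (d / a * a) (≤-trans (<⇒≤ (m%n<n d a)) (m≤n*m a (d / a) {{>-nonZero le}})) ⟩
        d / a * a + d / a * a    ≡⟨ dbl (d / a) a ⟩
        d / a * (2 * a)          ∎
        where
        dbl : ∀ x a → x * a + x * a ≡ x * (2 * a)
        dbl = solve-∀
      upper : d ≤ r * (20 * L)
      upper = ≤-trans (below (10 * L) 1≤r) (≤-reflexive (cong (r *_) (sym (*-assoc 2 10 L))))
      d≤4Ms : d ≤ 50 * (2 * L) * s
      d≤4Ms = ≤-trans (below (2 * M) 1≤s) (≤-reflexive (hundred s L))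
        where
        hundred : ∀ s l → s * (2 * (2 * (25 * l))) ≡ 50 * (2 * l) * s
        hundred = solve-∀
      dominated : ∀ (C : Fin n → Bool) v → 1 ≤ sum (λ w → ⟦ C w ∧ adj G v w ⟧) → ∃[ c ] C c ≡ true × adj G v c ≡ true
      dominated C v le with sum>0⇒∃ (λ w → ⟦ C w ∧ adj G v w ⟧) le
      ... | (c , p) with C c in cc | adj G v c in vc
      ...   | true | true = c , cc , vc
      ...   | true | false = contradiction p λ ()
      ...   | false | _ = contradiction p λ ()
      many : ∀ (C : Fin n → Bool) c → sum (λ w → ⟦ C w ∧ adj G c w ⟧) ≤ M → M * s ≤ sum (λ v → ⟦ not (C v) ∧ adj G c v ⟧)
      many C c le = +-cancelʳ-≤ M (M * s) _ (begin
        M * s + M                      ≤⟨ +-monoʳ-≤ (M * s) (m≤m*n M s {{>-nonZero 1≤s}}) ⟩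
        M * s + M * s                  ≡⟨ dbl M s ⟩
        s * (2 * M)                    ≤⟨ m/n*n≤m d (2 * M) ⟩
        d                              ≡⟨ neighbours c ⟨
        card (adj G c)                 ≡⟨ sum-cong-≗ {n} (λ v → split (C v) (adj G c v)) ⟩
        sum (λ v → ⟦ not (C v) ∧ adj G c v ⟧ + ⟦ C v ∧ adj G c v ⟧)
          ≡⟨ ∑-distrib-+ {n} (λ v → ⟦ not (C v) ∧ adj G c v ⟧) (λ v → ⟦ C v ∧ adj G c v ⟧) ⟩
        sum (λ v → ⟦ not (C v) ∧ adj G c v ⟧) + sum (λ v → ⟦ C v ∧ adj G c v ⟧)
          ≤⟨ +-monoʳ-≤ (sum (λ v → ⟦ not (C v) ∧ adj G c v ⟧)) le ⟩
        sum (λ v → ⟦ not (C v) ∧ adj G c v ⟧) + M ∎)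
        where
        dbl : ∀ m s → m * s + m * s ≡ s * (2 * m)
        dbl = solve-∀
        split : ∀ a b → ⟦ b ⟧ ≡ ⟦ not a ∧ b ⟧ + ⟦ a ∧ b ⟧
        split true  b = refl
        split false b = sym (+-identityʳ ⟦ b ⟧)

  star-factor-exists : 1 ≤ d → Large
  star-factor-exists 1≤d with ≤-total d (50 * suc ℓ)
  ... | inj₁ d≤ = small-degree d≤ 1≤d
  ... | inj₂ d≥ = large-degree d≥

-- Logarithms

ι : ℕ → ℚ
ι k = ℤ.+ k ℚ./ 1

half : ℚ
half = ℤ.+ 1 ℚ./ 2

ι-mono : ∀ {a b} → a ≤ b → ι a ℚ.≤ ι b
ι-mono {a} {b} a≤b = ℚ.toℚᵘ-cancel-≤ (ℚᵘ.≤-respˡ-≃ (ℚᵘ.≃-sym (ℚ.toℚᵘ-fromℚᵘ (ℚᵘ.mkℚᵘ (ℤ.+ a) 0)))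
  (ℚᵘ.≤-respʳ-≃ (ℚᵘ.≃-sym (ℚ.toℚᵘ-fromℚᵘ (ℚᵘ.mkℚᵘ (ℤ.+ b) 0)))
    (ℚᵘ.*≤* (ℤ.*-monoʳ-≤-nonNeg (ℤ.+ 1) (ℤ.+≤+ a≤b)))))

ι-* : ∀ a b → ι (a * b) ≡ ι a ℚ.* ι b
ι-* a b = ℚ.toℚᵘ-injective
  (ℚᵘ.≃-trans (ℚ.toℚᵘ-fromℚᵘ (ℚᵘ.mkℚᵘ (ℤ.+ (a * b)) 0))
  (ℚᵘ.≃-trans (ℚᵘ.*≡* (cong (ℤ._* ℤ.+ 1) (ℤ.pos-* a b)))
  (ℚᵘ.≃-trans (ℚᵘ.*-cong (ℚᵘ.≃-sym (ℚ.toℚᵘ-fromℚᵘ (ℚᵘ.mkℚᵘ (ℤ.+ a) 0))) (ℚᵘ.≃-sym (ℚ.toℚᵘ-fromℚᵘ (ℚᵘ.mkℚᵘ (ℤ.+ b) 0))))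
  (ℚᵘ.≃-sym (ℚ.toℚᵘ-homo-* (ι a) (ι b))))))

ι≥0 : ∀ a → 0ℚ ℚ.≤ ι a
ι≥0 a = ι-mono {0} {a} z≤n

times-half : ∀ k → times k half ≡ half ℚ.* ι k
times-half zero    = refl
times-half (suc k) = trans (cong (ℚ._+ half) (times-half k))
  (trans (ℚ-Solver.solve 2 (λ h x → h ℚ-Solver.:* x ℚ-Solver.:+ h ℚ-Solver.:= h ℚ-Solver.:* (x ℚ-Solver.:+ ℚ-Solver.con 1ℚ)) refl half (ι k))
    (cong (half ℚ.*_) (trans (cong (ℚ._+ 1ℚ) (sym (times-unit k 0))) (times-unit (suc k) 0))))

times-self : ∀ k m → k ≡ suc m → times k (ℤ.+ 1 ℚ./ suc m) ≡ 1ℚ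
times-self k m refl = trans (times-unit (suc m) m)
  (ℚ.fromℚᵘ-cong {ℚᵘ.mkℚᵘ (ℤ.+ suc m) m} {ℚᵘ.mkℚᵘ (ℤ.+ 1) 0} (ℚᵘ.*≡* (ℤ.*-comm (ℤ.+ suc m) (ℤ.+ 1))))

times-double : ∀ k m → k + k ≡ suc m → times k (ℤ.+ 1 ℚ./ suc m) ≡ half
times-double k m e = trans (times-unit k m)
  (ℚ.fromℚᵘ-cong {ℚᵘ.mkℚᵘ (ℤ.+ k) m} {ℚᵘ.mkℚᵘ (ℤ.+ 1) 1}
    (ℚᵘ.*≡* (trans (sym (ℤ.pos-* k 2)) (trans (cong ℤ.+_ (trans (dbl k) e)) (sym (ℤ.*-identityˡ (ℤ.+ suc m)))))))
  where
  dbl : ∀ k → k * 2 ≡ k + k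
  dbl = solve-∀

2^suc : ∀ ℓ → 2 ^ ℓ + 2 ^ ℓ ≡ 2 ^ suc ℓ
2^suc ℓ = cong (2 ^ ℓ +_) (sym (+-identityʳ (2 ^ ℓ)))

pred-2^ : ∀ ℓ → 2 ^ ℓ ≡ suc (2 ^ ℓ ∸ 1)
pred-2^ ℓ = sym (m+[n∸m]≡n (m^n>0 2 ℓ))

-- Oresme's argument: the 2^ℓ terms after 1/2^ℓ are each at least 1/2^(ℓ+1). The summand 1 cancels
-- against the `harmonic 1` in `logSeq`.
harmonic-lower : ∀ ℓ → times ℓ half ℚ.+ 1ℚ ℚ.≤ harmonic (2 ^ ℓ)
harmonic-lower zero    = ℚ.≤-refl
harmonic-lower (suc ℓ) = begin
  times ℓ half ℚ.+ half ℚ.+ 1ℚ         ≡⟨ ℚ-Solver.solve 3 (λ t h x → t ℚ-Solver.:+ h ℚ-Solver.:+ x ℚ-Solver.:= h ℚ-Solver.:+ (t ℚ-Solver.:+ x)) refl (times ℓ half) half 1ℚ ⟩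
  half ℚ.+ (times ℓ half ℚ.+ 1ℚ)       ≤⟨ ℚ.+-monoʳ-≤ half (harmonic-lower ℓ) ⟩
  half ℚ.+ harmonic (2 ^ ℓ)            ≡⟨ cong (ℚ._+ harmonic (2 ^ ℓ)) (sym (times-double (2 ^ ℓ) (2 ^ suc ℓ ∸ 1) eq)) ⟩
  times (2 ^ ℓ) (ℤ.+ 1 ℚ./ suc (2 ^ suc ℓ ∸ 1)) ℚ.+ harmonic (2 ^ ℓ)
                                       ≤⟨ harmonic-block-≥ (2 ^ ℓ) (2 ^ ℓ) (≤-reflexive eq) ⟩
  harmonic (2 ^ ℓ + 2 ^ ℓ)             ≡⟨ cong harmonic (2^suc ℓ) ⟩
  harmonic (2 ^ suc ℓ)                 ∎
  where
  open ℚ.≤-Reasoning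
  eq : 2 ^ ℓ + 2 ^ ℓ ≡ suc (2 ^ suc ℓ ∸ 1)
  eq = trans (2^suc ℓ) (pred-2^ (suc ℓ))

-- The same dyadic blocks, each term now bounded by 1/2^ℓ, so that a block contributes at most 1.
harmonic-upper : ∀ ℓ → harmonic (2 ^ ℓ) ℚ.≤ ι (suc ℓ)
harmonic-upper zero    = ℚ.≤-refl
harmonic-upper (suc ℓ) = begin
  harmonic (2 ^ suc ℓ)                  ≡⟨ cong harmonic (sym (2^suc ℓ)) ⟩
  harmonic (2 ^ ℓ + 2 ^ ℓ)              ≤⟨ harmonic-block-≤ (2 ^ ℓ) (2 ^ ℓ) (m∸n≤m (2 ^ ℓ) 1) ⟩
  times (2 ^ ℓ) (ℤ.+ 1 ℚ./ suc (2 ^ ℓ ∸ 1)) ℚ.+ harmonic (2 ^ ℓ)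
                                        ≡⟨ cong (ℚ._+ harmonic (2 ^ ℓ)) (times-self (2 ^ ℓ) (2 ^ ℓ ∸ 1) (pred-2^ ℓ)) ⟩
  1ℚ ℚ.+ harmonic (2 ^ ℓ)               ≤⟨ ℚ.+-monoʳ-≤ 1ℚ (harmonic-upper ℓ) ⟩
  1ℚ ℚ.+ ι (suc ℓ)                      ≡⟨ ℚ.+-comm 1ℚ (ι (suc ℓ)) ⟩
  ι (suc ℓ) ℚ.+ 1ℚ                      ≡⟨ trans (cong (ℚ._+ 1ℚ) (sym (times-unit (suc ℓ) 0))) (times-unit (suc (suc ℓ)) 0) ⟩
  ι (suc (suc ℓ))                       ∎
  where open ℚ.≤-Reasoning

-- `logSeq` increases in n, so its first term H_d - 1 bounds it from below.
logSeq-lower : ∀ e ℓ n → 2 ^ ℓ ≤ suc e → half ℚ.* ι ℓ ℚ.≤ logSeq (suc e) n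
logSeq-lower e ℓ n h = begin
  half ℚ.* ι ℓ                                   ≡⟨ sym (times-half ℓ) ⟩
  times ℓ half                                   ≡⟨ ℚ-Solver.solve 2 (λ t x → t ℚ-Solver.:= (t ℚ-Solver.:+ x) ℚ-Solver.:- x) refl (times ℓ half) 1ℚ ⟩
  times ℓ half ℚ.+ 1ℚ ℚ.- 1ℚ                     ≤⟨ ℚ.+-monoˡ-≤ (ℚ.- 1ℚ) (harmonic-lower ℓ) ⟩
  harmonic (2 ^ ℓ) ℚ.- 1ℚ                        ≤⟨ ℚ.+-monoˡ-≤ (ℚ.- 1ℚ) (harmonic-mono (≤⇒≤′ h)) ⟩
  harmonic (suc e) ℚ.- 1ℚ                        ≡⟨ cong (λ z → harmonic z ℚ.- 1ℚ) (sym (+-identityʳ (suc e))) ⟩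
  logSeq (suc e) 0                               ≤⟨ logSeq-mono e (≤⇒≤′ (z≤n {n})) ⟩
  logSeq (suc e) n                               ∎
  where open ℚ.≤-Reasoning

-- `logSeq d n + 1/(n+1)` decreases in n and starts at H_d, which is at most ℓ + 2 and hence at most
-- 3ℓ.
logSeq-upper : ∀ e ℓ n → 1 ≤ ℓ → suc e < 2 ^ suc ℓ → logSeq (suc e) n ℚ.≤ ι 3 ℚ.* ι ℓ
logSeq-upper e ℓ n 1≤ℓ h = begin
  logSeq (suc e) n                               ≡⟨ ℚ.+-identityʳ _ ⟨
  logSeq (suc e) n ℚ.+ 0ℚ                        ≤⟨ ℚ.+-monoʳ-≤ (logSeq (suc e) n) (ℚ.<⇒≤ (unit-pos n)) ⟩
  logSeq (suc e) n ℚ.+ ℤ.+ 1 ℚ./ suc n             ≤⟨ logSeq-anti e (≤⇒≤′ (z≤n {n})) ⟩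
  harmonic (1 * suc e) ℚ.- 1ℚ ℚ.+ 1ℚ             ≡⟨ ℚ-Solver.solve 2 (λ t x → (t ℚ-Solver.:- x) ℚ-Solver.:+ x ℚ-Solver.:= t) refl (harmonic (1 * suc e)) 1ℚ ⟩
  harmonic (1 * suc e)                           ≡⟨ cong harmonic (+-identityʳ (suc e)) ⟩
  harmonic (suc e)                               ≤⟨ harmonic-mono (≤⇒≤′ (<⇒≤ h)) ⟩
  harmonic (2 ^ suc ℓ)                           ≤⟨ harmonic-upper (suc ℓ) ⟩
  ι (2 + ℓ)                                      ≤⟨ ι-mono (≤-trans (+-monoˡ-≤ ℓ (*-monoʳ-≤ 2 1≤ℓ)) (≤-reflexive (+-comm (2 * ℓ) ℓ))) ⟩
  ι (3 * ℓ)                                      ≡⟨ ι-* 3 ℓ ⟩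
  ι 3 ℚ.* ι ℓ                                    ∎
  where open ℚ.≤-Reasoning

≤-divide : ∀ {a b y} → 0ℚ ℚ.< y → a ℚ.≤ b ℚ.* y → a ℚ.* recip y ℚ.≤ b
≤-divide {a} {b} {y} y>0 h = subst (a ℚ.* recip y ℚ.≤_)
  (trans (ℚ.*-assoc b y (recip y)) (trans (cong (b ℚ.*_) (recip-inverse y>0)) (ℚ.*-identityʳ b)))
  (ℚ.*-monoʳ-≤-nonNeg (recip y) {{ℚ.nonNegative (ℚ.<⇒≤ (recip-pos y>0))}} h)

divide-≤ : ∀ {a b y} → 0ℚ ℚ.< y → b ℚ.* y ℚ.≤ a → b ℚ.≤ a ℚ.* recip y
divide-≤ {a} {b} {y} y>0 h = subst (ℚ._≤ a ℚ.* recip y)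
  (trans (ℚ.*-assoc b y (recip y)) (trans (cong (b ℚ.*_) (recip-inverse y>0)) (ℚ.*-identityʳ b)))
  (ℚ.*-monoʳ-≤-nonNeg (recip y) {{ℚ.nonNegative (ℚ.<⇒≤ (recip-pos y>0))}} h)

≤+δ : ∀ {x y δ} → 0ℚ ℚ.< δ → x ℚ.≤ y → x ℚ.≤ y ℚ.+ δ
≤+δ {x} {y} δ>0 h = ℚ.≤-trans h (ℚ.≤-trans (ℚ.≤-reflexive (sym (ℚ.+-identityʳ y))) (ℚ.+-monoʳ-≤ y (ℚ.<⇒≤ δ>0)))

-- `recip` has a conventional value at 0; from this N on it is a true inverse, and the comparisons
-- with d/log d hold term by term.
logSeq-pos : ∀ {d} (d≥2 : 2 ≤ d) → ∃[ N ] (∀ n → N ≤ n → 0ℚ ℚ.< logSeq d n)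
logSeq-pos {d} d≥2 = let (η , η>0 , N , h) = log-pos d≥2 in
  N , λ n le → ℚ.<-≤-trans η>0 (subst (ℚ._≤ logSeq d n) (ℚ.+-identityˡ η) (h n le))

d/log-≤ : ∀ d (d≥2 : 2 ≤ d) ℓ e → 2 ^ ℓ ≤ d → d ≤ 400 * (ℓ * e) →
  (fromℚ (ℤ.+ 1 ℚ./ 800) *ʳ (d /log d by d≥2)) ≤ʳ fromNat e
d/log-≤ (suc d′) d≥2 ℓ e lo bound δ δ>0 = let (N , pos) = logSeq-pos d≥2 in N , λ n le →
  ≤+δ δ>0 (subst (ℚ._≤ ι e) (ℚ.*-assoc c (ι d) (recip (logSeq d n))) (≤-divide (pos n le) (main n)))
  where
  open ℚ.≤-Reasoning
  d = suc d′
  -- Chosen so that 400c = 1/2, the factor in `logSeq-lower`.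
  c = ℤ.+ 1 ℚ./ 800
  main : ∀ n → c ℚ.* ι d ℚ.≤ ι e ℚ.* logSeq d n
  main n = begin
    c ℚ.* ι d                             ≤⟨ ℚ.*-monoˡ-≤-nonNeg c (ι-mono bound) ⟩
    c ℚ.* ι (400 * (ℓ * e))               ≡⟨ cong (c ℚ.*_) (trans (ι-* 400 (ℓ * e)) (cong (ι 400 ℚ.*_) (ι-* ℓ e))) ⟩
    c ℚ.* (ι 400 ℚ.* (ι ℓ ℚ.* ι e))       ≡⟨ ℚ-Solver.solve 4 (λ c b l e → c ℚ-Solver.:* (b ℚ-Solver.:* (l ℚ-Solver.:* e)) ℚ-Solver.:= e ℚ-Solver.:* ((c ℚ-Solver.:* b) ℚ-Solver.:* l)) refl c (ι 400) (ι ℓ) (ι e) ⟩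
    ι e ℚ.* (half ℚ.* ι ℓ)                ≤⟨ ℚ.*-monoˡ-≤-nonNeg (ι e) {{ℚ.nonNegative (ι≥0 e)}} (logSeq-lower d′ ℓ n lo) ⟩
    ι e ℚ.* logSeq d n                    ∎

-- 96 = 3 · 32, the 3 coming from `logSeq-upper`.
≤-d/log : ∀ d (d≥2 : 2 ≤ d) ℓ e → 1 ≤ ℓ → d < 2 ^ suc ℓ → ℓ * e ≤ 32 * d →
  fromNat e ≤ʳ (fromℚ (ι 96) *ʳ (d /log d by d≥2))
≤-d/log (suc d′) d≥2 ℓ e 1≤ℓ hi bound δ δ>0 = let (N , pos) = logSeq-pos d≥2 in N , λ n le →
  ≤+δ δ>0 (subst (ι e ℚ.≤_) (ℚ.*-assoc (ι 96) (ι d) (recip (logSeq d n))) (divide-≤ (pos n le) (main n)))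
  where
  open ℚ.≤-Reasoning
  d = suc d′
  main : ∀ n → ι e ℚ.* logSeq d n ℚ.≤ ι 96 ℚ.* ι d
  main n = begin
    ι e ℚ.* logSeq d n                    ≤⟨ ℚ.*-monoˡ-≤-nonNeg (ι e) {{ℚ.nonNegative (ι≥0 e)}} (logSeq-upper d′ ℓ n 1≤ℓ hi) ⟩
    ι e ℚ.* (ι 3 ℚ.* ι ℓ)                 ≡⟨ ℚ-Solver.solve 3 (λ e b l → e ℚ-Solver.:* (b ℚ-Solver.:* l) ℚ-Solver.:= b ℚ-Solver.:* (l ℚ-Solver.:* e)) refl (ι e) (ι 3) (ι ℓ) ⟩
    ι 3 ℚ.* (ι ℓ ℚ.* ι e)                 ≡⟨ cong (ι 3 ℚ.*_) (sym (ι-* ℓ e)) ⟩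
    ι 3 ℚ.* ι (ℓ * e)                     ≤⟨ ℚ.*-monoˡ-≤-nonNeg (ι 3) (ι-mono bound) ⟩
    ι 3 ℚ.* ι (32 * d)                    ≡⟨ ι-* 3 (32 * d) ⟨
    ι (3 * (32 * d))                      ≡⟨ cong ι (*-assoc 3 32 d) ⟨
    ι (96 * d)                            ≡⟨ ι-* 96 d ⟩
    ι 96 ℚ.* ι d                          ∎

-- Graphs with large domination number

-- Four colours stand for F₂ × F₂: klein is its addition, and form₁ its
-- symplectic form, which is 1 exactly on two distinct nonzero elements.
klein : Fin 4 → Fin 4 → Fin 4
klein x y = lookup (lookup ((0F ∷ 1F ∷ 2F ∷ 3F ∷ []) ∷ (1F ∷ 0F ∷ 3F ∷ 2F ∷ []) ∷ (2F ∷ 3F ∷ 0F ∷ 1F ∷ []) ∷ (3F ∷ 2F ∷ 1F ∷ 0F ∷ []) ∷ []) x) y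

form₁ : Fin 4 → Fin 4 → Bool
form₁ zero    _       = false
form₁ (suc x) zero    = false
form₁ (suc x) (suc y) = not (does (x Fin.≟ y))

_⊕_ : Vec (Fin 4) n → Vec (Fin 4) n → Vec (Fin 4) n
[]      ⊕ []      = []
(a ∷ x) ⊕ (b ∷ y) = klein a b ∷ (x ⊕ y)

form : Vec (Fin 4) n → Vec (Fin 4) n → Bool
form []      []      = false
form (a ∷ x) (b ∷ y) = form₁ a b xor form x y

form₁-sym : ∀ a b → form₁ a b ≡ form₁ b a
form₁-sym = from-yes (Fin.all? λ a → Fin.all? λ b → form₁ a b Bool.≟ form₁ b a)

form₁-self : ∀ a → form₁ a a ≡ false
form₁-self = from-yes (Fin.all? λ a → form₁ a a Bool.≟ false)

form₁-klein : ∀ a b c → form₁ a (klein b c) ≡ form₁ a b xor form₁ a c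
form₁-klein = from-yes (Fin.all? λ a → Fin.all? λ b → Fin.all? λ c → form₁ a (klein b c) Bool.≟ (form₁ a b xor form₁ a c))

form-sym : ∀ (x y : Vec (Fin 4) n) → form x y ≡ form y x
form-sym []      []      = refl
form-sym (a ∷ x) (b ∷ y) = cong₂ _xor_ (form₁-sym a b) (form-sym x y)

form-self : ∀ (x : Vec (Fin 4) n) → form x x ≡ false
form-self []      = refl
form-self (a ∷ x) = cong₂ _xor_ (form₁-self a) (form-self x)

form-⊕ : ∀ (x y z : Vec (Fin 4) n) → form x (y ⊕ z) ≡ form x y xor form x z
form-⊕ []      []      []      = refl
form-⊕ (a ∷ x) (b ∷ y) (c ∷ z) = trans (cong₂ _xor_ (form₁-klein a b c) (form-⊕ x y z)) (interchange (form₁ a b) (form₁ a c) (form x y) (form x z))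
  where
  interchange : ∀ p q r s → (p xor q) xor (r xor s) ≡ (p xor r) xor (q xor s)
  interchange true  true  true  s = refl
  interchange true  true  false s = sym (Bool.not-involutive s)
  interchange true  false true  s = Bool.not-involutive s
  interchange true  false false s = refl
  interchange false true  true  s = refl
  interchange false true  false s = refl
  interchange false false r     s = refl

𝟎 : Vec (Fin 4) n
𝟎 {zero}  = []
𝟎 {suc n} = zero ∷ 𝟎

form-𝟎 : ∀ (x : Vec (Fin 4) n) → form x 𝟎 ≡ false
form-𝟎 []      = refl
form-𝟎 (a ∷ x) = cong₂ _xor_ (form₁-sym a zero) (form-𝟎 x)

-- The evidence points at the first nonzero coordinate, where the induction in `form-balanced`
-- stops.
data Nonzero : Vec (Fin 4) n → Set where
  here  : ∀ a (x : Vec (Fin 4) n) → Nonzero (suc a ∷ x)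
  there : ∀ {x : Vec (Fin 4) n} → Nonzero x → Nonzero (zero ∷ x)

-- Nondegeneracy in counted form. At the first nonzero coordinate of `x`, `form₁` takes each value
-- on two of the four elements, so whatever the later coordinates contribute, half of all y give 1.
form-balanced : ∀ {x : Vec (Fin 4) n} → Nonzero x → sumVec (λ y → ⟦ form x y ⟧) * 2 ≡ 4 ^ n
form-balanced {suc n} {suc a ∷ x} (here a x) = begin
  sumVec (λ y → ⟦ form (suc a ∷ x) y ⟧) * 2    ≡⟨ cong (_* 2) (sumVec-suc (λ y → ⟦ form (suc a ∷ x) y ⟧)) ⟩
  sum (λ b → t (form₁ (suc a) b)) * 2          ≡⟨ cong (_* 2) (two-each a) ⟩
  (2 * (t true + t false)) * 2                 ≡⟨ cong (λ z → 2 * z * 2) (trans (sym (sumVec-+ (λ y → ⟦ true xor form x y ⟧) (λ y → ⟦ false xor form x y ⟧))) (trans (sumVec-cong λ y → one (form x y)) (sumVec-const n))) ⟩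
  (2 * (4 ^ n * 1)) * 2                        ≡⟨ four (4 ^ n) ⟩
  4 * 4 ^ n                                    ∎
  where
  open ≡-Reasoning
  t : Bool → ℕ
  t b = sumVec (λ y → ⟦ b xor form x y ⟧)
  one : ∀ b → ⟦ true xor b ⟧ + ⟦ false xor b ⟧ ≡ 1
  one true  = refl
  one false = refl
  four : ∀ k → 2 * (k * 1) * 2 ≡ 4 * k
  four = solve-∀
  regroup₁ : ∀ p q → q + (q + (p + (p + 0))) ≡ 2 * (p + q)
  regroup₁ = solve-∀
  regroup₂ : ∀ p q → q + (p + (q + (p + 0))) ≡ 2 * (p + q)
  regroup₂ = solve-∀
  regroup₃ : ∀ p q → q + (p + (p + (q + 0))) ≡ 2 * (p + q)
  regroup₃ = solve-∀
  two-each : ∀ a → sum (λ b → t (form₁ (suc a) b)) ≡ 2 * (t true + t false)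
  two-each zero             = regroup₁ (t true) (t false)
  two-each (suc zero)       = regroup₂ (t true) (t false)
  two-each (suc (suc zero)) = regroup₃ (t true) (t false)
form-balanced {suc n} {zero ∷ x} (there nz) = begin
  sumVec (λ y → ⟦ form (zero ∷ x) y ⟧) * 2     ≡⟨ cong (_* 2) (trans (sumVec-suc (λ y → ⟦ form (zero ∷ x) y ⟧)) (sum-const 4 {sumVec (λ y → ⟦ form x y ⟧)})) ⟩
  4 * sumVec (λ y → ⟦ form x y ⟧) * 2          ≡⟨ *-assoc 4 (sumVec (λ y → ⟦ form x y ⟧)) 2 ⟩
  4 * (sumVec (λ y → ⟦ form x y ⟧) * 2)        ≡⟨ cong (4 *_) (form-balanced nz) ⟩
  4 * 4 ^ n                                    ∎
  where open ≡-Reasoning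

-- Translation is a bijection: every row of the `klein` table is a permutation.
sumVec-shift : ∀ (y : Vec (Fin 4) n) (F : Vec (Fin 4) n → ℕ) → sumVec (λ z → F (y ⊕ z)) ≡ sumVec F
sumVec-shift []      F = refl
sumVec-shift {suc n} (a ∷ y) F = begin
  sumVec (λ z → F ((a ∷ y) ⊕ z))                     ≡⟨ sumVec-suc (λ z → F ((a ∷ y) ⊕ z)) ⟩
  sum (λ c → sumVec (λ z → F (klein a c ∷ (y ⊕ z)))) ≡⟨ sum-cong-≗ {4} (λ c → sumVec-shift y (λ z → F (klein a c ∷ z))) ⟩
  sum (λ c → t (klein a c))                          ≡⟨ permute a ⟩
  sum t                                              ≡⟨ sumVec-suc F ⟨
  sumVec F                                           ∎
  where
  open ≡-Reasoning
  t : Fin 4 → ℕ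
  t c = sumVec (λ z → F (c ∷ z))
  permute₁ : ∀ p q r s → q + (p + (s + (r + 0))) ≡ p + (q + (r + (s + 0)))
  permute₁ = solve-∀
  permute₂ : ∀ p q r s → r + (s + (p + (q + 0))) ≡ p + (q + (r + (s + 0)))
  permute₂ = solve-∀
  permute₃ : ∀ p q r s → s + (r + (q + (p + 0))) ≡ p + (q + (r + (s + 0)))
  permute₃ = solve-∀
  permute : ∀ a → sum (λ c → t (klein a c)) ≡ sum t
  permute zero                   = refl
  permute (suc zero)             = permute₁ (t 0F) (t 1F) (t 2F) (t 3F)
  permute (suc (suc zero))       = permute₂ (t 0F) (t 1F) (t 2F) (t 3F)
  permute (suc (suc (suc zero))) = permute₃ (t 0F) (t 1F) (t 2F) (t 3F)

orth : List (Vec (Fin 4) n) → Vec (Fin 4) n → Bool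
orth []      y = true
orth (x ∷ L) y = not (form x y) ∧ orth L y

orth-⊕ : ∀ (L : List (Vec (Fin 4) n)) y z → orth L y ≡ true → orth L z ≡ true → orth L (y ⊕ z) ≡ true
orth-⊕ []      y z _  _  = refl
orth-⊕ (x ∷ L) y z oy oz = let (fy , oy′) = true-∧ {not (form x y)} oy; (fz , oz′) = true-∧ {not (form x z)} oz in
  ∧-true (cong not (trans (form-⊕ x y z) (cong₂ _xor_ (not-true fy) (not-true fz)))) (orth-⊕ L y z oy′ oz′)

-- The solutions of form x y = 1 are at most as many as those of form x y = 0,
-- because adding one of them maps the former into the latter.
orth-count : ∀ (L : List (Vec (Fin 4) n)) → 4 ^ n ≤ sumVec (λ y → ⟦ orth L y ⟧) * 2 ^ length L
orth-count {n} []      = ≤-reflexive (sym (trans (*-identityʳ (sumVec {4} {n} λ _ → 1)) (trans (sumVec-const n) (*-identityʳ (4 ^ n)))))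
orth-count {n} (x ∷ L) = begin
  4 ^ n                                           ≤⟨ orth-count L ⟩
  sumVec (λ y → ⟦ orth L y ⟧) * 2 ^ length L      ≤⟨ *-monoˡ-≤ (2 ^ length L) halve ⟩
  (N + N) * 2 ^ length L                          ≡⟨ arrange N (2 ^ length L) ⟩
  N * (2 * 2 ^ length L)                          ∎
  where
  open ≤-Reasoning
  N = sumVec (λ y → ⟦ orth (x ∷ L) y ⟧)
  N′ = sumVec (λ y → ⟦ form x y ∧ orth L y ⟧)
  arrange : ∀ a b → (a + a) * b ≡ a * (2 * b)
  arrange = solve-∀
  split : ∀ a b → ⟦ b ⟧ ≡ ⟦ not a ∧ b ⟧ + ⟦ a ∧ b ⟧
  split true  b = refl
  split false b = sym (+-identityʳ ⟦ b ⟧)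
  N′≤N : N′ ≤ N
  N′≤N with 0 <? N′
  ... | no N′≯0 = ≤-trans (≮⇒≥ N′≯0) z≤n
  ... | yes pos with sumVec>0⇒∃ (λ y → ⟦ form x y ∧ orth L y ⟧) pos
  ...   | (y , p) with true-or-false (form x y ∧ orth L y)
  ...     | inj₂ e = contradiction (subst (λ b → 0 < ⟦ b ⟧) e p) λ ()
  ...     | inj₁ e = ≤-trans (sumVec-mono λ z → ⟦⟧-mono λ e′ →
                let (fy , oy) = true-∧ {form x y} e; (fz , oz) = true-∧ {form x z} e′ in
                ∧-true (cong not (trans (form-⊕ x y z) (cong₂ _xor_ fy fz))) (orth-⊕ L y z oy oz))
              (≤-reflexive (sumVec-shift y (λ z → ⟦ orth (x ∷ L) z ⟧)))
  halve : sumVec (λ y → ⟦ orth L y ⟧) ≤ N + N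
  halve = begin
    sumVec (λ y → ⟦ orth L y ⟧)                                        ≡⟨ sumVec-cong (λ y → split (form x y) (orth L y)) ⟩
    sumVec (λ y → ⟦ orth (x ∷ L) y ⟧ + ⟦ form x y ∧ orth L y ⟧)        ≡⟨ sumVec-+ (λ y → ⟦ orth (x ∷ L) y ⟧) (λ y → ⟦ form x y ∧ orth L y ⟧) ⟩
    N + N′                                                             ≤⟨ +-monoʳ-≤ N N′≤N ⟩
    N + N                                                              ∎

-- 4^h - 1, split by whether the first coordinate is nonzero; `nonzero` enumerates the vectors in
-- the same way.
#nonzero : ℕ → ℕ
#nonzero zero    = 0
#nonzero (suc h) = 3 * 4 ^ h + #nonzero h

nonzero : ∀ h → Fin (#nonzero h) → Vec (Fin 4) h
nonzero (suc h) i with Fin.splitAt (3 * 4 ^ h) i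
... | inj₁ k = suc (proj₁ (remQuot {3} (4 ^ h) k)) ∷ decode h (proj₂ (remQuot {3} (4 ^ h) k))
... | inj₂ j = zero ∷ nonzero h j

nonzero-Nonzero : ∀ h i → Nonzero (nonzero h i)
nonzero-Nonzero (suc h) i with Fin.splitAt (3 * 4 ^ h) i
... | inj₁ k = here _ _
... | inj₂ j = there (nonzero-Nonzero h j)

sum-nonzero : ∀ h (F : Vec (Fin 4) h → ℕ) → sum (λ i → F (nonzero h i)) + F 𝟎 ≡ sumVec F
sum-nonzero zero    F = sym (+-identityʳ (F []))
sum-nonzero (suc h) F = begin
  sum (λ i → F (nonzero (suc h) i)) + F 𝟎
    ≡⟨ cong (_+ F 𝟎) (sum-↑ (3 * 4 ^ h) (λ i → F (nonzero (suc h) i))) ⟩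
  sum (λ k → F (nonzero (suc h) (k ↑ˡ #nonzero h))) + sum (λ j → F (nonzero (suc h) (3 * 4 ^ h ↑ʳ j))) + F 𝟎
    ≡⟨ cong (_+ F 𝟎) (cong₂ _+_ (sum-cong-≗ {3 * 4 ^ h} λ k → cong F (left k)) (sum-cong-≗ {#nonzero h} λ j → cong F (right j))) ⟩
  sum (λ k → F (suc (proj₁ (remQuot {3} (4 ^ h) k)) ∷ decode h (proj₂ (remQuot {3} (4 ^ h) k)))) + sum (λ j → F (zero ∷ nonzero h j)) + F 𝟎
    ≡⟨ +-assoc (sum (λ k → F (suc (proj₁ (remQuot {3} (4 ^ h) k)) ∷ decode h (proj₂ (remQuot {3} (4 ^ h) k))))) _ _ ⟩
  sum (λ k → F (suc (proj₁ (remQuot {3} (4 ^ h) k)) ∷ decode h (proj₂ (remQuot {3} (4 ^ h) k)))) + (sum (λ j → F (zero ∷ nonzero h j)) + F (zero ∷ 𝟎))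
    ≡⟨ cong₂ _+_ (sum-remQuot 3 (λ c k → F (suc c ∷ decode h k))) (sum-nonzero h (λ y → F (zero ∷ y))) ⟩
  sum (λ c → sumVec (λ y → F (suc c ∷ y))) + sumVec (λ y → F (zero ∷ y))
    ≡⟨ +-comm (sum (λ c → sumVec (λ y → F (suc c ∷ y)))) _ ⟩
  sum (λ c → sumVec (λ y → F (c ∷ y)))
    ≡⟨ sumVec-suc F ⟨
  sumVec F ∎
  where
  open ≡-Reasoning
  left : ∀ k → nonzero (suc h) (k ↑ˡ #nonzero h) ≡ suc (proj₁ (remQuot {3} (4 ^ h) k)) ∷ decode h (proj₂ (remQuot {3} (4 ^ h) k))
  left k rewrite Fin.splitAt-↑ˡ (3 * 4 ^ h) k (#nonzero h) = refl
  right : ∀ j → nonzero (suc h) (3 * 4 ^ h ↑ʳ j) ≡ zero ∷ nonzero h j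
  right j rewrite Fin.splitAt-↑ʳ (3 * 4 ^ h) (#nonzero h) j = refl

#nonzero-suc : ∀ h → suc (#nonzero h) ≡ 4 ^ h
#nonzero-suc h = trans (+-comm 1 (#nonzero h)) (trans (cong (_+ 1) (sym (trans (sum-const (#nonzero h)) (*-identityʳ (#nonzero h)))))
  (trans (sum-nonzero h (λ _ → 1)) (trans (sumVec-const h) (*-identityʳ (4 ^ h)))))

n<2^n : ∀ n → n < 2 ^ n
n<2^n zero    = s≤s z≤n
n<2^n (suc n) = ≤-trans (+-mono-≤ (m^n>0 2 n) (n<2^n n)) (≤-reflexive (cong (2 ^ n +_) (sym (+-identityʳ (2 ^ n)))))

occurrences : List (Fin n) → Fin n → ℕ
occurrences []      y = 0
occurrences (x ∷ L) y = ⟦ does (x Fin.≟ y) ⟧ + occurrences L y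

sum-occurrences : ∀ (L : List (Fin n)) → sum (occurrences L) ≡ length L
sum-occurrences {n} []      = sum-zero {n} λ _ → refl
sum-occurrences {n} (x ∷ L) = trans (∑-distrib-+ {n} (λ y → ⟦ does (x Fin.≟ y) ⟧) (occurrences L)) (cong₂ _+_ (sum-δ₁ x) (sum-occurrences L))

sum-<⇒∃ : (f g : Fin n → ℕ) → sum f < sum g → ∃[ i ] f i < g i
sum-<⇒∃ {n} f g lt with Fin.any? (λ i → f i <? g i)
... | yes p   = p
... | no none = contradiction (≤-trans lt (sum-mono λ i → ≮⇒≥ λ l → none (i , l))) (<-irrefl refl)

-- Fewer than h vectors have at least 2·4^h/2^h = 2^(h+1) common orthogonal vectors, more than the
-- zero vector and `L` can account for. That y avoids `L` is a condition of its own, since every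
-- vector is orthogonal to itself. Comparing multiplicities in `L` with the indicator of
-- orthogonality yields both at once.
unaffected : ∀ h (L : List (Fin (#nonzero h))) → length L < h →
  ∃[ y ] (∀ x → x List.∈ L → form (nonzero h x) (nonzero h y) ≡ false × x ≢ y)
unaffected h L short =
  let (y , lt) = sum-<⇒∃ (occurrences L) (λ y → ⟦ orth L′ (nonzero h y) ⟧) many
  in y , λ x x∈L → (free L y (≤-trans (s≤s z≤n) lt) x x∈L , apart L y (≤-pred (≤-trans lt (⟦⟧≤1 _))) x x∈L)
  where
  open ≤-Reasoning
  L′ = List.map (nonzero h) L
  N = sumVec (λ y → ⟦ orth L′ y ⟧)
  arrange : ∀ a b → 2 * a * b ≡ a * b * 2
  arrange = solve-∀
  N≥ : 2 ^ suc h ≤ N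
  N≥ = power-cancel {a = 2} {h} (begin
    2 ^ h * (2 * 2 ^ h)             ≡⟨ trans (*-comm (2 ^ h) (2 * 2 ^ h)) (*-assoc 2 (2 ^ h) (2 ^ h)) ⟩
    2 * (2 ^ h * 2 ^ h)             ≡⟨ cong (2 *_) (sym (^-distribʳ-* h 2 2)) ⟩
    2 * 4 ^ h                       ≤⟨ *-monoʳ-≤ 2 (orth-count L′) ⟩
    2 * (N * 2 ^ length L′)         ≡⟨ cong (λ k → 2 * (N * 2 ^ k)) (List.length-map (nonzero h) L) ⟩
    2 * (N * 2 ^ length L)          ≡⟨ trans (sym (*-assoc 2 N (2 ^ length L))) (trans (arrange N (2 ^ length L)) (trans (*-assoc N (2 ^ length L) 2) (cong (N *_) (*-comm (2 ^ length L) 2)))) ⟩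
    N * 2 ^ suc (length L)          ≤⟨ *-monoʳ-≤ N (^-monoʳ-≤ 2 short) ⟩
    N * 2 ^ h                       ≡⟨ *-comm N (2 ^ h) ⟩
    2 ^ h * N                       ∎)
  many : sum (occurrences L) < sum (λ y → ⟦ orth L′ (nonzero h y) ⟧)
  many = ≤-pred (begin
    suc (suc (sum (occurrences L)))                   ≡⟨ cong (2 +_) (sum-occurrences L) ⟩
    2 + length L                                      ≤⟨ s≤s short ⟩
    suc h                                             ≤⟨ <⇒≤ (n<2^n (suc h)) ⟩
    2 ^ suc h                                         ≤⟨ N≥ ⟩
    N                                                 ≡⟨ sum-nonzero h (λ y → ⟦ orth L′ y ⟧) ⟨
    sum (λ y → ⟦ orth L′ (nonzero h y) ⟧) + ⟦ orth L′ 𝟎 ⟧ ≤⟨ +-monoʳ-≤ _ (⟦⟧≤1 (orth L′ 𝟎)) ⟩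
    sum (λ y → ⟦ orth L′ (nonzero h y) ⟧) + 1         ≡⟨ +-comm _ 1 ⟩
    suc (sum (λ y → ⟦ orth L′ (nonzero h y) ⟧))       ∎)
  free : ∀ L y → 1 ≤ ⟦ orth (List.map (nonzero h) L) (nonzero h y) ⟧ → ∀ x → x List.∈ L → form (nonzero h x) (nonzero h y) ≡ false
  free (x ∷ L) y le _ (List.here refl) with form (nonzero h x) (nonzero h y)
  ... | false = refl
  ... | true  = contradiction le λ ()
  free (x ∷ L) y le z (List.there z∈L) with form (nonzero h x) (nonzero h y)
  ... | false = free L y le z z∈L
  ... | true  = contradiction le λ ()
  apart : ∀ L (y : Fin (#nonzero h)) → occurrences L y ≤ 0 → ∀ x → x List.∈ L → x ≢ y
  apart (x ∷ L) y le _ (List.here refl) refl = contradiction (≤-trans (≤-reflexive (cong ⟦_⟧ (sym (does-true (x Fin.≟ x) refl)))) (≤-trans (m≤m+n _ (occurrences L x)) le)) λ ()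
  apart (x ∷ L) y le z (List.there z∈L) = apart L y (≤-trans (m≤n+m (occurrences L y) ⟦ does (x Fin.≟ y) ⟧) le) z z∈L

-- Small stars from large dominating sets.

-- The given element only excludes emptiness; the one returned comes from a search that depends on
-- `S` alone.
first : (S : Subset n) → ∃ (_∈ S) → ∃ (_∈ S)
first S nonempty with Fin.any? (Subset._∈? S)
... | yes p = p
... | no ¬p = contradiction nonempty ¬p

first-unique : (S : Subset n) (p q : ∃ (_∈ S)) → first S p ≡ first S q
first-unique S p q with Fin.any? (Subset._∈? S)
... | yes _ = refl
... | no ¬p = contradiction p ¬p

abstract
  component : (H : Graph (Fin n)) → ∀ v → ∃[ S ] (∀ u → u ∈ S ⇔ Reachable H v u)
  component {n} H v =
    let (R , rv , reached , closed) = reachableSet {n} {E = Adj H} (λ x y → Bool.T? (adj H x y)) (Reachable H v) (λ p e → p ◅◅ e ◅ ε) v ε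
    in tabulate R , λ u → mk⇔ (λ u∈ → reached u (trans (sym (Vec.lookup∘tabulate R u)) (Vec.[]=⇒lookup u∈)))
                              (λ p → Vec.lookup⇒[]= u (tabulate R) (trans (Vec.lookup∘tabulate R u) (along R closed p rv)))
    where
    along : ∀ (R : Fin n → Bool) → (∀ x y → R x ≡ true → Adj H x y → R y ≡ true) → ∀ {x y} → Reachable H x y → R x ≡ true → R y ≡ true
    along R closed ε                       rx = rx
    along R closed {x} (_◅_ {j = w} e p) rx = along R closed p (closed x w rx e)

reachable-sym : (H : Graph (Fin n)) → ∀ {u v} → Reachable H u v → Reachable H v u
reachable-sym H ε                       = ε
reachable-sym H {u} (_◅_ {j = w} e p) = reachable-sym H p ◅◅ subst T (symm H u w) e ◅ ε

-- Two adjacent vertices of a star, neither of them its centre, would make a triangle.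
triangle-free : (H : Graph (Fin n)) → IsForest H → ∀ {a b c} → Adj H a b → Adj H b c → Adj H c a → ⊥
triangle-free {n} H forest {a} {b} {c} ab bc ca = forest 0 f (injective , (λ { zero → ab ; (suc zero) → bc }) , ca)
  where
  f : Fin 3 → Fin n
  f = lookup (a ∷ b ∷ c ∷ [])
  loop : ∀ {x} → ¬ Adj H x x
  loop {x} e = true≢false (T⇒true e) (irrefl H x)
  injective : ∀ {i j} → f i ≡ f j → i ≡ j
  injective {0F} {0F} _ = refl
  injective {1F} {1F} _ = refl
  injective {2F} {2F} _ = refl
  injective {0F} {1F} e = contradiction (subst (Adj H a) (sym e) ab) loop
  injective {1F} {0F} e = contradiction (subst (Adj H a) e ab) loop
  injective {1F} {2F} e = contradiction (subst (Adj H b) (sym e) bc) loop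
  injective {2F} {1F} e = contradiction (subst (Adj H b) e bc) loop
  injective {0F} {2F} e = contradiction (subst (Adj H c) e ca) loop
  injective {2F} {0F} e = contradiction (subst (Adj H c) (sym e) ca) loop

Dominating : Graph (Fin n) → (Fin n → Bool) → Set
Dominating G D = ∀ v → D v ≡ true ⊎ ∃[ c ] D c ≡ true × adj G v c ≡ true

module SmallStar {n} (G : Graph (Fin n)) (H : Graph (Fin n)) (starFactor : IsStarFactor G H) where

  forest : IsForest H
  forest = proj₁ (proj₂ starFactor)

  S : Fin n → Subset n
  S v = proj₁ (component H v)

  ∈S⇒ : ∀ {v u} → u ∈ S v → Reachable H v u
  ∈S⇒ {v} {u} = Equivalence.to (proj₂ (component H v) u)

  ⇒∈S : ∀ {v u} → Reachable H v u → u ∈ S v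
  ⇒∈S {v} {u} = Equivalence.from (proj₂ (component H v) u)

  S-cong : ∀ {u v} → Reachable H u v → S u ≡ S v
  S-cong p = Subset.⊆-antisym (λ x∈ → ⇒∈S (reachable-sym H p ◅◅ ∈S⇒ x∈)) (λ x∈ → ⇒∈S (p ◅◅ ∈S⇒ x∈))

  representative : ∀ v → ∃ (_∈ S v)
  representative v = first (S v) (v , ⇒∈S ε)

  representative-cong : ∀ {u v} → Reachable H u v → proj₁ (representative u) ≡ proj₁ (representative v)
  representative-cong {u} {v} p = go (S-cong p) (u , ⇒∈S ε) (v , ⇒∈S ε)
    where
    go : ∀ {S S′ : Subset n} → S ≡ S′ → (p : ∃ (_∈ S)) (q : ∃ (_∈ S′)) → proj₁ (first S p) ≡ proj₁ (first S′ q)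
    go {S} refl p q = cong proj₁ (first-unique S p q)

  star : ∀ v → ∃[ c ] (∀ w → w ≢ c → Adj (induced H (S v)) c w)
  star v = proj₂ (proj₂ (proj₂ starFactor) (S v) (v , proj₂ (component H v)))

  -- The centre of a single edge is ambiguous; going through the representative
  -- makes the choice the same for all vertices of a component.
  centre : Fin n → Fin n
  centre v = proj₁ (proj₁ (star (proj₁ (representative v))))

  centre-cong : ∀ {u v} → Reachable H u v → centre u ≡ centre v
  centre-cong p = cong (λ r → proj₁ (proj₁ (star r))) (representative-cong p)

  to-representative : ∀ v → Reachable H v (proj₁ (representative v))
  to-representative v = ∈S⇒ (proj₂ (representative v))

  centre-adj : ∀ {v w} → Reachable H v w → w ≢ centre v → Adj H (centre v) w
  centre-adj {v} {w} p w≢c = proj₂ (star r) (w , ⇒∈S (reachable-sym H (to-representative v) ◅◅ p)) (λ e → w≢c (cong proj₁ e))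
    where r = proj₁ (representative v)

  fibre : Fin n → ℕ
  fibre x = sum (λ v → ⟦ does (centre v Fin.≟ x) ⟧)

  isCentre : Fin n → Bool
  isCentre x = does (Fin.any? (λ v → centre v Fin.≟ x))

  centres-dominate : Dominating G isCentre
  centres-dominate v with v Fin.≟ centre v
  ... | yes e  = inj₁ (does-true (Fin.any? (λ u → centre u Fin.≟ v)) (v , sym e))
  ... | no v≢c = inj₂ (centre v , does-true (Fin.any? (λ u → centre u Fin.≟ centre v)) (v , refl) ,
      T⇒true (proj₁ starFactor v (centre v) (subst T (symm H (centre v) v) (centre-adj ε v≢c))))

  sum-fibre : sum fibre ≡ n
  sum-fibre = trans (∑-comm {n} {n} (λ x v → ⟦ does (centre v Fin.≟ x) ⟧))
    (trans (sum-cong-≗ {n} (λ v → sum-δ₁ (centre v))) (trans (sum-const n) (*-identityʳ n)))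

  -- Every edge of the star contains its centre and is charged to the other end, which lies in the
  -- fibre. The factor 2 allows for the centre being the smaller or the larger end.
  edges≤ : ∀ v → edgesWithin H (S v) ≤ 2 * fibre (centre v)
  edges≤ v = begin
    edgesWithin H (S v)                                            ≡⟨ edgesWithin-sum H (S v) ⟩
    sum (λ u → sum (λ w → ⟦ edge? H (S v) u w ⟧))                  ≤⟨ sum-mono (λ u → sum-mono (λ w → ⟦⟧≤ (edge? H (S v) u w) (hits u w))) ⟩
    sum (λ u → sum (λ w → ends u w + ends w u))                    ≡⟨ sum-cong-≗ {n} (λ u → ∑-distrib-+ {n} (λ w → ends u w) (λ w → ends w u)) ⟩
    sum (λ u → sum (λ w → ends u w) + sum (λ w → ends w u))        ≡⟨ ∑-distrib-+ {n} (λ u → sum (λ w → ends u w)) (λ u → sum (λ w → ends w u)) ⟩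
    sum (λ u → sum (λ w → ends u w)) + sum (λ u → sum (λ w → ends w u)) ≡⟨ cong (λ z → sum (λ u → sum (λ w → ends u w)) + z) (∑-comm {n} {n} (λ u w → ends w u)) ⟩
    E + E                                                          ≡⟨ cong₂ _+_ total (trans total (sym (+-identityʳ (fibre c)))) ⟩
    2 * fibre c                                                    ∎
    where
    open ≤-Reasoning
    c = centre v
    ends : Fin n → Fin n → ℕ
    ends u w = ⟦ does (c Fin.≟ u) ⟧ * ⟦ does (centre w Fin.≟ c) ⟧
    E = sum (λ u → sum (λ w → ends u w))
    total : E ≡ fibre c
    total = trans (sum-cong-≗ {n} (λ u → sym (*-distribˡ-sum {n} ⟦ does (c Fin.≟ u) ⟧ (λ w → ⟦ does (centre w Fin.≟ c) ⟧)))) (sum-δ c (λ _ → fibre c))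
    ends-1 : ∀ {u w} → c ≡ u → Reachable H v w → 1 ≤ ends u w
    ends-1 {u} {w} e p = ≤-reflexive (cong₂ (λ a b → ⟦ a ⟧ * ⟦ b ⟧) (sym (does-true (c Fin.≟ u) e)) (sym (does-true (centre w Fin.≟ c) (sym (centre-cong p)))))
    hits : ∀ u w → edge? H (S v) u w ≡ true → 1 ≤ ends u w + ends w u
    hits u w e =
      let (_ , e₁)  = true-∧ {does (u Fin.<? w)} e
          (u∈ , e₂) = true-∧ {does (u Subset.∈? S v)} e₁
          (w∈ , uw) = true-∧ {does (w Subset.∈? S v)} e₂
      in decide (∈S⇒ (true-does (u Subset.∈? S v) u∈)) (∈S⇒ (true-does (w Subset.∈? S v) w∈)) (true⇒T uw)
      where
      decide : Reachable H v u → Reachable H v w → Adj H u w → 1 ≤ ends u w + ends w u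
      decide pu pw uw with u Fin.≟ c | w Fin.≟ c
      ... | yes u≡c | _       = ≤-trans (ends-1 (sym u≡c) pw) (m≤m+n (ends u w) (ends w u))
      ... | no _    | yes w≡c = ≤-trans (ends-1 (sym w≡c) pu) (m≤n+m (ends w u) (ends u w))
      ... | no u≢c  | no w≢c  = ⊥-elim (triangle-free H forest (centre-adj pu u≢c) uw (subst T (symm H c w) (centre-adj pw w≢c)))

  -- Averaging over the centres: the fibres partition the n vertices, and there are at least k
  -- centres. If each fibre times k were at least n + 1, summing over the centres would give k(n +
  -- 1) ≤ kn.
  small-star : ∀ k → 1 ≤ k → (∀ D → Dominating G D → k ≤ card D) → ∃[ T ] IsComponent H T × edgesWithin H T * k ≤ 2 * n
  small-star k 1≤k large with Fin.any? (λ v → fibre (centre v) * k ≤? n)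
  ... | yes (v , le) = S v , (v , proj₂ (component H v)) , (begin
    edgesWithin H (S v) * k        ≤⟨ *-monoˡ-≤ k (edges≤ v) ⟩
    2 * fibre (centre v) * k       ≡⟨ *-assoc 2 (fibre (centre v)) k ⟩
    2 * (fibre (centre v) * k)     ≤⟨ *-monoʳ-≤ 2 le ⟩
    2 * n                          ∎)
    where open ≤-Reasoning
  ... | no none = contradiction (begin-strict
    n * k                                  <⟨ *-monoˡ-< k {{>-nonZero 1≤k}} (n<1+n n) ⟩
    suc n * k                              ≡⟨ *-comm (suc n) k ⟩
    k * suc n                              ≤⟨ *-monoˡ-≤ (suc n) (large isCentre centres-dominate) ⟩
    card isCentre * suc n                  ≡⟨ *-distribʳ-sum {n} (suc n) (λ x → ⟦ isCentre x ⟧) ⟩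
    sum (λ x → ⟦ isCentre x ⟧ * suc n)     ≤⟨ sum-mono big ⟩
    sum (λ x → fibre x * k)                ≡⟨ *-distribʳ-sum {n} k fibre ⟨
    sum fibre * k                          ≡⟨ cong (_* k) sum-fibre ⟩
    n * k                                  ∎) (<-irrefl refl)
    where
    open ≤-Reasoning
    big : ∀ x → ⟦ isCentre x ⟧ * suc n ≤ fibre x * k
    big x with Fin.any? (λ v → centre v Fin.≟ x)
    ... | no _           = z≤n
    ... | yes (v , refl) = ≤-trans (≤-reflexive (+-identityʳ (suc n))) (≰⇒> λ le → none (v , le))

-- Blow-ups of arbitrary degree.

telescope : ∀ t (ψ : ℕ → ℕ) → ψ 0 + sum {t} (λ j → ψ (suc (toℕ j))) ≡ sum {t} (λ j → ψ (toℕ j)) + ψ t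
telescope zero    ψ = +-identityʳ (ψ 0)
telescope (suc t) ψ = trans (cong (λ z → ψ 0 + z) (telescope t (ψ ∘ suc))) (sym (+-assoc (ψ 0) _ _))

-- Shifting the window of t consecutive numbers by one drops i and gains i + t, which have the same
-- residue; at i = 0 the count is immediate.
circulant-sum : ∀ t .{{_ : NonZero t}} r → r ≤ t → ∀ i → sum {t} (λ j → ⟦ does ((i + toℕ j) % t <? r) ⟧) ≡ r
circulant-sum t r r≤t zero = trans (sum-cong-≗ {t} (λ j → cong (λ k → ⟦ does (k <? r) ⟧) (m<n⇒m%n≡m (Fin.toℕ<n j)))) (count r≤t)
  where
  count : ∀ {r t} → r ≤ t → sum {t} (λ j → ⟦ does (toℕ j <? r) ⟧) ≡ r
  count {zero}  {t}     z≤n     = sum-zero {t} λ j → refl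
  count {suc r} {suc t} (s≤s h) = cong suc (count h)
circulant-sum t r r≤t (suc i) = trans (+-cancelˡ-≡ (φ i) _ _ step) (circulant-sum t r r≤t i)
  where
  φ : ℕ → ℕ
  φ k = ⟦ does (k % t <? r) ⟧
  step : φ i + sum {t} (λ j → φ (suc i + toℕ j)) ≡ φ i + sum {t} (λ j → φ (i + toℕ j))
  step = begin
    φ i + sum {t} (λ j → φ (suc i + toℕ j))          ≡⟨ cong₂ _+_ (cong φ (sym (+-identityʳ i))) (sum-cong-≗ {t} λ j → cong φ (sym (+-suc i (toℕ j)))) ⟩
    φ (i + 0) + sum {t} (λ j → φ (i + suc (toℕ j)))  ≡⟨ telescope t (λ j → φ (i + j)) ⟩
    sum {t} (λ j → φ (i + toℕ j)) + φ (i + t)        ≡⟨ cong (λ z → sum {t} (λ j → φ (i + toℕ j)) + ⟦ does (z <? r) ⟧) ([m+n]%n≡m%n i t) ⟩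
    sum {t} (λ j → φ (i + toℕ j)) + φ i              ≡⟨ +-comm _ (φ i) ⟩
    φ i + sum {t} (λ j → φ (i + toℕ j))              ∎
    where open ≡-Reasoning

≟-sym : ∀ (x y : Fin n) → does (x Fin.≟ y) ≡ does (y Fin.≟ x)
≟-sym x y with x Fin.≟ y | y Fin.≟ x
... | yes _   | yes _   = refl
... | no _    | no _    = refl
... | yes x≡y | no y≢x  = contradiction (sym x≡y) y≢x
... | no x≢y  | yes y≡x = contradiction (sym y≡x) x≢y

-- Each point x is replaced by 2t twins (x , b , i); twins with different b are
-- joined by an r-regular circulant, which adjusts the degree to P t + r.
module BlowUp (N : ℕ) (M : Fin N → Fin N → Bool) (M-sym : ∀ x y → M x y ≡ M y x) (M-irrefl : ∀ x → M x x ≡ false)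
  (P : ℕ) (row : ∀ x → card (M x) * 2 ≡ P) (t : ℕ) .{{_ : NonZero t}} (r : ℕ) (r≤t : r ≤ t) where

  point : Fin (N * (2 * t)) → Fin N
  point v = proj₁ (remQuot {N} (2 * t) v)

  side : Fin (N * (2 * t)) → Fin 2
  side v = proj₁ (remQuot {2} t (proj₂ (remQuot {N} (2 * t) v)))

  twin : Fin (N * (2 * t)) → Fin t
  twin v = proj₂ (remQuot {2} t (proj₂ (remQuot {N} (2 * t) v)))

  -- The sum of the indices, rather than their difference, makes the relation symmetric. Loops at
  -- indices where 2i mod t is below r are excluded by the two sides.
  join : Fin N → Fin 2 → Fin t → Fin N → Fin 2 → Fin t → Bool
  join x b i y c j = does (x Fin.≟ y) ∧ (not (does (b Fin.≟ c)) ∧ does ((toℕ i + toℕ j) % t <? r))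

  graph : Graph (Fin (N * (2 * t)))
  graph = record
    { adj    = λ u v → M (point u) (point v) ∨ join (point u) (side u) (twin u) (point v) (side v) (twin v)
    ; symm   = λ u v → cong₂ _∨_ (M-sym (point u) (point v)) (join-sym (point u) (side u) (twin u) (point v) (side v) (twin v))
    ; irrefl = λ v → cong₂ _∨_ (M-irrefl (point v)) (join-irrefl (point v) (side v) (twin v))
    }
    where
    join-sym : ∀ x b i y c j → join x b i y c j ≡ join y c j x b i
    join-sym x b i y c j = cong₂ _∧_ (≟-sym x y) (cong₂ (λ e k → not e ∧ does (k % t <? r)) (≟-sym b c) (+-comm (toℕ i) (toℕ j)))
    join-irrefl : ∀ x b i → join x b i x b i ≡ false
    join-irrefl x b i = trans (cong (λ e → does (x Fin.≟ x) ∧ (not e ∧ does ((toℕ i + toℕ i) % t <? r))) (does-true (b Fin.≟ b) refl)) (Bool.∧-zeroʳ (does (x Fin.≟ x)))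

  regular : Regular (P * t + r) graph
  regular v = begin
    degree graph v                                                    ≡⟨ degree-sum graph v ⟩
    sum (λ w → F (point w) (side w) (twin w))                         ≡⟨ sum-remQuot N (λ y k → F y (proj₁ (remQuot {2} t k)) (proj₂ (remQuot {2} t k))) ⟩
    sum (λ y → sum (λ k → F y (proj₁ (remQuot {2} t k)) (proj₂ (remQuot {2} t k)))) ≡⟨ sum-cong-≗ {N} (λ y → sum-remQuot 2 (F y)) ⟩
    sum (λ y → sum {2} (λ c → sum {t} (λ j → F y c j)))               ≡⟨ sum-cong-≗ {N} (λ y → per-point y) ⟩
    sum (λ y → 2 * (t * ⟦ M x y ⟧) + ⟦ does (x Fin.≟ y) ⟧ * r)        ≡⟨ ∑-distrib-+ {N} (λ y → 2 * (t * ⟦ M x y ⟧)) (λ y → ⟦ does (x Fin.≟ y) ⟧ * r) ⟩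
    sum (λ y → 2 * (t * ⟦ M x y ⟧)) + sum (λ y → ⟦ does (x Fin.≟ y) ⟧ * r) ≡⟨ cong₂ _+_ main (sum-δ x (λ _ → r)) ⟩
    P * t + r                                                         ∎
    where
    open ≡-Reasoning
    x = point v
    b = side v
    i = twin v
    F : Fin N → Fin 2 → Fin t → ℕ
    F y c j = ⟦ M x y ∨ join x b i y c j ⟧
    main : sum (λ y → 2 * (t * ⟦ M x y ⟧)) ≡ P * t
    main = begin
      sum (λ y → 2 * (t * ⟦ M x y ⟧))   ≡⟨ sum-cong-≗ {N} (λ y → sym (*-assoc 2 t ⟦ M x y ⟧)) ⟩
      sum (λ y → 2 * t * ⟦ M x y ⟧)     ≡⟨ *-distribˡ-sum {N} (2 * t) (λ y → ⟦ M x y ⟧) ⟨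
      2 * t * card (M x)                ≡⟨ arrange t (card (M x)) ⟩
      card (M x) * 2 * t                ≡⟨ cong (_* t) (row x) ⟩
      P * t                             ∎
      where
      arrange : ∀ t k → 2 * t * k ≡ k * 2 * t
      arrange = solve-∀
    pointwise : ∀ y c j → F y c j ≡ ⟦ M x y ⟧ + ⟦ does (x Fin.≟ y) ⟧ * (⟦ not (does (b Fin.≟ c)) ⟧ * ⟦ does ((toℕ i + toℕ j) % t <? r) ⟧)
    pointwise y c j with x Fin.≟ y
    ... | no _ = trans (cong ⟦_⟧ (Bool.∨-identityʳ (M x y))) (sym (+-identityʳ ⟦ M x y ⟧))
    ... | yes refl = trans (cong (λ m → ⟦ m ∨ (not (does (b Fin.≟ c)) ∧ does ((toℕ i + toℕ j) % t <? r)) ⟧) (M-irrefl x))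
      (trans (⟦⟧-∧ (not (does (b Fin.≟ c))) (does ((toℕ i + toℕ j) % t <? r)))
        (sym (cong₂ (λ m z → ⟦ m ⟧ + z) (M-irrefl x) (+-identityʳ _))))
    other : ∀ (b : Fin 2) → sum (λ c → ⟦ not (does (b Fin.≟ c)) ⟧) ≡ 1
    other zero       = refl
    other (suc zero) = refl
    per-point : ∀ y → sum {2} (λ c → sum {t} (λ j → F y c j)) ≡ 2 * (t * ⟦ M x y ⟧) + ⟦ does (x Fin.≟ y) ⟧ * r
    per-point y = begin
      sum {2} (λ c → sum {t} (λ j → F y c j))
        ≡⟨ sum-cong-≗ {2} (λ c → trans (sum-cong-≗ {t} (λ j → pointwise y c j)) (∑-distrib-+ {t} (λ _ → ⟦ M x y ⟧) (λ j → δ * (β c * γ j)))) ⟩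
      sum {2} (λ c → sum {t} (λ _ → ⟦ M x y ⟧) + sum {t} (λ j → δ * (β c * γ j)))
        ≡⟨ sum-cong-≗ {2} (λ c → cong₂ _+_ (sum-const t {⟦ M x y ⟧}) (trans (sym (*-distribˡ-sum {t} δ (λ j → β c * γ j))) (cong (δ *_) (sym (*-distribˡ-sum {t} (β c) γ))))) ⟩
      sum {2} (λ c → t * ⟦ M x y ⟧ + δ * (β c * sum γ))
        ≡⟨ sum-cong-≗ {2} (λ c → cong (λ z → t * ⟦ M x y ⟧ + δ * (β c * z)) (circulant-sum t r r≤t (toℕ i))) ⟩
      sum {2} (λ c → t * ⟦ M x y ⟧ + δ * (β c * r))
        ≡⟨ ∑-distrib-+ {2} (λ _ → t * ⟦ M x y ⟧) (λ c → δ * (β c * r)) ⟩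
      2 * (t * ⟦ M x y ⟧) + sum {2} (λ c → δ * (β c * r))
        ≡⟨ cong (2 * (t * ⟦ M x y ⟧) +_) (trans (sym (*-distribˡ-sum {2} δ (λ c → β c * r))) (cong (δ *_) (sym (*-distribʳ-sum {2} r β)))) ⟩
      2 * (t * ⟦ M x y ⟧) + δ * (sum {2} β * r)
        ≡⟨ cong (λ z → 2 * (t * ⟦ M x y ⟧) + δ * z) (trans (cong (_* r) (other b)) (*-identityˡ r)) ⟩
      2 * (t * ⟦ M x y ⟧) + δ * r ∎
      where
      δ = ⟦ does (x Fin.≟ y) ⟧
      β : Fin 2 → ℕ
      β c = ⟦ not (does (b Fin.≟ c)) ⟧
      γ : Fin t → ℕ
      γ j = ⟦ does ((toℕ i + toℕ j) % t <? r) ⟧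

  -- Blowing up does not lower the bound. The points under a small `D` miss some y, and no copy of y
  -- is dominated: `M` does not join it to `D`, and `D` contains no vertex over y.
  dominating-large : ∀ k → (∀ (L : List (Fin N)) → length L < k → ∃[ y ] (∀ x → x List.∈ L → M x y ≡ false × x ≢ y)) →
    ∀ D → Dominating graph D → k ≤ card D
  dominating-large k free D dominating = ≮⇒≥ λ few →
    let (y , hy) = free L (subst (_< k) (sym length-L) few)
        v        = combine y (combine {2} zero (Fin.fromℕ< (>-nonZero⁻¹ t)))
        point-v  : point v ≡ y
        point-v  = cong proj₁ (Fin.remQuot-combine {N} y (combine {2} zero (Fin.fromℕ< (>-nonZero⁻¹ t))))
        avoid    : ∀ c → D c ≡ true → M (point c) (point v) ≡ false × point c ≢ point v
        avoid c dc = subst (λ z → M (point c) z ≡ false × point c ≢ z) (sym point-v) (hy (point c) (∈L c dc))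
    in case dominating v of λ
      { (inj₁ dv) → proj₂ (avoid v dv) refl
      ; (inj₂ (c , dc , vc)) → case true-∨ vc of λ
          { (inj₁ m) → true≢false (trans (M-sym (point c) (point v)) m) (proj₁ (avoid c dc))
          ; (inj₂ e) → proj₂ (avoid c dc) (sym (true-does (point v Fin.≟ point c) (proj₁ (true-∧ e)))) } }
    where
    D? : ∀ v → Dec (T (D v))
    D? v = Bool.T? (D v)
    L = List.map point (List.filter D? (List.allFin (N * (2 * t))))
    length-L : length L ≡ card D
    length-L = trans (List.length-map point (List.filter D? (List.allFin (N * (2 * t))))) (length-filter-tabulate D? (λ v → v))
    ∈L : ∀ c → D c ≡ true → point c List.∈ L
    ∈L c dc = List.∈-map⁺ point (List.∈-filter⁺ D? (List.∈-allFin c) (true⇒T dc))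

HardGraph : ℕ → ℕ → Set
HardGraph d ℓ = ∃[ n ] 1 ≤ n × Σ[ G ∈ Graph (Fin n) ] Regular d G ×
  (∀ H → IsStarFactor G H → ∃[ S ] IsComponent H S × ℓ * edgesWithin H S ≤ 32 * d)

-- The degree is 4^h/2, and the doubling in the blow-up clears the fraction. This leaves 4^h t + r,
-- so t and r can be the quotient and remainder of d by 4^h.
form-row : ∀ h x → card (λ y → form (nonzero h x) (nonzero h y)) * 2 ≡ 4 ^ h
form-row h x = trans (cong (_* 2) (begin
  card (λ y → form (nonzero h x) (nonzero h y))                               ≡⟨ +-identityʳ _ ⟨
  card (λ y → form (nonzero h x) (nonzero h y)) + 0                           ≡⟨ cong (λ b → card (λ y → form (nonzero h x) (nonzero h y)) + ⟦ b ⟧) (form-𝟎 (nonzero h x)) ⟨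
  card (λ y → form (nonzero h x) (nonzero h y)) + ⟦ form (nonzero h x) 𝟎 ⟧    ≡⟨ sum-nonzero h (λ y → ⟦ form (nonzero h x) y ⟧) ⟩
  sumVec (λ y → ⟦ form (nonzero h x) y ⟧)                                     ∎)) (form-balanced (nonzero-Nonzero h x))
  where open ≡-Reasoning

-- Blowing up a single point with t = r = d gives the complete bipartite graph K_{d,d}. For bounded
-- ℓ the trivial bound by the number of vertices suffices, a dominating set having at least one
-- element.
hard-graph-small : ∀ d ℓ → 1 ≤ d → ℓ ≤ 4 → HardGraph d ℓ
hard-graph-small d ℓ 1≤d ℓ≤4 = 1 * (2 * d) , ≤-trans 1≤d (≤-trans (m≤n*m d 2) (m≤n*m (2 * d) 1)) , graph , regular , λ H starFactor →
  let (S , comp , le) = SmallStar.small-star graph H starFactor 1 ≤-refl (dominating-large 1 λ { [] _ → zero , (λ x ()) ; (x ∷ L) (s≤s ()) })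
  in S , comp , (begin
    ℓ * edgesWithin H S          ≤⟨ *-mono-≤ ℓ≤4 (≤-trans (≤-reflexive (sym (*-identityʳ (edgesWithin H S)))) le) ⟩
    4 * (2 * (1 * (2 * d)))      ≡⟨ arrange d ⟩
    16 * d                       ≤⟨ *-monoˡ-≤ d (m≤m+n 16 16) ⟩
    32 * d                       ∎)
  where
  open ≤-Reasoning
  arrange : ∀ d → 4 * (2 * (1 * (2 * d))) ≡ 16 * d
  arrange = solve-∀
  open BlowUp 1 (λ _ _ → false) (λ _ _ → refl) (λ _ → refl) 0 (λ _ → refl) d {{>-nonZero 1≤d}} d ≤-refl

hard-graph-large : ∀ d ℓ → 4 ≤ ℓ → 2 ^ ℓ ≤ d → HardGraph d ℓ
hard-graph-large d ℓ 4≤ℓ lo = N * (2 * t) , *-mono-≤ 1≤N (*-mono-≤ {1} {2} (s≤s z≤n) 1≤t) , graph , subst (λ e → Regular e graph) degree≡ regular ,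
  λ H starFactor →
  let (S , comp , le) = SmallStar.small-star graph H starFactor h 1≤h (dominating-large h (unaffected h))
      e = edgesWithin H S
  in S , comp , (begin
    ℓ * e                        ≤⟨ *-monoˡ-≤ e ℓ≤8h ⟩
    8 * h * e                    ≡⟨ arrange₁ h e ⟩
    8 * (e * h)                  ≤⟨ *-monoʳ-≤ 8 le ⟩
    8 * (2 * (N * (2 * t)))      ≡⟨ arrange₂ N t ⟩
    32 * (t * N)                 ≤⟨ *-monoʳ-≤ 32 (*-monoʳ-≤ t (≤-trans (n≤1+n N) (≤-reflexive (#nonzero-suc h)))) ⟩
    32 * (t * 4 ^ h)             ≤⟨ *-monoʳ-≤ 32 (m/n*n≤m d (4 ^ h)) ⟩
    32 * d                       ∎)
  where
  open ≤-Reasoning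
  -- The circulant needs r ≤ t. As r < 4^h, it is enough that 4^h ≤ d / 4^h, that is, 16^h ≤ d,
  -- which follows from 4h ≤ ℓ.
  h = ℓ / 4
  N = #nonzero h
  instance
    4^h≢0 : NonZero (4 ^ h)
    4^h≢0 = m^n≢0 4 h
  t = d / 4 ^ h
  r = d % 4 ^ h
  1≤h : 1 ≤ h
  1≤h = m≥n⇒m/n>0 4≤ℓ
  1≤N : 1 ≤ N
  1≤N = ≤-pred (≤-trans (≤-trans (s≤s (s≤s z≤n)) (^-monoʳ-≤ 4 1≤h)) (≤-reflexive (sym (#nonzero-suc h))))
  4^h≤t : 4 ^ h ≤ t
  4^h≤t = begin
    4 ^ h                        ≡⟨ m*n/n≡m (4 ^ h) (4 ^ h) ⟨
    4 ^ h * 4 ^ h / 4 ^ h        ≤⟨ /-monoˡ-≤ (4 ^ h) (begin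
      4 ^ h * 4 ^ h              ≡⟨ ^-distribʳ-* h 4 4 ⟨
      16 ^ h                     ≡⟨ ^-*-assoc 2 4 h ⟩
      2 ^ (4 * h)                ≤⟨ ^-monoʳ-≤ 2 (≤-trans (≤-reflexive (*-comm 4 h)) (m/n*n≤m ℓ 4)) ⟩
      2 ^ ℓ                      ≤⟨ lo ⟩
      d                          ∎) ⟩
    t                            ∎
  1≤t : 1 ≤ t
  1≤t = ≤-trans (m^n>0 4 h) 4^h≤t
  degree≡ : 4 ^ h * t + r ≡ d
  degree≡ = trans (+-comm (4 ^ h * t) r) (trans (cong (λ z → r + z) (*-comm (4 ^ h) t)) (sym (m≡m%n+[m/n]*n d (4 ^ h))))
  ℓ≤8h : ℓ ≤ 8 * h
  ℓ≤8h = begin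
    ℓ                            ≡⟨ m≡m%n+[m/n]*n ℓ 4 ⟩
    ℓ % 4 + h * 4                ≤⟨ +-monoˡ-≤ (h * 4) (≤-trans (<⇒≤ (m%n<n ℓ 4)) (*-monoˡ-≤ 4 1≤h)) ⟩
    h * 4 + h * 4                ≡⟨ dbl h ⟩
    8 * h                        ∎
    where
    dbl : ∀ h → h * 4 + h * 4 ≡ 8 * h
    dbl = solve-∀
  arrange₁ : ∀ h e → 8 * h * e ≡ 8 * (e * h)
  arrange₁ = solve-∀
  arrange₂ : ∀ n t → 8 * (2 * (n * (2 * t))) ≡ 32 * (t * n)
  arrange₂ = solve-∀
  open BlowUp N (λ x y → form (nonzero h x) (nonzero h y)) (λ x y → form-sym (nonzero h x) (nonzero h y)) (λ x → form-self (nonzero h x))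
    (4 ^ h) (form-row h) t {{>-nonZero 1≤t}} r (≤-trans (<⇒≤ (m%n<n d (4 ^ h))) 4^h≤t)

hard-graph : ∀ d ℓ → 1 ≤ d → 2 ^ ℓ ≤ d → HardGraph d ℓ
hard-graph d ℓ 1≤d lo with ≤-total ℓ 4
... | inj₁ ℓ≤4 = hard-graph-small d ℓ 1≤d ℓ≤4
... | inj₂ 4≤ℓ = hard-graph-large d ℓ 4≤ℓ lo

log₂-of : ∀ d → 2 ≤ d → ∃[ ℓ ] 1 ≤ ℓ × 2 ^ ℓ ≤ d × d < 2 ^ suc ℓ
log₂-of d d≥2 with log₂-bracket d (≤-trans (s≤s z≤n) d≥2)
... | (zero  , _  , hi) = contradiction (<-≤-trans hi d≥2) (<-irrefl refl)
... | (suc ℓ , lo , hi) = suc ℓ , s≤s z≤n , lo , hi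

theorem1p2 : (∃[ c′ ] 0ʳ <ʳ c′ ×
    (∀ (d : ℕ) (d≥2 : 2 ≤ d) (n : ℕ) (G : Graph (Fin n)) → Regular d G →
    ∃[ H ] IsStarFactor G H ×
    (∀ S → IsComponent H S →
    (c′ *ʳ (d /log d by d≥2)) ≤ʳ fromNat (edgesWithin H S))))
    ×
    (∃[ C′ ] 0ʳ <ʳ C′ ×
    (∀ (d : ℕ) (d≥2 : 2 ≤ d) →
    ∃[ n ] 1 ≤ n × Σ[ G ∈ Graph (Fin n) ] Regular d G ×
    (∀ H → IsStarFactor G H →
    ∃[ S ] IsComponent H S ×
    fromNat (edgesWithin H S) ≤ʳ (C′ *ʳ (d /log d by d≥2)))))
theorem1p2 =
  (fromℚ (ℤ.+ 1 ℚ./ 800) , fromℚ-pos _ , λ d d≥2 n G regular →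
    let (ℓ , 1≤ℓ , lo , hi) = log₂-of d d≥2
        (H , starFactor , large) = star-factor-exists G d regular ℓ 1≤ℓ hi (≤-trans (s≤s z≤n) d≥2)
    in H , starFactor , λ S comp → d/log-≤ d d≥2 ℓ (edgesWithin H S) lo (large S comp)) ,
  (fromℚ (ι 96) , fromℚ-pos _ , λ d d≥2 →
    let (ℓ , 1≤ℓ , lo , hi) = log₂-of d d≥2
        (n , n≥1 , G , regular , hard) = hard-graph d ℓ (≤-trans (s≤s z≤n) d≥2) lo
    in n , n≥1 , G , regular , λ H starFactor →
      let (S , comp , small) = hard H starFactor
      in S , comp , ≤-d/log d d≥2 ℓ (edgesWithin H S) 1≤ℓ hi small)
  where
  fromℚ-pos : ∀ c .{{_ : ℚ.Positive c}} → 0ʳ <ʳ fromℚ c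
  fromℚ-pos c = c , ℚ.positive⁻¹ c , 0 , λ _ _ → ℚ.≤-reflexive (ℚ.+-identityˡ c)
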